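{- $IR(3,\mathbb F_2)$ is homotopy equivalent to a wedge of eight $3$-spheres: $$|IR(3,\mathbb F_2)|\simeq\bigvee_8 S^3.$$
   Context: A binary matroid (a matroid representable over $\mathbb F_2$) is regular if it has no minor isomorphic to the Fano matroid $F_7$ (the linear matroid on the seven nonzero vectors of $\mathbb F_2^3$) or to its dual $F_7^*$. Subsets of $\mathbb F_2^r$ are regarded as matroids under linear independence over $\mathbb F_2$. $IR(r,\mathbb F_2)$ is the poset, ordered by inclusion, of all subsets of $\mathbb F_2^r\setminus\{0\}$ which are regular matroids of rank $r$. The geometric realization $|P|$ of a poset $P$ is the geometric realization of its order complex (simplices are finite chains $x_0<\cdots<x_k$). -}

module Defs where

open import Algebra.Bundles using (CommutativeRing)
open import Algebra.Structures using (IsCommutativeRing)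
import Algebra.Properties.CommutativeMonoid.Sum as Summation
open import Data.Fin.Base using (Fin; zero; suc; toℕ; finToFun; funToFin)
import Data.Fin.Base as Fin
open import Data.Fin.Subset as Subset
  using (Subset; _∈_; _∉_; _⊆_; _∩_; _∪_; _─_; ∁; ⁅_⁆; ∣_∣; Empty)
open import Data.Fin.Subset.Properties using (⊆-poset)
open import Data.Nat.Base as ℕ using (ℕ; NonZero; parity)
open import Data.Parity.Base as ℙ using (Parity; 0ℙ)
import Data.Parity.Properties as ℙ
open import Data.Product.Base using (Σ; ∃; ∃₂; _×_; _,_; proj₁; proj₂)
open import Data.Product.Relation.Binary.Pointwise.NonDependent using (×-setoid)
open import Data.Sum.Base using (_⊎_; inj₁; inj₂)
open import Data.Unit.Base using (tt)
open import Data.Vec.Functional using (Vector)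
open import Data.Vec.Functional.Relation.Binary.Equality.Setoid
  using () renaming (≋-setoid to vectorSetoid)
open import Function.Base using (_∘_; id)
open import Function.Bundles using (Func; Inverse; _⇔_; _↔_)
import Function.Construct.Composition as Compose
import Function.Construct.Identity as Identity
open import Level using (0ℓ; Lift; lift; lower) renaming (suc to lsuc)
open import Relation.Binary.Bundles using (Setoid; Poset)
open import Relation.Binary.Core using (Rel)
open import Relation.Binary.Definitions using (_Respects_; Trans; tri<; tri≈; tri>)
open import Relation.Binary.Structures using (IsStrictTotalOrder)
import Relation.Binary.Construct.On as On
import Relation.Binary.Construct.StrictToNonStrict as StrictToNonStrict
import Relation.Binary.Properties.Poset as PosetProperties
open import Relation.Binary.PropositionalEquality.Core as ≡ using (_≡_)
open import Relation.Nullary.Negation.Core using (¬_)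
open import Relation.Unary as Pred using (Pred; _≐_)

private
  variable
    m n r : ℕ

------------------------------------------------------------------------
-- Matroids

-- As with the library's raw algebraic bundles, the independence axioms
-- are not part of the record.  The ground set is a subset of `Fin n`, so
-- that deletion and contraction do not change the ambient type.

record RawMatroid (n : ℕ) : Set₁ where
  field
    ground : Subset n
    Indep  : Subset n → Set

  IsBasisOf : Subset n → Subset n → Set
  IsBasisOf B X = B ⊆ X × Indep B × (∀ I → I ⊆ X → Indep I → B ⊆ I → I ⊆ B)

  IsBasis : Subset n → Set
  IsBasis B = IsBasisOf B ground

  HasRank : ℕ → Set
  HasRank k = ∃ λ B → IsBasis B × ∣ B ∣ ≡ k

open RawMatroid

infixl 6 _∖_ _/_

_∖_ : RawMatroid n → Subset n → RawMatroid n
M ∖ D = record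
  { ground = ground M ─ D
  ; Indep  = λ I → I ⊆ ground M ─ D × Indep M I
  }

_/_ : RawMatroid n → Subset n → RawMatroid n
M / C = record
  { ground = ground M ─ C
  ; Indep  = λ I → I ⊆ ground M ─ C × ∃ λ B → IsBasisOf M B C × Indep M (I ∪ B)
  }

dual : RawMatroid n → RawMatroid n
dual M = record
  { ground = ground M
  ; Indep  = λ I → I ⊆ ground M × ∃ λ B → IsBasis M B × Empty (I ∩ B)
  }

-- The premises of `indep` say that J is the image of I under φ.

record _≅_ (M : RawMatroid m) (N : RawMatroid n) : Set where
  field
    φ     : ∃ (_∈ ground M) ↔ ∃ (_∈ ground N)
    indep : ∀ I J → I ⊆ ground M → J ⊆ ground N →
            (∀ x → proj₁ x ∈ I ⇔ proj₁ (Inverse.to φ x) ∈ J) →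
            Indep M I ⇔ Indep N J

HasMinor : RawMatroid m → RawMatroid n → Set
HasMinor M N = ∃₂ λ C D →
  C ⊆ ground M × D ⊆ ground M × Empty (C ∩ D) × (M / C ∖ D) ≅ N

-- 𝔽₂ is the library's `Parity`.  The independent sets of `linear v E` are
-- the subsets of E along which the family v is linearly independent.

linear : (Fin n → Vector Parity r) → Subset n → RawMatroid n
linear {n} v E = record
  { ground = E
  ; Indep  = λ I → I ⊆ E × ((c : Vector Parity n) → (∀ i → i ∉ I → c i ≡ 0ℙ) →
               (∀ k → sum (λ i → c i ℙ.* v i k) ≡ 0ℙ) → ∀ i → c i ≡ 0ℙ)
  }
  where open Summation ℙ.+-0-commutativeMonoid using (sum)

Binary : RawMatroid n → Set
Binary {n} M = ∃₂ λ r (v : Fin n → Vector Parity r) →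
  ∀ I → Indep M I ⇔ Indep (linear v (ground M)) I

-- The vectors of 𝔽₂ʳ are numbered by their binary expansions.

vector : Fin (2 ℕ.^ r) → Vector Parity r
vector x k = parity (toℕ (finToFun x k))

nonzero : ∀ r → Subset (2 ℕ.^ r)
nonzero r = ∁ ⁅ funToFin {r} (λ _ → zero) ⁆

⟦_⟧ : Subset (2 ℕ.^ r) → RawMatroid (2 ℕ.^ r)
⟦_⟧ {r} = linear (vector {r})

F₇ : RawMatroid 8
F₇ = ⟦_⟧ {3} (nonzero 3)

Regular : RawMatroid n → Set
Regular M = Binary M × ¬ HasMinor M F₇ × ¬ HasMinor M (dual F₇)

IR : ℕ → Poset 0ℓ 0ℓ 0ℓ
IR r = On.poset (⊆-poset (2 ℕ.^ r)) underlying
  where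
  underlying : (Σ (Subset (2 ℕ.^ r)) λ S →
                S ⊆ nonzero r × Regular (⟦_⟧ {r} S) × HasRank (⟦_⟧ {r} S) r) →
               Subset (2 ℕ.^ r)
  underlying = proj₁

------------------------------------------------------------------------
-- The real numbers, axiomatised up to isomorphism

-- `sup` is phrased with witnesses: instead of being below every other
-- upper bound, s has elements of S above anything smaller than it.
-- Classically this is the least upper bound property.  Together with
-- trichotomy it makes the logic of `Set` classical, as for the classical
-- real numbers it should.

record CompleteOrderedField : Set₁ where
  infixl 7 _*_
  infixl 6 _+_
  infix  8 -_
  infix  4 _≈_ _<_ _≤_
  field
    Carrier            : Set
    _≈_ _<_            : Rel Carrier 0ℓ
    _+_ _*_            : Carrier → Carrier → Carrier
    -_                 : Carrier → Carrier
    0# 1#              : Carrier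
    isCommutativeRing  : IsCommutativeRing _≈_ _+_ _*_ -_ 0# 1#
    isStrictTotalOrder : IsStrictTotalOrder _≈_ _<_
    0<1                : 0# < 1#
    inverse            : ∀ x → ¬ x ≈ 0# → ∃ λ y → x * y ≈ 1#
    +-monoʳ-<          : ∀ x {y z} → y < z → x + y < x + z
    *-pos              : ∀ {x y} → 0# < x → 0# < y → 0# < x * y

  _≤_ : Rel Carrier 0ℓ
  _≤_ = StrictToNonStrict._≤_ _≈_ _<_

  field
    sup : (S : Pred Carrier 0ℓ) → ∃ S → (∃ λ b → ∀ x → S x → x ≤ b) →
          ∃ λ s → (∀ x → S x → x ≤ s) × (∀ x → x < s → ∃ λ y → S y × x < y)

  commutativeRing : CommutativeRing 0ℓ 0ℓ
  commutativeRing = record { isCommutativeRing = isCommutativeRing }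

  open IsStrictTotalOrder isStrictTotalOrder public
    using (compare; <-respʳ-≈; <-respˡ-≈) renaming (trans to <-trans)
  open CommutativeRing commutativeRing public
    using (setoid; refl; sym; trans; +-cong; +-congˡ; +-identityʳ;
           *-identityˡ; zeroˡ; +-commutativeMonoid)
  open Summation +-commutativeMonoid public using (sum; sum-cong-≋; sum-replicate-zero)

  <-≤-trans : Trans _<_ _≤_ _<_
  <-≤-trans = StrictToNonStrict.<-≤-trans _≈_ _<_ <-trans <-respʳ-≈

------------------------------------------------------------------------
-- Topological spaces

record TopologicalSpace : Set₂ where
  field
    points : Setoid 0ℓ 0ℓ

  open Setoid points public

  field
    Open   : Pred Carrier 0ℓ → Set₁
    resp-≐ : ∀ {U V} → U ≐ V → Open U → Open V
    resp-≈ : ∀ {U} → Open U → U Respects _≈_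
    whole  : Open Pred.U
    inter  : ∀ {U V} → Open U → Open V → Open (U Pred.∩ V)
    union  : (I : Set) (U : I → Pred Carrier 0ℓ) →
             (∀ i → Open (U i)) → Open (Pred.⋃ I U)

infix 3 _⇒_

record _⇒_ (X Y : TopologicalSpace) : Set₁ where
  private
    module X = TopologicalSpace X
    module Y = TopologicalSpace Y
  field
    func       : Func X.points Y.points
    continuous : ∀ V → Y.Open V → X.Open (V ∘ Func.to func)

  open Func func public using (to; cong)

idₜ : ∀ X → X ⇒ X
idₜ X = record
  { func = Identity.function (TopologicalSpace.points X)
  ; continuous = λ _ → id
  }

infixr 9 _∘ₜ_

_∘ₜ_ : ∀ {X Y Z} → Y ⇒ Z → X ⇒ Y → X ⇒ Z
g ∘ₜ f = record
  { func = Compose.function (_⇒_.func f) (_⇒_.func g)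
  ; continuous = λ V → _⇒_.continuous f _ ∘ _⇒_.continuous g V
  }

subspace : (X : TopologicalSpace) → Pred (TopologicalSpace.Carrier X) 0ℓ →
           TopologicalSpace
subspace X Q = record
  { points = On.setoid {B = ∃ Q} points proj₁
  ; Open   = λ U → ∃ λ V → Open V × U ≐ (V ∘ proj₁)
  ; resp-≐ = λ { (p , q) (V , oV , f , g) → V , oV , f ∘ q , p ∘ g }
  ; resp-≈ = λ { (V , oV , f , g) x≈y Ux → g (resp-≈ oV x≈y (f Ux)) }
  ; whole  = Pred.U , whole , (λ _ → tt) , (λ _ → tt)
  ; inter  = λ { (V , oV , f , g) (V′ , oV′ , f′ , g′) →
               V Pred.∩ V′ , inter oV oV′ ,
               (λ { (u , u′) → f u , f′ u′ }) , (λ { (v , v′) → g v , g′ v′ }) }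
  ; union  = λ I U o → (Pred.⋃ I (proj₁ ∘ o)) , union I _ (λ i → proj₁ (proj₂ (o i))) ,
               (λ { (i , u) → i , proj₁ (proj₂ (proj₂ (o i))) u }) ,
               (λ { (i , v) → i , proj₂ (proj₂ (proj₂ (o i))) v })
  }
  where open TopologicalSpace X

infixr 4 _×ₜ_

_×ₜ_ : TopologicalSpace → TopologicalSpace → TopologicalSpace
X ×ₜ Y = record
  { points = ×-setoid X.points Y.points
  ; Open   = λ W → ∀ p → W p → ∃₂ λ U V →
               X.Open U × Y.Open V × (U Pred.⟨×⟩ V) p × (U Pred.⟨×⟩ V) Pred.⊆ W
  ; resp-≐ = λ { (f , g) o p w → let (U , V , oU , oV , uv , s) = o p (g w) in
               U , V , oU , oV , uv , λ q → f (s q) }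
  ; resp-≈ = λ { o {p} (x≈ , y≈) w → let (U , V , oU , oV , (u , v) , s) = o p w in
               s (X.resp-≈ oU x≈ u , Y.resp-≈ oV y≈ v) }
  ; whole  = λ _ _ → Pred.U , Pred.U , X.whole , Y.whole , (tt , tt) , (λ _ → tt)
  ; inter  = λ o o′ p (w , w′) →
               let (U , V , oU , oV , (u , v) , s) = o p w
                   (U′ , V′ , oU′ , oV′ , (u′ , v′) , s′) = o′ p w′
               in U Pred.∩ U′ , V Pred.∩ V′ , X.inter oU oU′ , Y.inter oV oV′ ,
                  ((u , u′) , (v , v′)) ,
                  λ { ((a , a′) , (b , b′)) → s (a , b) , s′ (a′ , b′) }
  ; union  = λ I W o p (i , w) →
               let (U , V , oU , oV , uv , s) = o i p w
               in U , V , oU , oV , uv , λ q → i , s q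
  }
  where
  module X = TopologicalSpace X
  module Y = TopologicalSpace Y

-- The wedge of k copies of X at the base point x₀, with the quotient
-- topology.  For k = 0 the identification below would give the empty
-- space rather than a point.

⋁ : ∀ k .{{_ : NonZero k}} (X : TopologicalSpace) → TopologicalSpace.Carrier X →
    TopologicalSpace
⋁ k X x₀ = record
  { points = record
    { Carrier       = Fin k × Carrier
    ; _≈_           = _∼_
    ; isEquivalence = record
      { refl = inj₁ (≡.refl , refl) ; sym = ∼-sym ; trans = ∼-trans }
    }
  ; Open   = λ U → U Respects _∼_ × (∀ i → Open (λ x → U (i , x)))
  ; resp-≐ = λ { (f , g) (r , o) →
               (λ p∼q → f ∘ r p∼q ∘ g) , λ i → resp-≐ (f , g) (o i) }
  ; resp-≈ = proj₁
  ; whole  = (λ _ _ → tt) , λ _ → whole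
  ; inter  = λ { (r , o) (r′ , o′) →
               (λ { p∼q (u , u′) → r p∼q u , r′ p∼q u′ }) , λ i → inter (o i) (o′ i) }
  ; union  = λ I U o →
               (λ { p∼q (i , u) → i , proj₁ (o i) p∼q u }) ,
               λ j → union I _ (λ i → proj₂ (o i) j)
  }
  where
  open TopologicalSpace X

  _∼_ : Rel (Fin k × Carrier) 0ℓ
  (i , x) ∼ (j , y) = (i ≡ j × x ≈ y) ⊎ (x ≈ x₀ × y ≈ x₀)

  ∼-sym : ∀ {p q} → p ∼ q → q ∼ p
  ∼-sym (inj₁ (i≡j , x≈y)) = inj₁ (≡.sym i≡j , sym x≈y)
  ∼-sym (inj₂ (x≈ , y≈))   = inj₂ (y≈ , x≈)

  ∼-trans : ∀ {p q s} → p ∼ q → q ∼ s → p ∼ s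
  ∼-trans (inj₁ (i≡j , x≈y)) (inj₁ (j≡k , y≈z)) = inj₁ (≡.trans i≡j j≡k , trans x≈y y≈z)
  ∼-trans (inj₁ (_ , x≈y))   (inj₂ (y≈ , z≈))   = inj₂ (trans x≈y y≈ , z≈)
  ∼-trans (inj₂ (x≈ , y≈))   (inj₁ (_ , y≈z))   = inj₂ (x≈ , trans (sym y≈z) y≈)
  ∼-trans (inj₂ (x≈ , _))    (inj₂ (_ , z≈))    = inj₂ (x≈ , z≈)

module Topology (ℝ : CompleteOrderedField) where

  private
    module ℝ = CompleteOrderedField ℝ
  open ℝ using (0#; 1#; _+_; _*_; _<_; _≤_; sum)

  -- ∣ x - y ∣ < ε
  Close : ℝ.Carrier → Rel ℝ.Carrier 0ℓ
  Close ε x y = x < y + ε × y < x + ε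

  private
    Positive = ∃ λ ε → 0# < ε

    +-monoʳ-≤ : ∀ x {y z} → y ≤ z → x + y ≤ x + z
    +-monoʳ-≤ x (inj₁ y<z) = inj₁ (ℝ.+-monoʳ-< x y<z)
    +-monoʳ-≤ x (inj₂ y≈z) = inj₂ (ℝ.+-congˡ y≈z)

    close-mono : ∀ {δ ε x y} → δ ≤ ε → Close δ x y → Close ε x y
    close-mono δ≤ε (p , q) =
      ℝ.<-≤-trans p (+-monoʳ-≤ _ δ≤ε) , ℝ.<-≤-trans q (+-monoʳ-≤ _ δ≤ε)

    close-refl : ∀ {ε x y} → 0# < ε → x ℝ.≈ y → Close ε x y
    close-refl 0<ε x≈y = lt x≈y , lt (ℝ.sym x≈y)
      where
      lt : ∀ {x y} → x ℝ.≈ y → x < y + _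
      lt x≈y = ℝ.<-respˡ-≈ (ℝ.trans (ℝ.+-identityʳ _) (ℝ.sym x≈y)) (ℝ.+-monoʳ-< _ 0<ε)

    lower-bound : ∀ {δ ε} → 0# < δ → 0# < ε → ∃ λ ζ → 0# < ζ × ζ ≤ δ × ζ ≤ ε
    lower-bound {δ} {ε} 0<δ 0<ε with ℝ.compare δ ε
    ... | tri< δ<ε _ _ = δ , 0<δ , inj₂ ℝ.refl , inj₁ δ<ε
    ... | tri≈ _ δ≈ε _ = δ , 0<δ , inj₂ ℝ.refl , inj₂ δ≈ε
    ... | tri> _ _ ε<δ = ε , 0<ε , inj₁ ε<δ , inj₂ ℝ.refl

  -- The product topology, given by the sup-metric.
  ℝ^_ : ℕ → TopologicalSpace
  ℝ^ n = record
    { points = vectorSetoid ℝ.setoid n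
    ; Open   = λ U → Lift (lsuc 0ℓ) (∀ x → U x →
                 ∃ λ ε → 0# < ε × (∀ y → (∀ i → Close ε (x i) (y i)) → U y))
    ; resp-≐ = λ { (f , g) (lift o) → lift λ x u →
                 let (ε , 0<ε , b) = o x (g u) in ε , 0<ε , λ y c → f (b y c) }
    ; resp-≈ = λ { (lift o) {x} x≈y u →
                 let (ε , 0<ε , b) = o x u in b _ (λ i → close-refl 0<ε (x≈y i)) }
    ; whole  = lift λ _ _ → 1# , ℝ.0<1 , λ _ _ → tt
    ; inter  = λ { (lift o) (lift o′) → lift λ { x (u , u′) →
                 let (δ , 0<δ , b) = o x u
                     (ε , 0<ε , b′) = o′ x u′
                     (ζ , 0<ζ , ζ≤δ , ζ≤ε) = lower-bound 0<δ 0<ε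
                 in ζ , 0<ζ , λ y c → b y (λ i → close-mono ζ≤δ (c i)) ,
                                      b′ y (λ i → close-mono ζ≤ε (c i)) } }
    ; union  = λ I U o → lift λ { x (i , u) →
                 let (ε , 0<ε , b) = lower (o i) x u in ε , 0<ε , λ y c → i , b y c }
    }

  unitInterval : TopologicalSpace
  unitInterval = subspace (ℝ^ 1) λ x → 0# ≤ x zero × x zero ≤ 1#

  𝕀₀ 𝕀₁ : TopologicalSpace.Carrier unitInterval
  𝕀₀ = (λ _ → 0#) , inj₂ ℝ.refl , inj₁ ℝ.0<1
  𝕀₁ = (λ _ → 1#) , inj₁ ℝ.0<1 , inj₂ ℝ.refl

  𝕊 : ℕ → TopologicalSpace
  𝕊 n = subspace (ℝ^ (ℕ.suc n)) λ x → sum (λ i → x i * x i) ℝ.≈ 1#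

  basePoint : ∀ n → TopologicalSpace.Carrier (𝕊 n)
  basePoint n = e₀ , ℝ.trans (ℝ.+-cong (ℝ.*-identityˡ 1#) rest) (ℝ.+-identityʳ 1#)
    where
    e₀ : Vector ℝ.Carrier (ℕ.suc n)
    e₀ zero    = 1#
    e₀ (suc _) = 0#
    rest : sum {n} (λ _ → 0# * 0#) ℝ.≈ 0#
    rest = ℝ.trans (ℝ.sum-cong-≋ {n} (λ _ → ℝ.zeroˡ 0#)) (ℝ.sum-replicate-zero n)

  Homotopic : ∀ {X Y} → X ⇒ Y → X ⇒ Y → Set₁
  Homotopic {X} {Y} f g = Σ (X ×ₜ unitInterval ⇒ Y) λ H →
    (∀ x → _⇒_.to H (x , 𝕀₀) Y.≈ _⇒_.to f x) ×
    (∀ x → _⇒_.to H (x , 𝕀₁) Y.≈ _⇒_.to g x)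
    where module Y = TopologicalSpace Y

  infix 2 _≃_

  _≃_ : TopologicalSpace → TopologicalSpace → Set₁
  X ≃ Y = Σ (X ⇒ Y) λ f → Σ (Y ⇒ X) λ g →
    Homotopic (g ∘ₜ f) (idₜ X) × Homotopic (f ∘ₜ g) (idₜ Y)

  -- A point of the realization of the order complex is given by its
  -- barycentric coordinates, which are carried by some simplex, that is by
  -- some chain c zero < c (suc zero) < ⋯.  A set is open when its trace on
  -- each closed simplex is open, i.e. in the weak topology.

  module Realization (P : Poset 0ℓ 0ℓ 0ℓ) where
    private
      module P = Poset P
      module < = PosetProperties P

    record Simplex : Set where
      field
        dim        : ℕ
        vertex     : Fin (ℕ.suc dim) → P.Carrier
        increasing : ∀ {i j} → i Fin.< j → vertex i <.< vertex j

    open Simplex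

    CarriedBy : Simplex → (P.Carrier → ℝ.Carrier) → Set
    CarriedBy σ t = (∀ p → (∀ i → ¬ p P.≈ vertex σ i) → t p ℝ.≈ 0#) ×
                    sum (t ∘ vertex σ) ℝ.≈ 1#

    record Point : Set where
      field
        coord   : P.Carrier → ℝ.Carrier
        cong    : ∀ {p q} → p P.≈ q → coord p ℝ.≈ coord q
        nonNeg  : ∀ p → 0# ≤ coord p
        carried : ∃ λ σ → CarriedBy σ coord

    open Point

    realization : TopologicalSpace
    realization = record
      { points = record
        { Carrier       = Point
        ; _≈_           = λ x y → ∀ p → coord x p ℝ.≈ coord y p
        ; isEquivalence = record
          { refl  = λ _ → ℝ.refl
          ; sym   = λ x≈y p → ℝ.sym (x≈y p)
          ; trans = λ x≈y y≈z p → ℝ.trans (x≈y p) (y≈z p)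
          }
        }
      ; Open   = λ U → Lift (lsuc 0ℓ) (∀ σ x → CarriedBy σ (coord x) → U x →
                   ∃ λ ε → 0# < ε × (∀ y → CarriedBy σ (coord y) →
                     (∀ i → Close ε (coord x (vertex σ i)) (coord y (vertex σ i))) → U y))
      ; resp-≐ = λ { (f , g) (lift o) → lift λ σ x cx u →
                   let (ε , 0<ε , b) = o σ x cx (g u) in ε , 0<ε , λ y cy c → f (b y cy c) }
      ; resp-≈ = λ { (lift o) {x} {y} x≈y u →
                   let (σ , z , s)   = carried x
                       (ε , 0<ε , b) = o σ x (z , s) u
                   in b y ((λ p p∉ → ℝ.trans (ℝ.sym (x≈y p)) (z p p∉)) ,
                           ℝ.trans (ℝ.sum-cong-≋ (λ i → ℝ.sym (x≈y (vertex σ i)))) s)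
                          (λ i → close-refl 0<ε (x≈y (vertex σ i))) }
      ; whole  = lift λ _ _ _ _ → 1# , ℝ.0<1 , λ _ _ _ → tt
      ; inter  = λ { (lift o) (lift o′) → lift λ { σ x cx (u , u′) →
                   let (δ , 0<δ , b) = o σ x cx u
                       (ε , 0<ε , b′) = o′ σ x cx u′
                       (ζ , 0<ζ , ζ≤δ , ζ≤ε) = lower-bound 0<δ 0<ε
                   in ζ , 0<ζ , λ y cy c → b y cy (λ i → close-mono ζ≤δ (c i)) ,
                                           b′ y cy (λ i → close-mono ζ≤ε (c i)) } }
      ; union  = λ I U o → lift λ { σ x cx (i , u) →
                   let (ε , 0<ε , b) = lower (o i) σ x cx u
                   in ε , 0<ε , λ y cy c → i , b y cy c }
      }

  ∥_∥ : Poset 0ℓ 0ℓ 0ℓ → TopologicalSpace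
  ∥ P ∥ = Realization.realization P

{-# OPTIONS --safe #-}
module Submission where

-- Complementation turns IR(3, 𝔽₂) into the opposite of the face poset of the complex
-- K on the seven points of the Fano plane whose minimal nonfaces are the complements
-- of the seven lines: a set of points spans iff it meets each of these complements,
-- and the whole plane is the only nonregular spanning set.
--
-- The realization of the face poset is compared with the cone of nonzero nonnegative
-- vectors carried by a face of K.  A chain of weighted faces is sent to the weighted
-- sum of their indicator vectors, and a vector x to the chain of its superlevel sets
-- {p : x p > c}; both composites move points inside single simplices.  Working with
-- the cone rather than with barycentric coordinates avoids most normalisations.
--
-- Eight facets Fᵢ of K (tetrahedra) are chosen such that the complex left after
-- removing their interiors, the core, collapses to a vertex.  With T a set of vertices
-- such that v can be added to each face containing T, the collapse is the map
-- x ↦ x + min_T x · (e_v - 1_T), which fixes all vectors not supported on T.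
-- The map to the wedge sends x to the i-th sphere, where mᵢ(x) = min_{Fᵢ} x > 0, by
-- normalising (max x - 2 mᵢ(x), mᵢ(x) · differences of the coordinates on Fᵢ);
-- the core goes to the base point.  Conversely the i-th sphere is mapped to Fᵢ with
-- its boundary contracted along the collapse.  One composite is never antipodal to the
-- identity, and the other one is deformed to the identity by first removing the
-- contribution of the apex, then undoing the collapse, and then moving inside Fᵢ.

open import Defs
open import Algebra.Bundles using (CommutativeRing)
open import Algebra.Construct.NaturalChoice.Base using (MinOperator; MaxOperator)
import Algebra.Construct.NaturalChoice.MinMaxOp as MinMaxOp
open import Algebra.Properties.AbelianGroup using (⁻¹-∙-comm)
import Algebra.Properties.CommutativeMonoid.Sum as Summation
import Algebra.Properties.Ring as RingProperties
import Algebra.Properties.Semiring.Mult.TCOptimised as Mult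
import Algebra.Solver.Ring
open import Algebra.Solver.Ring.AlmostCommutativeRing using (_-Raw-AlmostCommutative⟶_; fromCommutativeRing)
open import Data.Bool.Base using (Bool; true; false)
import Data.Bool.Properties as Bool
open import Data.Empty using (⊥; ⊥-elim)
open import Data.Fin.Base using (Fin; zero; suc; punchOut)
import Data.Fin.Base as Fin
open import Data.Fin.Patterns using (0F; 1F; 2F; 3F; 4F; 5F; 6F)
import Data.Fin.Properties as Fin
open import Data.Fin.Subset as Subset
  using (Subset; inside; outside; _∈_; _∉_; _⊆_; _⊈_; _∪_; _─_; ∣_∣; ⁅_⁆; Nonempty; ∁)
open import Data.Fin.Subset.Properties
  using (_∈?_; _⊆?_; anySubset?; nonempty?; ∈⊤; ⊆⊤; ∉⊥; x∈⁅x⁆; ⊆-antisym; drop-there; drop-∷-⊆; out⊆;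
         x∈p∪q⁺; x∈p∪q⁻; p⊆p∪q; x∈p∩q⁻; x∈p∧x≢y⇒x∈p-y; p─q⊆p; p⊂q⇒∣p∣<∣q∣;
         x∈p⇒x∉∁p; x∈∁p⇒x∉p; x∉∁p⇒x∈p; x∉p⇒x∈∁p; p⊆q⇒∁p⊇∁q; ∁p⊆∁q⇒p⊇q)
open import Data.Integer.Base as ℤ using (ℤ; +_; -[1+_]; +[1+_])
import Data.Integer.Properties as ℤ
open import Data.List.Base as List using (List; []; _∷_; _++_; length; filter) renaming (tabulate to tabulateᴸ)
import Data.List.Membership.Propositional as Membership
import Data.List.Membership.Propositional.Properties as Membership
open import Data.List.Relation.Unary.All as All using (All; []; _∷_)
import Data.List.Relation.Unary.All.Properties as All
open import Data.List.Relation.Unary.AllPairs as AllPairs using (AllPairs; []; _∷_)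
import Data.List.Relation.Unary.AllPairs.Properties as AllPairs
open import Data.List.Relation.Unary.Any as Any using (Any; here; there)
import Data.List.Relation.Unary.Any.Properties as Any
open import Data.Maybe.Base using (Maybe; just; nothing)
open import Data.Nat.Base as ℕ using (ℕ; zero; suc; s≤s; nonZero)
import Data.Nat.Properties as ℕ
open import Data.Parity.Base as ℙ using (Parity; 0ℙ; 1ℙ)
import Data.Parity.Properties as ℙ
open import Data.Product.Base using (Σ; ∃; ∃₂; _×_; _,_; proj₁; proj₂)
open import Data.Sum.Base using (_⊎_; inj₁; inj₂; [_,_]; [_,_]′)
open import Data.Unit.Base using (⊤; tt)
open import Data.Vec.Base as Vec using (Vec; []; _∷_; here; there; tabulate)
open import Data.Vec.Functional using (Vector)
import Data.Vec.Properties as Vec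
open import Function.Base using (_∘_; id)
open import Function.Bundles using (Inverse; Equivalence; mk⇔; _⇔_)
import Function.Construct.Identity as Identity
open import Level using (0ℓ; lift)
open import Relation.Binary.Bundles using (StrictTotalOrder; DecTotalOrder; Poset)
open import Relation.Binary.Definitions using (tri<; tri≈; tri>)
import Relation.Binary.Properties.StrictTotalOrder as StrictTotalOrderProperties
open import Relation.Binary.PropositionalEquality.Core as ≡ using (_≡_)
import Relation.Binary.Reasoning.Setoid as SetoidReasoning
open import Relation.Nullary.Decidable as Dec
  using (Dec; yes; no; does; ¬?; _×-dec_; _→-dec_; dec-true; decidable-stable; from-yes)
open import Relation.Nullary.Negation.Core using (¬_)
open import Relation.Unary using (Pred; _∩_)

-- The number of removed facets is forced. All sets of at most three points are faces of K, so are
-- 28 of the 35 four-point sets, and no larger set is, because any two points lie on a line; the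
-- reduced Euler characteristic is -1 + 7 - 21 + 35 - 28 = -8. Collapses preserve it, so exactly
-- eight tetrahedra must go before a vertex can be reached.
--
-- Maps and homotopies are formulas in sums, products, minima, maxima, inverses and square roots, so
-- that continuity follows the shape of the formula. The price is that each formula must be shown to
-- stay in the cone, and above all to avoid the zero vector. This shapes the inverse map: the lift
-- of a sphere point tends to zero at the base point, so weight at the apex is added there, and the
-- last homotopy has to remove that weight again without vanishing. The choice of a facet is
-- discontinuous, but it changes only across points where all the minima vanish, and there the
-- formulas for all facets agree.

-- Polynomial identities with integer coefficients.

module IntegerCoefficients {c ℓ} (R : CommutativeRing c ℓ) where
  open CommutativeRing R
  open Mult semiring using (1+×; ×-homo-+; ×1-homo-*) renaming (_×_ to _·_)
  open RingProperties ring using (-0#≈0#; -‿involutive; -‿distribˡ-*; -‿distribʳ-*)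
  open SetoidReasoning setoid

  -- With this form of multiplication the numerals compute to `1#`, `1# + 1#` and so on, exactly as
  -- `2#` and `3#` are written later, so solved equations match them definitionally.
  fromℤ : ℤ → Carrier
  fromℤ (+ n)     = n · 1#
  fromℤ -[1+ n ] = - (suc n · 1#)

  neg-homo : ∀ i → fromℤ (ℤ.- i) ≈ - fromℤ i
  neg-homo (+ zero)  = sym -0#≈0#
  neg-homo +[1+ n ]  = refl
  neg-homo -[1+ n ] = sym (-‿involutive _)

  cancel-1# : ∀ a b → (1# + a) + - (1# + b) ≈ a + - b
  cancel-1# a b = begin
    (1# + a) + - (1# + b)     ≈⟨ +-cong (+-comm _ _) (sym (⁻¹-∙-comm +-abelianGroup 1# b)) ⟩
    (a + 1#) + (- 1# + - b)   ≈⟨ +-assoc _ _ _ ⟩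
    a + (1# + (- 1# + - b))   ≈⟨ +-congˡ (+-assoc _ _ _) ⟨
    a + ((1# + - 1#) + - b)   ≈⟨ +-congˡ (+-congʳ (-‿inverseʳ 1#)) ⟩
    a + (0# + - b)            ≈⟨ +-congˡ (+-identityˡ _) ⟩
    a + - b                   ∎

  ⊖-homo : ∀ m n → fromℤ (m ℤ.⊖ n) ≈ m · 1# + - (n · 1#)
  ⊖-homo zero zero       = sym (-‿inverseʳ 0#)
  ⊖-homo zero (suc n)    = sym (+-identityˡ _)
  ⊖-homo (suc m) zero    = sym (trans (+-congˡ -0#≈0#) (+-identityʳ _))
  ⊖-homo (suc m) (suc n) = begin
    fromℤ (suc m ℤ.⊖ suc n)              ≡⟨ ≡.cong fromℤ (ℤ.[1+m]⊖[1+n]≡m⊖n m n) ⟩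
    fromℤ (m ℤ.⊖ n)                      ≈⟨ ⊖-homo m n ⟩
    m · 1# + - (n · 1#)                  ≈⟨ cancel-1# _ _ ⟨
    (1# + m · 1#) + - (1# + n · 1#)      ≈⟨ +-cong (1+× m 1#) (-‿cong (1+× n 1#)) ⟨
    suc m · 1# + - (suc n · 1#)          ∎

  +-homo : ∀ i j → fromℤ (i ℤ.+ j) ≈ fromℤ i + fromℤ j
  +-homo (+ m)     (+ n)     = ×-homo-+ 1# m n
  +-homo (+ m)     -[1+ n ] = ⊖-homo m (suc n)
  +-homo -[1+ m ] (+ n)     = trans (⊖-homo n (suc m)) (+-comm _ _)
  +-homo -[1+ m ] -[1+ n ] = begin
    fromℤ (-[1+ m ] ℤ.+ -[1+ n ])        ≡⟨ ≡.cong fromℤ (ℤ.neg-distrib-+ +[1+ m ] +[1+ n ]) ⟨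
    fromℤ (ℤ.- (+[1+ m ] ℤ.+ +[1+ n ]))  ≈⟨ neg-homo (+[1+ m ] ℤ.+ +[1+ n ]) ⟩
    - ((suc m ℕ.+ suc n) · 1#)           ≈⟨ -‿cong (×-homo-+ 1# (suc m) (suc n)) ⟩
    - (suc m · 1# + suc n · 1#)          ≈⟨ ⁻¹-∙-comm +-abelianGroup _ _ ⟨
    - (suc m · 1#) + - (suc n · 1#)      ∎

  *-homo-pos : ∀ i n → fromℤ (i ℤ.* (+ n)) ≈ fromℤ i * (n · 1#)
  *-homo-pos (+ m)     n = trans (reflexive (≡.cong fromℤ (≡.sym (ℤ.pos-* m n)))) (×1-homo-* m n)
  *-homo-pos -[1+ m ] n = begin
    fromℤ (-[1+ m ] ℤ.* + n)         ≡⟨ ≡.cong fromℤ (ℤ.neg-distribˡ-* +[1+ m ] (+ n)) ⟨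
    fromℤ (ℤ.- (+[1+ m ] ℤ.* + n))   ≈⟨ neg-homo (+[1+ m ] ℤ.* + n) ⟩
    - fromℤ (+[1+ m ] ℤ.* + n)       ≈⟨ -‿cong (*-homo-pos +[1+ m ] n) ⟩
    - (suc m · 1# * (n · 1#))        ≈⟨ -‿distribˡ-* _ _ ⟩
    - (suc m · 1#) * (n · 1#)        ∎

  *-homo : ∀ i j → fromℤ (i ℤ.* j) ≈ fromℤ i * fromℤ j
  *-homo i (+ n)     = *-homo-pos i n
  *-homo i -[1+ n ] = begin
    fromℤ (i ℤ.* -[1+ n ])           ≡⟨ ≡.cong fromℤ (ℤ.neg-distribʳ-* i +[1+ n ]) ⟨
    fromℤ (ℤ.- (i ℤ.* +[1+ n ]))     ≈⟨ neg-homo (i ℤ.* +[1+ n ]) ⟩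
    - fromℤ (i ℤ.* +[1+ n ])         ≈⟨ -‿cong (*-homo-pos i (suc n)) ⟩
    - (fromℤ i * (suc n · 1#))       ≈⟨ -‿distribʳ-* _ _ ⟩
    fromℤ i * - (suc n · 1#)         ∎

  morphism : ℤ.+-*-rawRing -Raw-AlmostCommutative⟶ fromCommutativeRing R
  morphism = record
    { ⟦_⟧ = fromℤ ; +-homo = +-homo ; *-homo = *-homo ; -‿homo = neg-homo
    ; 0-homo = refl ; 1-homo = refl }

  fromℤ-≟ : ∀ i j → Maybe (fromℤ i ≈ fromℤ j)
  fromℤ-≟ i j with i ℤ.≟ j
  ... | yes ≡.refl = just refl
  ... | no _       = nothing

  open Algebra.Solver.Ring ℤ.+-*-rawRing (fromCommutativeRing R) morphism fromℤ-≟ public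
    using (solve; _:=_; _:+_; _:*_; _:-_; :-_; con)

-- Ordered-field arithmetic, minima and maxima, square roots.

module OrderedField (ℝ : CompleteOrderedField) where
  open CompleteOrderedField ℝ public
  open CommutativeRing commutativeRing public
    using (ring; +-congʳ; *-cong; *-congˡ; *-congʳ; -‿cong; reflexive; +-identityˡ; *-identityʳ; zeroʳ;
           *-comm; +-comm; -‿inverseʳ)
  open IntegerCoefficients commutativeRing public using (solve; _:=_; _:+_; _:*_; _:-_; :-_; con)
  open Topology ℝ public

  strictTotalOrder : StrictTotalOrder 0ℓ 0ℓ 0ℓ
  strictTotalOrder = record { isStrictTotalOrder = isStrictTotalOrder }

  decTotalOrder : DecTotalOrder 0ℓ 0ℓ 0ℓ
  decTotalOrder = StrictTotalOrderProperties.decTotalOrder strictTotalOrder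

  open DecTotalOrder decTotalOrder public
    using (total; totalPreorder; ≤-respʳ-≈; ≤-respˡ-≈; _≤?_)
    renaming (refl to ≤-refl; trans to ≤-trans; antisym to ≤-antisym; reflexive to ≤-reflexive)
  open StrictTotalOrder strictTotalOrder public using () renaming (irrefl to <-irrefl; asym to <-asym)

  infixl 6 _-_
  _-_ : Carrier → Carrier → Carrier
  x - y = x + - y

  2# : Carrier
  2# = 1# + 1#

  <⇒≤ : ∀ {x y} → x < y → x ≤ y
  <⇒≤ = inj₁

  ≤-<-trans : ∀ {x y z} → x ≤ y → y < z → x < z
  ≤-<-trans (inj₁ x<y) y<z = <-trans x<y y<z
  ≤-<-trans (inj₂ x≈y) y<z = <-respˡ-≈ (sym x≈y) y<z

  <-irrefl′ : ∀ {x} → ¬ x < x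
  <-irrefl′ = <-irrefl refl

  ≤⇒≯ : ∀ {x y} → x ≤ y → ¬ y < x
  ≤⇒≯ x≤y y<x = <-irrefl′ (≤-<-trans x≤y y<x)

  <-≤-total : ∀ x y → x < y ⊎ y ≤ x
  <-≤-total x y with compare x y
  ... | tri< x<y _ _ = inj₁ x<y
  ... | tri≈ _ x≈y _ = inj₂ (inj₂ (sym x≈y))
  ... | tri> _ _ y<x = inj₂ (inj₁ y<x)

  ≮⇒≥ : ∀ {x y} → ¬ x < y → y ≤ x
  ≮⇒≥ {x} {y} x≮y = [ ⊥-elim ∘ x≮y , id ]′ (<-≤-total x y)

  0≤⇒≈⊎< : ∀ {x} → 0# ≤ x → x ≈ 0# ⊎ 0# < x
  0≤⇒≈⊎< (inj₁ 0<x) = inj₂ 0<x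
  0≤⇒≈⊎< (inj₂ 0≈x) = inj₁ (sym 0≈x)

  gap< : ∀ {x y} → x < y → 0# < y - x
  gap< {x} {y} x<y = <-respˡ-≈ (solve 1 (λ x → :- x :+ x := con (+ 0)) refl x)
                    (<-respʳ-≈ (+-comm _ _) (+-monoʳ-< (- x) x<y))

  gap≤ : ∀ {x y} → x ≤ y → 0# ≤ y - x
  gap≤ (inj₁ x<y) = inj₁ (gap< x<y)
  gap≤ {x} {y} (inj₂ x≈y) = inj₂ (trans (sym (-‿inverseʳ x)) (+-congʳ x≈y))

  -- Splits an estimate into a positive expression and an identity for the ring solver. Most
  -- inequalities below are proved through this lemma or its weak form `le`.
  lt : ∀ {x y e} → 0# < e → e ≈ y - x → x < y
  lt {x} {y} 0<e e≈ = <-respˡ-≈ (+-identityʳ x)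
    (<-respʳ-≈ (trans (+-congˡ e≈) (solve 2 (λ x y → x :+ (y :- x) := y) refl x y)) (+-monoʳ-< x 0<e))

  le : ∀ {x y e} → 0# ≤ e → e ≈ y - x → x ≤ y
  le (inj₁ 0<e) e≈ = inj₁ (lt 0<e e≈)
  le {x} {y} (inj₂ 0≈e) e≈ = inj₂ (trans (sym (+-identityʳ x)) (trans (+-congˡ (trans 0≈e e≈))
    (solve 2 (λ x y → x :+ (y :- x) := y) refl x y)))

  +-pos : ∀ {x y} → 0# < x → 0# < y → 0# < x + y
  +-pos {x} 0<x 0<y = <-trans 0<x (<-respˡ-≈ (+-identityʳ x) (+-monoʳ-< x 0<y))

  +-nonNeg : ∀ {x y} → 0# ≤ x → 0# ≤ y → 0# ≤ x + y
  +-nonNeg (inj₁ p) (inj₁ q) = inj₁ (+-pos p q)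
  +-nonNeg (inj₁ p) (inj₂ q) = inj₁ (<-respʳ-≈ (trans (sym (+-identityʳ _)) (+-congˡ q)) p)
  +-nonNeg (inj₂ p) q        = ≤-respʳ-≈ (trans (sym (+-identityˡ _)) (+-congʳ p)) q

  +-nonNeg-pos : ∀ {x y} → 0# ≤ x → 0# < y → 0# < x + y
  +-nonNeg-pos (inj₁ p) q = +-pos p q
  +-nonNeg-pos (inj₂ p) q = <-respʳ-≈ (trans (sym (+-identityˡ _)) (+-congʳ p)) q

  +-pos-nonNeg : ∀ {x y} → 0# < x → 0# ≤ y → 0# < x + y
  +-pos-nonNeg p q = <-respʳ-≈ (+-comm _ _) (+-nonNeg-pos q p)

  *-nonNeg : ∀ {x y} → 0# ≤ x → 0# ≤ y → 0# ≤ x * y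
  *-nonNeg (inj₁ p) (inj₁ q) = inj₁ (*-pos p q)
  *-nonNeg (inj₁ p) (inj₂ q) = inj₂ (trans (sym (zeroʳ _)) (*-congˡ q))
  *-nonNeg (inj₂ p) q        = inj₂ (trans (sym (zeroˡ _)) (*-congʳ p))

  +-mono-< : ∀ {a b c d} → a < b → c < d → a + c < b + d
  +-mono-< {a} {b} {c} {d} p q = lt (+-pos (gap< p) (gap< q))
    (solve 4 (λ a b c d → (b :- a) :+ (d :- c) := (b :+ d) :- (a :+ c)) refl a b c d)

  +-mono-≤ : ∀ {a b c d} → a ≤ b → c ≤ d → a + c ≤ b + d
  +-mono-≤ {a} {b} {c} {d} p q = le (+-nonNeg (gap≤ p) (gap≤ q))
    (solve 4 (λ a b c d → (b :- a) :+ (d :- c) := (b :+ d) :- (a :+ c)) refl a b c d)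

  *-monoʳ-≤ : ∀ {a b c} → 0# ≤ a → b ≤ c → a * b ≤ a * c
  *-monoʳ-≤ {a} {b} {c} p q = le (*-nonNeg p (gap≤ q))
    (solve 3 (λ a b c → a :* (c :- b) := a :* c :- a :* b) refl a b c)

  *-monoʳ-< : ∀ {a b c} → 0# < a → b < c → a * b < a * c
  *-monoʳ-< {a} {b} {c} p q = lt (*-pos p (gap< q))
    (solve 3 (λ a b c → a :* (c :- b) := a :* c :- a :* b) refl a b c)

  neg-mono-≤ : ∀ {a b} → a ≤ b → - b ≤ - a
  neg-mono-≤ {a} {b} p = le (gap≤ p) (solve 2 (λ a b → b :- a := :- a :- :- b) refl a b)

  neg-mono-< : ∀ {a b} → a < b → - b < - a
  neg-mono-< {a} {b} p = lt (gap< p) (solve 2 (λ a b → b :- a := :- a :- :- b) refl a b)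

  0<⇒≉ : ∀ {x} → 0# < x → ¬ x ≈ 0#
  0<⇒≉ 0<x x≈0 = <-irrefl (sym x≈0) 0<x

  0<2# : 0# < 2#
  0<2# = +-pos 0<1 0<1

  -0≈0 : - 0# ≈ 0#
  -0≈0 = solve 0 (:- con (+ 0) := con (+ 0)) refl

  neg-pos : ∀ {x} → x < 0# → 0# < - x
  neg-pos x<0 = <-respˡ-≈ -0≈0 (neg-mono-< x<0)

  x*x-nonNeg : ∀ x → 0# ≤ x * x
  x*x-nonNeg x with total 0# x
  ... | inj₁ p = *-nonNeg p p
  ... | inj₂ p = ≤-respʳ-≈ (solve 1 (λ x → :- x :* :- x := x :* x) refl x)
                   (*-nonNeg (≤-respˡ-≈ -0≈0 (neg-mono-≤ p)) (≤-respˡ-≈ -0≈0 (neg-mono-≤ p)))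

  x*x-pos : ∀ x → ¬ x ≈ 0# → 0# < x * x
  x*x-pos x x≉0 with compare 0# x
  ... | tri< p _ _ = *-pos p p
  ... | tri≈ _ p _ = ⊥-elim (x≉0 (sym p))
  ... | tri> _ _ p = <-respʳ-≈ (solve 1 (λ x → :- x :* :- x := x :* x) refl x) (*-pos (neg-pos p) (neg-pos p))

  *-cancel-pos : ∀ {x y} → 0# < x → 0# < x * y → 0# < y
  *-cancel-pos {x} {y} 0<x 0<xy with <-≤-total 0# y
  ... | inj₁ p = p
  ... | inj₂ y≤0 = ⊥-elim (≤⇒≯ (≤-respʳ-≈ (zeroʳ x) (*-monoʳ-≤ (inj₁ 0<x) y≤0)) 0<xy)

  abstract
    positive-inverse : ∀ x → 0# < x → ∃ λ y → 0# < y × x * y ≈ 1#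
    positive-inverse x 0<x =
      let (y , xy≈1) = inverse x (0<⇒≉ 0<x)
      in y , *-cancel-pos 0<x (<-respʳ-≈ (sym xy≈1) 0<1) , xy≈1

  *-zero-divisor : ∀ {x y} → x * y ≈ 0# → 0# < x → y ≈ 0#
  *-zero-divisor {x} {y} xy≈0 0<x = let (z , _ , xz≈1) = positive-inverse x 0<x in
    trans (sym (*-identityʳ y)) (trans (*-congˡ (sym xz≈1))
      (trans (solve 3 (λ x y z → y :* (x :* z) := (x :* y) :* z) refl x y z) (trans (*-congʳ xy≈0) (zeroˡ z))))

  ≈0⇒*≈0ˡ : ∀ {x y} → x ≈ 0# → x * y ≈ 0#
  ≈0⇒*≈0ˡ e = trans (*-congʳ e) (zeroˡ _)

  ≈0⇒*≈0ʳ : ∀ {x y} → y ≈ 0# → x * y ≈ 0#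
  ≈0⇒*≈0ʳ e = trans (*-congˡ e) (zeroʳ _)

  ≈1⇒*≈ʳ : ∀ {x y} → x ≈ 1# → x * y ≈ y
  ≈1⇒*≈ʳ e = trans (*-congʳ e) (*-identityˡ _)

  ≈1⇒*≈ˡ : ∀ {x y} → y ≈ 1# → x * y ≈ x
  ≈1⇒*≈ˡ e = trans (*-congˡ e) (*-identityʳ _)

  ½ : Carrier
  ½ = proj₁ (positive-inverse 2# 0<2#)

  0<½ : 0# < ½
  0<½ = proj₁ (proj₂ (positive-inverse 2# 0<2#))

  2*½≈1 : 2# * ½ ≈ 1#
  2*½≈1 = proj₂ (proj₂ (positive-inverse 2# 0<2#))

  halves : ∀ x → ½ * x + ½ * x ≈ x
  halves x = trans (solve 2 (λ h x → h :* x :+ h :* x := (con (+ 2) :* h) :* x) refl ½ x)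
                   (trans (*-congʳ 2*½≈1) (*-identityˡ x))

  infixl 7 _⊓_
  infixl 6 _⊔_

  abstract
    _⊓_ _⊔_ : Carrier → Carrier → Carrier
    x ⊓ y = [ (λ _ → x) , (λ _ → y) ]′ (total x y)
    x ⊔ y = [ (λ _ → y) , (λ _ → x) ]′ (total x y)

    x≤y⇒x⊓y≈x : ∀ {x y} → x ≤ y → x ⊓ y ≈ x
    x≤y⇒x⊓y≈x {x} {y} p with total x y
    ... | inj₁ _ = refl
    ... | inj₂ q = ≤-antisym q p

    x≥y⇒x⊓y≈y : ∀ {x y} → y ≤ x → x ⊓ y ≈ y
    x≥y⇒x⊓y≈y {x} {y} p with total x y
    ... | inj₁ q = ≤-antisym q p
    ... | inj₂ _ = refl

    x≤y⇒x⊔y≈y : ∀ {x y} → x ≤ y → x ⊔ y ≈ y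
    x≤y⇒x⊔y≈y {x} {y} p with total x y
    ... | inj₁ q = refl
    ... | inj₂ q = ≤-antisym p q

    x≥y⇒x⊔y≈x : ∀ {x y} → y ≤ x → x ⊔ y ≈ x
    x≥y⇒x⊔y≈x {x} {y} p with total x y
    ... | inj₁ q = ≤-antisym p q
    ... | inj₂ _ = refl

  minOperator : MinOperator totalPreorder
  minOperator = record { _⊓_ = _⊓_ ; x≤y⇒x⊓y≈x = x≤y⇒x⊓y≈x ; x≥y⇒x⊓y≈y = x≥y⇒x⊓y≈y }

  maxOperator : MaxOperator totalPreorder
  maxOperator = record { _⊔_ = _⊔_ ; x≤y⇒x⊔y≈y = x≤y⇒x⊔y≈y ; x≥y⇒x⊔y≈x = x≥y⇒x⊔y≈x }

  open MinMaxOp minOperator maxOperator public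
    using (x⊓y≤x; x⊓y≤y; x≤x⊔y; x≤y⊔x; ⊓-glb; ⊔-lub; ⊓-cong; ⊔-cong; ⊓-sel; ⊔-sel)

  ⊓-pos : ∀ {x y} → 0# < x → 0# < y → 0# < x ⊓ y
  ⊓-pos {x} {y} p q = [ (λ e → <-respʳ-≈ (sym e) p) , (λ e → <-respʳ-≈ (sym e) q) ]′ (⊓-sel x y)

  -- The elements of the set below are 0 and, provided that P holds, 1.
  excluded-middle : (P : Set) → P ⊎ ¬ P
  excluded-middle P = decide (sup S (0# , inj₁ refl) (1# , bound))
    where
    S : Carrier → Set
    S x = x ≈ 0# ⊎ (x ≈ 1# × P)
    bound : ∀ x → S x → x ≤ 1#
    bound x (inj₁ x≈0)       = inj₁ (<-respˡ-≈ (sym x≈0) 0<1)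
    bound x (inj₂ (x≈1 , _)) = inj₂ x≈1
    decide : (∃ λ s → (∀ x → S x → x ≤ s) × (∀ x → x < s → ∃ λ y → S y × x < y)) → P ⊎ ¬ P
    decide (s , upper , approx) with <-≤-total 0# s
    ... | inj₂ s≤0 = inj₂ λ p → ≤⇒≯ (≤-trans (upper 1# (inj₂ (refl , p))) s≤0) 0<1
    ... | inj₁ 0<s with approx 0# 0<s
    ...   | y , inj₁ y≈0 , 0<y     = ⊥-elim (0<⇒≉ 0<y y≈0)
    ...   | y , inj₂ (_ , p) , _   = inj₁ p

  square-mono : ∀ {x y} → 0# ≤ x → 0# ≤ y → x * x < y * y → x < y
  square-mono {x} {y} 0≤x 0≤y x²<y² with <-≤-total x y
  ... | inj₁ p = p
  ... | inj₂ y≤x = ⊥-elim (≤⇒≯ (≤-trans (*-monoʳ-≤ 0≤y y≤x) (≤-respˡ-≈ (*-comm _ _) (*-monoʳ-≤ 0≤x y≤x))) x²<y²)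

  abstract
    -- The root is the supremum of the positive numbers with square below `a`, together with 0 for
    -- inhabitance. If its square were too small, a slightly larger number would still belong to the
    -- set; if it were too large, a smaller number would already bound the set.
    sqrt : ∀ a → 0# < a → ∃ λ s → 0# < s × s * s ≈ a
    sqrt a 0<a = from-sup (sup S (0# , inj₁ refl) (1# + a , bound))
      where
      S : Carrier → Set
      S x = x ≈ 0# ⊎ (0# < x × x * x < a)
      0<1+a : 0# < 1# + a
      0<1+a = +-pos 0<1 0<a
      bound : ∀ x → S x → x ≤ 1# + a
      bound x (inj₁ x≈0) = inj₁ (<-respˡ-≈ (sym x≈0) 0<1+a)
      bound x (inj₂ (0<x , x²<a)) = inj₁ (square-mono (inj₁ 0<x) (inj₁ 0<1+a)
        (lt (+-pos (+-pos (+-pos (gap< x²<a) 0<a) 0<1) (*-pos 0<a 0<a))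
            (solve 2 (λ a x → (((a :- x :* x) :+ a) :+ con (+ 1)) :+ a :* a
                              := (con (+ 1) :+ a) :* (con (+ 1) :+ a) :- x :* x) refl a x)))
      small : ∃ λ d → 0# < d × d < 1# × d < a
      small = ½ * (1# ⊓ a) , *-pos 0<½ (⊓-pos 0<1 0<a) ,
              <-≤-trans half< (x⊓y≤x 1# a) , <-≤-trans half< (x⊓y≤y 1# a)
        where
        half< : ½ * (1# ⊓ a) < 1# ⊓ a
        half< = <-respʳ-≈ (halves _) (<-respˡ-≈ (+-identityʳ _) (+-monoʳ-< _ (*-pos 0<½ (⊓-pos 0<1 0<a))))
      from-sup : (∃ λ s → (∀ x → S x → x ≤ s) × (∀ x → x < s → ∃ λ y → S y × x < y)) →
                 ∃ λ s → 0# < s × s * s ≈ a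
      from-sup (s , upper , approx) = s , 0<s , s²≈a
        where
        0<s : 0# < s
        0<s = let (d , 0<d , d<1 , d<a) = small in <-≤-trans 0<d (upper d (inj₂ (0<d ,
          <-trans (<-respʳ-≈ (*-identityʳ d) (*-monoʳ-< 0<d d<1)) d<a)))
        2s+1>0 : 0# < 2# * s + 1#
        2s+1>0 = +-pos (*-pos 0<2# 0<s) 0<1
        s²≈a : s * s ≈ a
        s²≈a with compare (s * s) a
        ... | tri≈ _ e _ = e
        ... | tri< s²<a _ _ =
          let (i , 0<i , eq) = positive-inverse (2# * s + 1#) 2s+1>0
              -- Since `d < 1#`, the square of `s + d` is below `s * s + d * (2# * s + 1#)`, and the
              -- second bound on `d` makes this less than `a`.
              d = ½ * (1# ⊓ ((a - s * s) * i))
              0<g = ⊓-pos 0<1 (*-pos (gap< s²<a) 0<i)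
              0<d = *-pos 0<½ 0<g
              d<g = <-respʳ-≈ (halves _) (<-respˡ-≈ (+-identityʳ _) (+-monoʳ-< d 0<d))
              d<1 = <-≤-trans d<g (x⊓y≤x _ _)
              d<i = <-≤-trans d<g (x⊓y≤y _ _)
              key = +-pos (*-pos 2s+1>0 (gap< d<i)) (*-pos 0<d (gap< d<1))
          in ⊥-elim (≤⇒≯ (upper (s + d) (inj₂ (+-pos 0<s 0<d ,
               lt key (trans (solve 4 (λ a s d i →
                     (con (+ 2) :* s :+ con (+ 1)) :* ((a :- s :* s) :* i :- d) :+ d :* (con (+ 1) :- d)
                     := (a :- s :* s) :* ((con (+ 2) :* s :+ con (+ 1)) :* i)
                        :- ((con (+ 2) :* s :+ con (+ 1)) :* d :- d :* (con (+ 1) :- d))) refl a s d i)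
                   (trans (+-congʳ (trans (*-congˡ eq) (*-identityʳ _)))
                     (solve 3 (λ a s d → (a :- s :* s)
                        :- ((con (+ 2) :* s :+ con (+ 1)) :* d :- d :* (con (+ 1) :- d))
                        := a :- (s :+ d) :* (s :+ d)) refl a s d))))))
               (<-respˡ-≈ (+-identityʳ s) (+-monoʳ-< s 0<d)))
        ... | tri> _ _ a<s² =
          let (i , 0<i , eq) = positive-inverse (2# * s) (*-pos 0<2# 0<s)
              -- Here `s - d` is the Newton iterate, whose square is `a + d * d`. No element of the
              -- set can exceed it, although `s` is the supremum.
              d = (s * s - a) * i
              0<d = *-pos (gap< a<s²) 0<i
              (y , Sy , s-d<y) = approx (s - d) (lt 0<d (solve 2 (λ s d → d := s :- (s :- d)) refl s d))
              0<s-d = *-cancel-pos (*-pos 0<2# 0<s) (<-respʳ-≈ (trans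
                 (solve 2 (λ s a → s :* s :+ a := con (+ 2) :* s :* s :- (s :* s :- a) :* con (+ 1)) refl s a)
                 (trans (+-congˡ (-‿cong (*-congˡ (sym eq))))
                 (solve 3 (λ s a i → con (+ 2) :* s :* s :- (s :* s :- a) :* (con (+ 2) :* s :* i)
                    := con (+ 2) :* s :* (s :- (s :* s :- a) :* i)) refl s a i)))
                 (+-pos (*-pos 0<s 0<s) 0<a))
          in ⊥-elim (contradict y Sy d (inj₁ 0<d) s-d<y (inj₁ 0<s-d) (trans (solve 3 (λ s a i →
                 con (+ 2) :* s :* ((s :* s :- a) :* i) := (s :* s :- a) :* (con (+ 2) :* s :* i)) refl s a i)
                 (trans (*-congˡ eq) (*-identityʳ _))))
          where
          contradict : ∀ y → S y → ∀ d → 0# ≤ d → s - d < y → 0# ≤ s - d → 2# * s * d ≈ s * s - a → ⊥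
          contradict y (inj₁ y≈0) d _ p q _ = ≤⇒≯ q (<-respʳ-≈ y≈0 p)
          contradict y (inj₂ (0<y , y²<a)) d 0≤d p q e = <-asym p (square-mono (inj₁ 0<y) q
            (<-≤-trans y²<a (le (x*x-nonNeg d) (trans
               (solve 3 (λ s d a → d :* d := (s :- d) :* (s :- d) :- (s :* s :- con (+ 2) :* s :* d)) refl s d a)
               (+-congˡ (-‿cong (trans (+-congˡ (-‿cong e)) (solve 2 (λ s a → s :* s :- (s :* s :- a) := a) refl s a))))))))

-- Spaces with finitely many real coordinates and continuous functions on them.

module Continuity (ℝ : CompleteOrderedField) where
  open OrderedField ℝ public

  Within : Carrier → Carrier → Set
  Within ε d = - ε < d × d < ε

  close⇒within : ∀ {ε x y} → Close ε x y → Within ε (y - x)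
  close⇒within {ε} {x} {y} (p , q) =
    lt (gap< p) (solve 3 (λ e x y → (y :+ e) :- x := (y :- x) :- :- e) refl ε x y) ,
    lt (gap< q) (solve 3 (λ e x y → (x :+ e) :- y := e :- (y :- x)) refl ε x y)

  within⇒close : ∀ {ε x y} → Within ε (y - x) → Close ε x y
  within⇒close {ε} {x} {y} (p , q) =
    lt (gap< p) (solve 3 (λ e x y → (y :- x) :- :- e := (y :+ e) :- x) refl ε x y) ,
    lt (gap< q) (solve 3 (λ e x y → e :- (y :- x) := (x :+ e) :- y) refl ε x y)

  within-resp : ∀ {ε d e} → d ≈ e → Within ε d → Within ε e
  within-resp d≈e (p , q) = <-respʳ-≈ d≈e p , <-respˡ-≈ d≈e q

  within-mono : ∀ {δ ε d} → δ ≤ ε → Within δ d → Within ε d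
  within-mono δ≤ε (p , q) = ≤-<-trans (neg-mono-≤ δ≤ε) p , <-≤-trans q δ≤ε

  within-+ : ∀ {δ ε d e} → Within δ d → Within ε e → Within (δ + ε) (d + e)
  within-+ {δ} {ε} (p , q) (p′ , q′) =
    <-respˡ-≈ (solve 2 (λ d e → :- d :+ :- e := :- (d :+ e)) refl δ ε) (+-mono-< p p′) , +-mono-< q q′

  within-neg : ∀ {ε d} → Within ε d → Within ε (- d)
  within-neg {ε} {d} (p , q) = neg-mono-< q , <-respʳ-≈ (solve 1 (λ e → :- :- e := e) refl ε) (neg-mono-< p)

  -- Twice `a * b - d * e` equals `(a - d) * (e + b) + (a + d) * (b - e)`, a sum of products of
  -- positive factors. The lower bound has a similar identity, so no case distinction on signs
  -- arises.
  within-* : ∀ {a b d e} → Within a d → Within b e → Within (a * b) (d * e)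
  within-* {a} {b} {d} {e} (p , q) (p′ , q′) =
    lt (half-pos (+-pos (*-pos (gap< p) (gap< p′)) (*-pos (gap< q) (gap< q′))))
       (trans (*-congˡ (solve 4 (λ a b d e → (d :- :- a) :* (e :- :- b) :+ (a :- d) :* (b :- e)
                                 := con (+ 2) :* (d :* e :- :- (a :* b))) refl a b d e)) (half _)) ,
    lt (half-pos (+-pos (*-pos (gap< q) (gap< p′)) (*-pos (gap< p) (gap< q′))))
       (trans (*-congˡ (solve 4 (λ a b d e → (a :- d) :* (e :- :- b) :+ (d :- :- a) :* (b :- e)
                                 := con (+ 2) :* (a :* b :- d :* e)) refl a b d e)) (half _))
    where
    half-pos : ∀ {x} → 0# < x → 0# < ½ * x
    half-pos = *-pos 0<½
    half : ∀ x → ½ * (2# * x) ≈ x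
    half x = trans (solve 2 (λ h x → h :* (con (+ 2) :* x) := h :* x :+ h :* x) refl ½ x) (halves x)

  within-0 : ∀ {ε} → 0# < ε → Within ε 0#
  within-0 0<ε = <-respʳ-≈ -0≈0 (neg-mono-< 0<ε) , 0<ε

  within-refl : ∀ {ε x y} → 0# < ε → x ≈ y → Within ε (y - x)
  within-refl 0<ε x≈y = within-resp (sym (trans (+-congʳ (sym x≈y)) (-‿inverseʳ _))) (within-0 0<ε)

  magnitude : ∀ x → ∃ λ b → 0# < b × Within b x
  magnitude x with total 0# x
  ... | inj₁ 0≤x = x + 1# , 0<b , <-≤-trans (<-respʳ-≈ -0≈0 (neg-mono-< 0<b)) 0≤x ,
                   <-respˡ-≈ (+-identityʳ x) (+-monoʳ-< x 0<1)
    where 0<b = +-nonNeg-pos 0≤x 0<1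
  ... | inj₂ x≤0 = 1# - x , 0<b , lt 0<1 (solve 1 (λ x → con (+ 1) := x :- :- (con (+ 1) :- x)) refl x) ,
                   ≤-<-trans x≤0 0<b
    where 0<b = +-pos-nonNeg 0<1 (≤-respˡ-≈ -0≈0 (neg-mono-≤ x≤0))

  within-all⇒≈0 : ∀ {d} → (∀ ε → 0# < ε → Within ε d) → d ≈ 0#
  within-all⇒≈0 {d} w = ≤-antisym (≮⇒≥ λ 0<d → <-irrefl′ (proj₂ (w d 0<d)))
    (≮⇒≥ λ d<0 → <-irrefl (solve 1 (λ d → :- :- d := d) refl d) (proj₁ (w (- d) (neg-pos d<0))))

  -≈0⇒≈ : ∀ {x y} → y - x ≈ 0# → x ≈ y
  -≈0⇒≈ {x} {y} e = sym (trans (solve 2 (λ x y → y := x :+ (y :- x)) refl x y) (trans (+-congˡ e) (+-identityʳ x)))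

  close-mono : ∀ {δ ε x y} → δ ≤ ε → Close δ x y → Close ε x y
  close-mono δ≤ε = within⇒close ∘ within-mono δ≤ε ∘ close⇒within

  close-refl : ∀ {ε x y} → 0# < ε → x ≈ y → Close ε x y
  close-refl 0<ε x≈y = within⇒close (within-refl 0<ε x≈y)

  close-open : ∀ {ε x y} → Close ε x y → ∃ λ δ → 0# < δ × ∀ z → Close δ y z → Close ε x z
  close-open {ε} {x} {y} (p , q) = δ , ⊓-pos (gap< p) (gap< q) , λ z (r , s) →
      lt (+-pos-nonNeg (gap< r) (gap≤ (x⊓y≤x _ _)))
         (solve 5 (λ x y z d e → ((z :+ d) :- y) :+ (((y :+ e) :- x) :- d) := (z :+ e) :- x) refl x y z δ ε) ,
      lt (+-pos-nonNeg (gap< s) (gap≤ (x⊓y≤y _ _)))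
         (solve 5 (λ x y z d e → ((y :+ d) :- z) :+ (((x :+ e) :- y) :- d) := (x :+ e) :- z) refl x y z δ ε)
    where δ = ((y + ε) - x) ⊓ ((x + ε) - y)

  -- Finiteness in the form in which it is used: conditions that persist when the radius shrinks
  -- have a common radius. This passes to sums and retracts, so no enumeration of the index type is
  -- required.
  Uniform : Set → Set₁
  Uniform A = (R : A → Carrier → Set) → (∀ a {δ ε} → δ ≤ ε → R a ε → R a δ) →
              (∀ a → ∃ λ ε → 0# < ε × R a ε) → ∃ λ ε → 0# < ε × ∀ a → R a ε

  uniform-⊎ : ∀ {A B} → Uniform A → Uniform B → Uniform (A ⊎ B)
  uniform-⊎ u v R mono ex =
    let (δ , 0<δ , f) = u (R ∘ inj₁) (mono ∘ inj₁) (ex ∘ inj₁)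
        (ε , 0<ε , g) = v (R ∘ inj₂) (mono ∘ inj₂) (ex ∘ inj₂)
    in δ ⊓ ε , ⊓-pos 0<δ 0<ε ,
       [ (λ a → mono (inj₁ a) (x⊓y≤x δ ε) (f a)) , (λ b → mono (inj₂ b) (x⊓y≤y δ ε) (g b)) ]

  uniform-retract : ∀ {A B} (f : A → B) (g : B → A) → (∀ (R : B → Set) b → R (f (g b)) → R b) → Uniform A → Uniform B
  uniform-retract f g fg u R mono ex =
    let (ε , 0<ε , h) = u (R ∘ f) (mono ∘ f) (ex ∘ f) in ε , 0<ε , λ b → fg (λ b → R b ε) b (h (g b))

  uniform-Fin : ∀ n → Uniform (Fin n)
  uniform-Fin zero    R mono ex = 1# , 0<1 , λ ()
  uniform-Fin (suc n) R mono ex =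
    let (δ , 0<δ , p) = ex zero
        (ε , 0<ε , f) = uniform-Fin n (R ∘ suc) (mono ∘ suc) (ex ∘ suc)
    in δ ⊓ ε , ⊓-pos 0<δ 0<ε ,
       λ { zero → mono zero (x⊓y≤x δ ε) p ; (suc i) → mono (suc i) (x⊓y≤y δ ε) (f i) }

  uniform-Subset : ∀ n → Uniform (Subset n)
  uniform-Subset zero    R mono ex = let (ε , 0<ε , p) = ex [] in ε , 0<ε , λ { [] → p }
  uniform-Subset (suc n) = uniform-retract [ outside ∷_ , inside ∷_ ]′
    (λ { (true ∷ p) → inj₂ p ; (false ∷ p) → inj₁ p })
    (λ { R (true ∷ p) r → r ; R (false ∷ p) r → r })
    (uniform-⊎ (uniform-Subset n) (uniform-Subset n))

  -- A space whose topology comes from the sup-distance of finitely many coordinates. Spheres,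
  -- cones, the interval and the realization are presented this way; the wedge is not, and its open
  -- sets are treated directly.
  record Space : Set₂ where
    field
      space   : TopologicalSpace
      Index   : Set
      uniform : Uniform Index
    open TopologicalSpace space public using (Open; resp-≈) renaming (Carrier to Pt; _≈_ to _∼_)
    field
      coord : Pt → Index → Carrier
      coord-cong : ∀ {x y} → x ∼ y → ∀ a → coord x a ≈ coord y a
      coord-injective : ∀ {x y} → (∀ a → coord x a ≈ coord y a) → x ∼ y

    Ball : Carrier → Pt → Pt → Set
    Ball ε x y = ∀ a → Close ε (coord x a) (coord y a)

    BallOpen : Pred Pt 0ℓ → Set
    BallOpen U = ∀ x → U x → ∃ λ ε → 0# < ε × ∀ y → Ball ε x y → U y

    field
      open⇒ball : ∀ {U} → Open U → BallOpen U
      ball⇒open : ∀ {U} → BallOpen U → Open U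

    ball-refl : ∀ {ε x y} → 0# < ε → x ∼ y → Ball ε x y
    ball-refl 0<ε x≈y a = close-refl 0<ε (coord-cong x≈y a)

    ball-mono : ∀ {δ ε x y} → δ ≤ ε → Ball δ x y → Ball ε x y
    ball-mono δ≤ε b a = close-mono δ≤ε (b a)

    ball-open : ∀ ε x → Open (Ball ε x)
    ball-open ε x = ball⇒open λ y b →
      let (δ , 0<δ , f) = uniform (λ a δ → ∀ z → Close δ (coord y a) z → Close ε (coord x a) z)
                            (λ a δ≤ε f z c → f z (close-mono δ≤ε c)) (λ a → close-open (b a))
      in δ , 0<δ , λ z c a → f a _ (c a)

  subspaceOf : ∀ n → Pred (TopologicalSpace.Carrier (ℝ^ n)) 0ℓ → Space
  subspaceOf n Q = record
    { space = subspace (ℝ^ n) Q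
    ; Index = Fin n
    ; uniform = uniform-Fin n
    ; coord = proj₁
    ; coord-cong = id
    ; coord-injective = id
    ; open⇒ball = λ { (V , lift o , f , g) x Ux →
        let (ε , 0<ε , b) = o (proj₁ x) (f Ux) in ε , 0<ε , λ y c → g (b (proj₁ y) c) }
    ; ball⇒open = λ {U} o →
        -- The ambient open set is the union of all balls that are centred in the subspace and whose
        -- trace on it lies in `U`.
        (λ y → ∃₂ λ (x : ∃ Q) ε → (∀ z → (∀ a → Close ε (proj₁ x a) (proj₁ z a)) → U z) ×
                                  (∀ a → Close ε (proj₁ x a) (y a))) ,
        lift (λ { y (x , ε , f , c) →
          let (δ , 0<δ , h) = uniform-Fin n (λ a δ → ∀ z → Close δ (y a) z → Close ε (proj₁ x a) z)
                                (λ a δ≤ε f z c → f z (close-mono δ≤ε c)) (λ a → close-open (c a))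
          in δ , 0<δ , λ z d → x , ε , f , λ a → h a _ (d a) }) ,
        (λ {x} Ux → let (ε , 0<ε , f) = o x Ux in x , ε , f , λ a → close-refl 0<ε refl) ,
        (λ { {y} (x , ε , f , c) → f y c })
    }

  interval : Space
  interval = subspaceOf 1 λ x → 0# ≤ x zero × x zero ≤ 1#

  infixr 4 _×ₛ_

  _×ₛ_ : Space → Space → Space
  X ×ₛ Y = record
    { space = X.space ×ₜ Y.space
    ; Index = X.Index ⊎ Y.Index
    ; uniform = uniform-⊎ X.uniform Y.uniform
    ; coord = λ (x , y) → [ X.coord x , Y.coord y ]′
    ; coord-cong = λ (p , q) → [ X.coord-cong p , Y.coord-cong q ]
    ; coord-injective = λ e → X.coord-injective (e ∘ inj₁) , Y.coord-injective (e ∘ inj₂)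
    ; open⇒ball = λ o p w →
        let (U , V , oU , oV , (u , v) , s) = o p w
            (δ , 0<δ , f) = X.open⇒ball oU (proj₁ p) u
            (ε , 0<ε , g) = Y.open⇒ball oV (proj₂ p) v
        in δ ⊓ ε , ⊓-pos 0<δ 0<ε , λ q b →
           s (f (proj₁ q) (X.ball-mono (x⊓y≤x δ ε) (b ∘ inj₁)) , g (proj₂ q) (Y.ball-mono (x⊓y≤y δ ε) (b ∘ inj₂)))
    ; ball⇒open = λ o p w →
        let (ε , 0<ε , f) = o p w
        in X.Ball ε (proj₁ p) , Y.Ball ε (proj₂ p) , X.ball-open ε (proj₁ p) , Y.ball-open ε (proj₂ p) ,
           (X.ball-refl 0<ε (TopologicalSpace.refl X.space) , Y.ball-refl 0<ε (TopologicalSpace.refl Y.space)) ,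
           λ {q} (b , c) → f q [ b , c ]
    }
    where
    module X = Space X
    module Y = Space Y

  open Space using (Pt)

  module _ (X : Space) where
    open Space X hiding (Pt)

    Cont : (Pt X → Carrier) → Set
    Cont φ = ∀ x ε → 0# < ε → ∃ λ δ → 0# < δ × ∀ y → Ball δ x y → Within ε (φ y - φ x)

  module _ {X : Space} where
    open Space X hiding (Pt)

    cont-≈ : ∀ {φ ψ} → (∀ x → φ x ≈ ψ x) → Cont X φ → Cont X ψ
    cont-≈ φ≈ψ c x ε 0<ε = let (δ , 0<δ , f) = c x ε 0<ε in
      δ , 0<δ , λ y b → within-resp (+-cong (φ≈ψ y) (-‿cong (φ≈ψ x))) (f y b)

    cont-coord : ∀ a → Cont X (λ x → coord x a)
    cont-coord a x ε 0<ε = ε , 0<ε , λ y b → close⇒within (b a)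

    cont-const : ∀ c → Cont X (λ _ → c)
    cont-const c x ε 0<ε = 1# , 0<1 , λ y _ → within-refl 0<ε refl

    cont-+ : ∀ {φ ψ} → Cont X φ → Cont X ψ → Cont X (λ x → φ x + ψ x)
    cont-+ {φ} {ψ} cφ cψ x ε 0<ε =
      let (δ , 0<δ , f) = cφ x (½ * ε) (*-pos 0<½ 0<ε)
          (η , 0<η , g) = cψ x (½ * ε) (*-pos 0<½ 0<ε)
      in δ ⊓ η , ⊓-pos 0<δ 0<η , λ y b →
         within-mono (≤-reflexive (halves ε)) (within-resp
           (solve 4 (λ a b c d → (a :- b) :+ (c :- d) := (a :+ c) :- (b :+ d)) refl (φ y) (φ x) (ψ y) (ψ x))
           (within-+ (f y (ball-mono (x⊓y≤x δ η) b)) (g y (ball-mono (x⊓y≤y δ η) b))))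

    cont-neg : ∀ {φ} → Cont X φ → Cont X (λ x → - φ x)
    cont-neg {φ} cφ x ε 0<ε = let (δ , 0<δ , f) = cφ x ε 0<ε in δ , 0<δ , λ y b →
      within-resp (solve 2 (λ a b → :- (a :- b) := :- a :- :- b) refl (φ y) (φ x)) (within-neg (f y b))

    cont-sub : ∀ {φ ψ} → Cont X φ → Cont X ψ → Cont X (λ x → φ x - ψ x)
    cont-sub cφ cψ = cont-+ cφ (cont-neg cψ)

    cont-* : ∀ {φ ψ} → Cont X φ → Cont X ψ → Cont X (λ x → φ x * ψ x)
    cont-* {φ} {ψ} cφ cψ x ε 0<ε =
      let (b , 0<b , wb) = magnitude (φ x)
          (c , 0<c , wc) = magnitude (ψ x)
          0<s = +-pos (+-pos 0<1 0<c) 0<b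
          (i , 0<i , si≈1) = positive-inverse _ 0<s
          -- The error is bounded by `ζ * ζ + ζ * c + b * ζ`. As `ζ` is at most 1, this is at most
          -- `(1# + c + b) * ζ`, and `i` is the inverse of that factor.
          ζ = 1# ⊓ (ε * i)
          0<ζ = ⊓-pos 0<1 (*-pos 0<ε 0<i)
          (δ , 0<δ , f) = cφ x ζ 0<ζ
          (η , 0<η , g) = cψ x ζ 0<ζ
      in δ ⊓ η , ⊓-pos 0<δ 0<η , λ y near →
         let wf = f y (ball-mono (x⊓y≤x δ η) near)
             wg = g y (ball-mono (x⊓y≤y δ η) near)
         in within-mono
              (≤-trans (*-monoʳ-≤ (<⇒≤ 0<s) (x⊓y≤y 1# (ε * i)))
                (≤-reflexive (trans (solve 3 (λ s e i → s :* (e :* i) := e :* (s :* i)) refl _ ε i)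
                  (≈1⇒*≈ˡ si≈1))))
              (within-resp
                (solve 4 (λ p q r s → ((p :- q) :* (r :- s) :+ (p :- q) :* s) :+ q :* (r :- s) := p :* r :- q :* s)
                  refl (φ y) (φ x) (ψ y) (ψ x))
                (within-mono (≤-reflexive (solve 3 (λ b c z → (z :+ z :* c) :+ b :* z := ((con (+ 1) :+ c) :+ b) :* z)
                                refl b c ζ))
                  (within-+ (within-+ (within-mono (≤-trans (*-monoʳ-≤ (<⇒≤ 0<ζ) (x⊓y≤x 1# (ε * i)))
                                                    (≤-reflexive (*-identityʳ ζ)))
                                        (within-* wf wg))
                                      (within-* wf wc)) (within-* wb wg))))

    private
      ⊓-close : ∀ {ε a a′ b b′} → a < a′ + ε → b < b′ + ε → (a ⊓ b) < (a′ ⊓ b′) + ε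
      ⊓-close {ε} {a} {a′} {b} {b′} p q with ⊓-sel a′ b′
      ... | inj₁ e = ≤-<-trans (x⊓y≤x a b) (<-respʳ-≈ (+-congʳ (sym e)) p)
      ... | inj₂ e = ≤-<-trans (x⊓y≤y a b) (<-respʳ-≈ (+-congʳ (sym e)) q)

      ⊔-close : ∀ {ε a a′ b b′} → a < a′ + ε → b < b′ + ε → (a ⊔ b) < (a′ ⊔ b′) + ε
      ⊔-close {ε} {a} {a′} {b} {b′} p q with ⊔-sel a b
      ... | inj₁ e = <-respˡ-≈ (sym e) (<-≤-trans p (+-mono-≤ (x≤x⊔y a′ b′) ≤-refl))
      ... | inj₂ e = <-respˡ-≈ (sym e) (<-≤-trans q (+-mono-≤ (x≤y⊔x a′ b′) ≤-refl))

    cont-⊓ : ∀ {φ ψ} → Cont X φ → Cont X ψ → Cont X (λ x → φ x ⊓ ψ x)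
    cont-⊓ {φ} {ψ} cφ cψ x ε 0<ε =
      let (δ , 0<δ , f) = cφ x ε 0<ε
          (η , 0<η , g) = cψ x ε 0<ε
      in δ ⊓ η , ⊓-pos 0<δ 0<η , λ y b →
         let (p , p′) = within⇒close (f y (ball-mono (x⊓y≤x δ η) b))
             (q , q′) = within⇒close (g y (ball-mono (x⊓y≤y δ η) b))
         in close⇒within (⊓-close p q , ⊓-close p′ q′)

    cont-⊔ : ∀ {φ ψ} → Cont X φ → Cont X ψ → Cont X (λ x → φ x ⊔ ψ x)
    cont-⊔ {φ} {ψ} cφ cψ x ε 0<ε =
      let (δ , 0<δ , f) = cφ x ε 0<ε
          (η , 0<η , g) = cψ x ε 0<ε
      in δ ⊓ η , ⊓-pos 0<δ 0<η , λ y b →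
         let (p , p′) = within⇒close (f y (ball-mono (x⊓y≤x δ η) b))
             (q , q′) = within⇒close (g y (ball-mono (x⊓y≤y δ η) b))
         in close⇒within (⊔-close p q , ⊔-close p′ q′)

    cont-sum : ∀ {n} {φ : Pt X → Fin n → Carrier} → (∀ i → Cont X (λ x → φ x i)) → Cont X (λ x → sum (φ x))
    cont-sum {zero}  c = cont-const 0#
    cont-sum {suc n} c = cont-+ (c zero) (cont-sum (c ∘ suc))

    cont-positive : ∀ {φ} → Cont X φ → ∀ x c → c < φ x → ∃ λ δ → 0# < δ × ∀ y → Ball δ x y → c < φ y
    cont-positive {φ} cφ x c p = let (δ , 0<δ , f) = cφ x (φ x - c) (gap< p) in δ , 0<δ , λ y b →
      lt (gap< (proj₁ (f y b))) (solve 3 (λ a b c → (a :- b) :- :- (b :- c) := a :- c) refl (φ y) (φ x) c)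

    within-scale : ∀ {k ε d} → 0# < k → Within (k * ε) (k * d) → Within ε d
    within-scale {k} {ε} {d} 0<k (p , q) =
      lt (*-cancel-pos 0<k (<-respʳ-≈ (solve 3 (λ k e d → k :* d :- :- (k :* e) := k :* (d :- :- e)) refl k ε d) (gap< p))) refl ,
      lt (*-cancel-pos 0<k (<-respʳ-≈ (solve 3 (λ k e d → k :* e :- k :* d := k :* (e :- d)) refl k ε d) (gap< q))) refl

    -- With c = φ x, ψ x (φ x φ y) = φ y, so c² (ψ y - ψ x) = (c ψ y) (c - φ y), and c ψ y ≤ 2 once φ y ≥ c / 2.
    cont-inverse : ∀ {φ ψ} → (∀ x → 0# < φ x) → (∀ x → φ x * ψ x ≈ 1#) → Cont X φ → Cont X ψ
    cont-inverse {φ} {ψ} φ>0 φψ cφ x ε 0<ε =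
      let c = φ x
          0<c = φ>0 x
          0<cε = *-pos (*-pos 0<c 0<c) (*-pos 0<½ 0<ε)
          (δ , 0<δ , f) = cφ x (c * c * (½ * ε)) 0<cε
          (η , 0<η , g) = cont-positive cφ x (½ * c) (lt (*-pos 0<½ 0<c)
             (trans (solve 2 (λ h c → h :* c := (h :* c :+ h :* c) :- h :* c) refl ½ c) (+-congʳ (halves c))))
      in δ ⊓ η , ⊓-pos 0<δ 0<η , λ y b →
         let wf = f y (ball-mono (x⊓y≤x δ η) b)
             c<2φy = g y (ball-mono (x⊓y≤y δ η) b)
             0<cψ = *-pos 0<c (ψ>0 y)
             cψ<2 : c * ψ y < 2#
             cψ<2 = lt (*-pos (*-pos 0<2# (ψ>0 y)) (gap< c<2φy)) (trans
               (solve 4 (λ p q h c → con (+ 2) :* q :* (p :- h :* c) := con (+ 2) :* (p :* q) :- (con (+ 2) :* h) :* (c :* q)) refl (φ y) (ψ y) ½ c)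
               (+-cong (≈1⇒*≈ˡ (φψ y)) (-‿cong (≈1⇒*≈ʳ 2*½≈1))))
         in within-scale (*-pos 0<c 0<c) (within-mono (≤-reflexive (trans
              (solve 3 (λ c h e → con (+ 2) :* (c :* (h :* e)) := c :* ((con (+ 2) :* h) :* e)) refl (c * c) ½ ε)
              (*-congˡ (≈1⇒*≈ʳ 2*½≈1))))
              (within-resp (trans
                (solve 4 (λ c p q r → (c :* q) :* :- (p :- c) := c :* c :* q :- c :* (p :* q)) refl c (φ y) (ψ y) (ψ x))
                (trans (+-congˡ (-‿cong (trans (*-congˡ (trans (φψ y) (sym (φψ x)))) refl)))
                  (solve 3 (λ c q r → c :* c :* q :- c :* (c :* r) := (c :* c) :* (q :- r)) refl c (ψ y) (ψ x))))
                (within-* (<-trans (<-respʳ-≈ -0≈0 (neg-mono-< 0<2#)) 0<cψ , cψ<2) (within-neg wf))))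
      where
      ψ>0 : ∀ x → 0# < ψ x
      ψ>0 x = *-cancel-pos (φ>0 x) (<-respʳ-≈ (sym (φψ x)) 0<1)

    -- The difference of the roots times their sum is the difference of the `φ`-values, and the sum
    -- is at least `ψ x`. A tolerance `ψ x * ε` for `φ` is therefore small enough.
    cont-sqrt : ∀ {φ ψ} → (∀ x → 0# < ψ x) → (∀ x → ψ x * ψ x ≈ φ x) → Cont X φ → Cont X ψ
    cont-sqrt {φ} {ψ} ψ>0 ψψ cφ x ε 0<ε =
      let (δ , 0<δ , f) = cφ x (ψ x * ε) (*-pos (ψ>0 x) 0<ε)
      in δ , 0<δ , λ y b →
         let 0<s = +-pos-nonNeg (ψ>0 x) (<⇒≤ (ψ>0 y))
         in within-scale 0<s (within-mono
              (le (*-nonNeg (<⇒≤ (ψ>0 y)) (<⇒≤ 0<ε)) (solve 3 (λ a b e → b :* e := (a :+ b) :* e :- a :* e) refl (ψ x) (ψ y) ε))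
              (within-resp (trans (+-cong (sym (ψψ y)) (-‿cong (sym (ψψ x))))
                 (solve 2 (λ a b → b :* b :- a :* a := (a :+ b) :* (b :- a)) refl (ψ x) (ψ y))) (f y b)))

    -- Equal points lie in every ball around each other, so the values differ by less than every
    -- `ε`. This yields congruence also for functions built from chosen inverses and roots.
    cont-cong : ∀ {φ} → Cont X φ → ∀ {x y} → x ∼ y → φ x ≈ φ y
    cont-cong cφ {x} {y} x∼y = -≈0⇒≈ (within-all⇒≈0 λ ε 0<ε →
      let (δ , 0<δ , f) = cφ x ε 0<ε in f y (ball-refl 0<δ x∼y))

  module _ (X Y : Space) where
    private
      module X = Space X
      module Y = Space Y

    continuousMap : (f : Pt X → Pt Y) → (∀ b → Cont X (λ x → Y.coord (f x) b)) → X.space ⇒ Y.space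
    continuousMap f c = record
      { func = record { to = f ; cong = λ x∼y → Y.coord-injective λ b → cont-cong {X} (c b) x∼y }
      ; continuous = λ V oV → X.ball⇒open λ x fx∈V →
          let (ε , 0<ε , g) = Y.open⇒ball oV (f x) fx∈V
              (δ , 0<δ , h) = Y.uniform (λ b δ → ∀ y → X.Ball δ x y → Within ε (Y.coord (f y) b - Y.coord (f x) b))
                                (λ b δ≤ε h y n → h y (X.ball-mono δ≤ε n)) (λ b → c b x ε 0<ε)
          in δ , 0<δ , λ y n → g (f y) λ b → within⇒close (h b y n)
      }

  homotopy : ∀ {X Y} (f g : Space.space X ⇒ Space.space Y) (H : Pt (X ×ₛ interval) → Pt Y) →
             (∀ b → Cont (X ×ₛ interval) (λ p → Space.coord Y (H p) b)) →
             (∀ x → Space._∼_ Y (H (x , 𝕀₀)) (_⇒_.to f x)) → (∀ x → Space._∼_ Y (H (x , 𝕀₁)) (_⇒_.to g x)) →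
             Homotopic f g
  homotopy {X} {Y} f g H c H₀ H₁ = continuousMap (X ×ₛ interval) Y H c , H₀ , H₁

-- Concatenation of homotopies and transitivity of homotopy equivalence.

module Homotopies (ℝ : CompleteOrderedField) where
  open Continuity ℝ public

  private
    module I = Space interval

  clamp : Carrier → Carrier
  clamp a = 0# ⊔ (a ⊓ 1#)

  0≤clamp : ∀ a → 0# ≤ clamp a
  0≤clamp a = x≤x⊔y 0# (a ⊓ 1#)

  clamp≤1 : ∀ a → clamp a ≤ 1#
  clamp≤1 a = ⊔-lub (<⇒≤ 0<1) (x⊓y≤y a 1#)

  clamp-≤0 : ∀ {a} → a ≤ 0# → clamp a ≈ 0#
  clamp-≤0 {a} a≤0 = x≥y⇒x⊔y≈x (≤-trans (x⊓y≤x a 1#) a≤0)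

  clamp-≥1 : ∀ {a} → 1# ≤ a → clamp a ≈ 1#
  clamp-≥1 {a} 1≤a = trans (⊔-cong refl (x≥y⇒x⊓y≈y 1≤a)) (x≤y⇒x⊔y≈y (<⇒≤ 0<1))

  cont-clamp : ∀ {X φ} → Cont X φ → Cont X (clamp ∘ φ)
  cont-clamp {X} c = cont-⊔ {X} (cont-const {X} 0#) (cont-⊓ {X} c (cont-const {X} 1#))

  1-≈1 : ∀ {t} → t ≈ 0# → 1# - t ≈ 1#
  1-≈1 e = trans (+-congˡ (-‿cong e)) (solve 0 (con (+ 1) :- con (+ 0) := con (+ 1)) refl)

  1-≈0 : ∀ {t} → t ≈ 1# → 1# - t ≈ 0#
  1-≈0 e = trans (+-congˡ (-‿cong e)) (-‿inverseʳ 1#)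

  module _ {X X′ Y Y′ : TopologicalSpace} where
    productMap : X ⇒ X′ → Y ⇒ Y′ → X ×ₜ Y ⇒ X′ ×ₜ Y′
    productMap f g = record
      { func = record { to = λ (x , y) → _⇒_.to f x , _⇒_.to g y
                      ; cong = λ (p , q) → _⇒_.cong f p , _⇒_.cong g q }
      ; continuous = λ W oW (x , y) w →
          let (U , V , oU , oV , uv , s) = oW (_⇒_.to f x , _⇒_.to g y) w
          in U ∘ _⇒_.to f , V ∘ _⇒_.to g , _⇒_.continuous f U oU , _⇒_.continuous g V oV , uv , s
      }

  first-half second-half : unitInterval ⇒ unitInterval
  first-half = continuousMap interval interval
    (λ s → (λ _ → clamp (2# * proj₁ s zero)) , 0≤clamp _ , clamp≤1 _)
    (λ _ → cont-clamp {interval} (cont-* {interval} (cont-const {interval} 2#) (cont-coord {interval} zero)))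
  second-half = continuousMap interval interval
    (λ s → (λ _ → clamp (2# * proj₁ s zero - 1#)) , 0≤clamp _ , clamp≤1 _)
    (λ _ → cont-clamp {interval} (cont-sub {interval}
      (cont-* {interval} (cont-const {interval} 2#) (cont-coord {interval} zero)) (cont-const {interval} 1#)))

  module _ {X Y : TopologicalSpace} where
    private
      module X = TopologicalSpace X
      module Y = TopologicalSpace Y

    -- This has to work with open sets instead of coordinates, because it is applied to the wedge as
    -- well.
    homotopic-trans : {f g h : X ⇒ Y} → Homotopic f g → Homotopic g h → Homotopic f h
    homotopic-trans {f} {g} {h} (F , F₀ , F₁) (G , G₀ , G₁) = H , H₀ , H₁
      where
      F′ G′ : X ×ₜ unitInterval ⇒ Y
      F′ = F ∘ₜ productMap (idₜ X) first-half
      G′ = G ∘ₜ productMap (idₜ X) second-half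
      module F′ = _⇒_ F′
      module G′ = _⇒_ G′

      select : ∀ {s} → s ≤ ½ ⊎ ½ ≤ s → X.Carrier × I.Pt → Y.Carrier
      select c p = [ (λ _ → F′.to p) , (λ _ → G′.to p) ]′ c

      2½ : ∀ {s} → s ≈ ½ → 2# * s ≈ 1#
      2½ e = trans (*-congˡ e) 2*½≈1

      agree : ∀ x (s : I.Pt) → proj₁ s zero ≈ ½ → F′.to (x , s) Y.≈ G′.to (x , s)
      agree x s e = Y.trans (_⇒_.cong F (X.refl , λ { zero → clamp-≥1 (≤-reflexive (sym (2½ e))) }))
        (Y.trans (F₁ x) (Y.trans (Y.sym (G₀ x))
          (_⇒_.cong G (X.refl , λ { zero → sym (clamp-≤0 (≤-reflexive (trans (+-congʳ (2½ e)) (-‿inverseʳ 1#)))) }))))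

      is-first : ∀ (p : X.Carrier × I.Pt) (c : proj₁ (proj₂ p) zero ≤ ½ ⊎ ½ ≤ proj₁ (proj₂ p) zero) →
                 proj₁ (proj₂ p) zero ≤ ½ → select c p Y.≈ F′.to p
      is-first p       (inj₁ _) _ = Y.refl
      is-first (x , s) (inj₂ q) r = Y.sym (agree x s (≤-antisym r q))

      is-second : ∀ (p : X.Carrier × I.Pt) (c : proj₁ (proj₂ p) zero ≤ ½ ⊎ ½ ≤ proj₁ (proj₂ p) zero) →
                  ½ ≤ proj₁ (proj₂ p) zero → select c p Y.≈ G′.to p
      is-second (x , s) (inj₁ q) r = agree x s (≤-antisym q r)
      is-second p       (inj₂ _) _ = Y.refl

      value : X.Carrier × I.Pt → Y.Carrier
      value p = select (total (proj₁ (proj₂ p) zero) ½) p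

      value-first : ∀ p → proj₁ (proj₂ p) zero ≤ ½ → value p Y.≈ F′.to p
      value-first p = is-first p (total (proj₁ (proj₂ p) zero) ½)

      value-second : ∀ p → ½ ≤ proj₁ (proj₂ p) zero → value p Y.≈ G′.to p
      value-second p = is-second p (total (proj₁ (proj₂ p) zero) ½)

      below above : Pred I.Pt _
      below s = proj₁ s zero < ½
      above s = ½ < proj₁ s zero

      open-below : I.Open below
      open-below = I.ball⇒open λ s p →
        let (δ , 0<δ , c) = cont-positive {interval} (cont-neg {interval} (cont-coord {interval} zero)) s (- ½) (neg-mono-< p)
        in δ , 0<δ , λ t b → lt (gap< (c t b)) (solve 2 (λ a b → :- a :- :- b := b :- a) refl _ _)

      open-above : I.Open above
      open-above = I.ball⇒open λ s p → cont-positive {interval} (cont-coord {interval} zero) s ½ p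

      H : X ×ₜ unitInterval ⇒ Y
      H = record
        { func = record
          { to = value
          ; cong = λ { {x , s} {y , t} (p , q) →
              [ (λ r → Y.trans (value-first (x , s) r) (Y.trans (F′.cong {x , s} {y , t} (p , q))
                         (Y.sym (value-first (y , t) (≤-respˡ-≈ (q zero) r)))))
              , (λ r → Y.trans (value-second (x , s) r) (Y.trans (G′.cong {x , s} {y , t} (p , q))
                         (Y.sym (value-second (y , t) (≤-respʳ-≈ (q zero) r))))) ]′ (total (proj₁ s zero) ½) }
          }
        ; continuous = λ V oV (x , s) v → nbhd V oV x s v (compare (proj₁ s zero) ½)
        }
        where
        nbhd : ∀ V → Y.Open V → ∀ x s → V (value (x , s)) → _ →
               ∃₂ λ U W → X.Open U × I.Open W × (U x × W s) × (∀ {q} → U (proj₁ q) × W (proj₂ q) → V (value q))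
        nbhd V oV x s v (tri< s<½ _ _) =
          let (U , W , oU , oW , (u , w) , sub) = F′.continuous V oV (x , s) (Y.resp-≈ oV (value-first (x , s) (<⇒≤ s<½)) v)
          in U , W ∩ below , oU , TopologicalSpace.inter unitInterval oW open-below , (u , w , s<½) ,
             λ {q} (u′ , w′ , r) → Y.resp-≈ oV (Y.sym (value-first q (<⇒≤ r))) (sub {q} (u′ , w′))
        nbhd V oV x s v (tri> _ _ ½<s) =
          let (U , W , oU , oW , (u , w) , sub) = G′.continuous V oV (x , s) (Y.resp-≈ oV (value-second (x , s) (<⇒≤ ½<s)) v)
          in U , W ∩ above , oU , TopologicalSpace.inter unitInterval oW open-above , (u , w , ½<s) ,
             λ {q} (u′ , w′ , r) → Y.resp-≈ oV (Y.sym (value-second q (<⇒≤ r))) (sub {q} (u′ , w′))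
        -- A neighbourhood of the midpoint meets both halves, so it has to be good for both maps.
        nbhd V oV x s v (tri≈ _ e _) =
          let (U , W , oU , oW , (u , w) , sub) = F′.continuous V oV (x , s) (Y.resp-≈ oV (value-first (x , s) (≤-reflexive e)) v)
              (U′ , W′ , oU′ , oW′ , (u′ , w′) , sub′) =
                G′.continuous V oV (x , s) (Y.resp-≈ oV (value-second (x , s) (≤-reflexive (sym e))) v)
          in U ∩ U′ , W ∩ W′ , X.inter oU oU′ , TopologicalSpace.inter unitInterval oW oW′ , ((u , u′) , (w , w′)) ,
             λ {q} ((a , a′) , (b , b′)) →
               [ (λ r → Y.resp-≈ oV (Y.sym (value-first q r)) (sub {q} (a , b)))
               , (λ r → Y.resp-≈ oV (Y.sym (value-second q r)) (sub′ {q} (a′ , b′))) ]′ (total (proj₁ (proj₂ q) zero) ½)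

      H₀ : ∀ x → value (x , 𝕀₀) Y.≈ _⇒_.to f x
      H₀ x = Y.trans (value-first (x , 𝕀₀) (<⇒≤ 0<½))
        (Y.trans (_⇒_.cong F (X.refl , λ { zero → clamp-≤0 (≤-reflexive (zeroʳ 2#)) })) (F₀ x))

      H₁ : ∀ x → value (x , 𝕀₁) Y.≈ _⇒_.to h x
      H₁ x = Y.trans (value-second (x , 𝕀₁) ½≤1)
        (Y.trans (_⇒_.cong G (X.refl , λ { zero → clamp-≥1 (≤-reflexive
           (solve 0 (con (+ 1) := (con (+ 2) :* con (+ 1)) :- con (+ 1)) refl)) })) (G₁ x))
        where
        ½≤1 : ½ ≤ 1#
        ½≤1 = le (<⇒≤ 0<½) (trans (solve 1 (λ h → h := con (+ 2) :* h :- h) refl ½) (+-congʳ 2*½≈1))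

  ≃-trans : ∀ {X Y Z} → X ≃ Y → Y ≃ Z → X ≃ Z
  ≃-trans {X} {Y} {Z} (f , g , (gf , gf₀ , gf₁) , (fg , fg₀ , fg₁)) (f′ , g′ , (gf′ , gf′₀ , gf′₁) , (fg′ , fg′₀ , fg′₁)) =
    f′ ∘ₜ f , g ∘ₜ g′ ,
    homotopic-trans {f = (g ∘ₜ g′) ∘ₜ (f′ ∘ₜ f)} {g = g ∘ₜ f} {h = idₜ X}
      (g ∘ₜ (gf′ ∘ₜ productMap f (idₜ unitInterval)) ,
        (λ x → _⇒_.cong g (gf′₀ (_⇒_.to f x))) , (λ x → _⇒_.cong g (gf′₁ (_⇒_.to f x))))
      (gf , gf₀ , gf₁) ,
    homotopic-trans {f = (f′ ∘ₜ f) ∘ₜ (g ∘ₜ g′)} {g = f′ ∘ₜ g′} {h = idₜ Z}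
      (f′ ∘ₜ (fg ∘ₜ productMap g′ (idₜ unitInterval)) ,
        (λ z → _⇒_.cong f′ (fg₀ (_⇒_.to g′ z))) , (λ z → _⇒_.cong f′ (fg₁ (_⇒_.to g′ z))))
      (fg′ , fg′₀ , fg′₁)

-- Simplicial complexes given by nonfaces, and their collapses.

private
  variable
    d n : ℕ

-- Membership of `T` in the complex whose nonfaces are the supersets of members of `Φ`. In this
-- encoding, removing all faces that contain a given set just adds that set to the list.
Avoids : List (Subset n) → Subset n → Set
Avoids Φ T = All (_⊈ T) Φ

avoids? : (Φ : List (Subset n)) (T : Subset n) → Dec (Avoids Φ T)
avoids? Φ T = All.all? (λ φ → ¬? (φ ⊆? T)) Φ

avoids-antitone : ∀ {Φ : List (Subset n)} {T T′} → T ⊆ T′ → Avoids Φ T′ → Avoids Φ T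
avoids-antitone T⊆T′ = All.map λ φ⊈T′ φ⊆T → φ⊈T′ λ p∈φ → T⊆T′ (φ⊆T p∈φ)

-- (T , v) stands for the removal of all faces containing T, which is possible
-- when v can be added to each of them.
Collapse : ℕ → Set
Collapse n = Subset n × Fin n

-- A counterexample to the applicability of a collapse. Validity is stated as the absence of
-- counterexamples, because `anySubset?` decides existence.
Obstructs : List (Subset n) → Collapse n → Subset n → Set
Obstructs Φ (T , v) T′ = Avoids Φ T′ × T ⊆ T′ × ¬ Avoids Φ (T′ ∪ ⁅ v ⁆)

Valid : List (Subset n) → List (Collapse n) → Set
Valid Φ []            = ⊤
Valid Φ ((T , v) ∷ l) = Nonempty T × v ∉ T × (¬ ∃ (Obstructs Φ (T , v))) × Valid (T ∷ Φ) l

valid? : (Φ : List (Subset n)) (l : List (Collapse n)) → Dec (Valid Φ l)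
valid? Φ []            = yes tt
valid? Φ ((T , v) ∷ l) = nonempty? T ×-dec ¬? (v ∈? T) ×-dec
  ¬? (anySubset? λ T′ → avoids? Φ T′ ×-dec T ⊆? T′ ×-dec ¬? (avoids? Φ (T′ ∪ ⁅ v ⁆))) ×-dec valid? (T ∷ Φ) l

remaining : List (Subset n) → List (Collapse n) → List (Subset n)
remaining Φ []            = Φ
remaining Φ ((T , _) ∷ l) = remaining (T ∷ Φ) l

∉-remove : ∀ (T : Subset n) p → p ∉ T Subset.- p
∉-remove (_ ∷ T) zero    ()
∉-remove (_ ∷ T) (suc p) (there p∈) = ∉-remove T p p∈

-- Nonnegative vectors carried by a complex, and the flow of a collapse on them.

module Cones (ℝ : CompleteOrderedField) where
  open Homotopies ℝ public
  open Space using (Pt)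

  Coords : ℕ → Set
  Coords n = Fin n → Carrier

  maximum : Coords (suc n) → Carrier
  maximum {zero}  x = x zero
  maximum {suc n} x = x zero ⊔ maximum (x ∘ suc)

  ≤maximum : (x : Coords (suc n)) → ∀ p → x p ≤ maximum x
  ≤maximum {zero}  x zero    = ≤-refl
  ≤maximum {suc n} x zero    = x≤x⊔y _ _
  ≤maximum {suc n} x (suc p) = ≤-trans (≤maximum (x ∘ suc) p) (x≤y⊔x _ _)

  maximum-attained : (x : Coords (suc n)) → ∃ λ p → maximum x ≈ x p
  maximum-attained {zero}  x = zero , refl
  maximum-attained {suc n} x with ⊔-sel (x zero) (maximum (x ∘ suc)) | maximum-attained (x ∘ suc)
  ... | inj₁ e | _       = zero , e
  ... | inj₂ e | p , e′ = suc p , trans e e′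

  minimumFrom : Subset n → Coords n → Carrier → Carrier
  minimumFrom []            x d = d
  minimumFrom (inside ∷ T)  x d = x zero ⊓ minimumFrom T (x ∘ suc) d
  minimumFrom (outside ∷ T) x d = minimumFrom T (x ∘ suc) d

  minimumFrom≤ : ∀ (T : Subset n) x d {p} → p ∈ T → minimumFrom T x d ≤ x p
  minimumFrom≤ (inside ∷ T)  x d here       = x⊓y≤x _ _
  minimumFrom≤ (inside ∷ T)  x d (there p∈) = ≤-trans (x⊓y≤y _ _) (minimumFrom≤ T (x ∘ suc) d p∈)
  minimumFrom≤ (outside ∷ T) x d (there p∈) = minimumFrom≤ T (x ∘ suc) d p∈

  minimumFrom-attained : ∀ (T : Subset n) x d → minimumFrom T x d ≈ d ⊎ ∃ λ p → p ∈ T × minimumFrom T x d ≈ x p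
  minimumFrom-attained []            x d = inj₁ refl
  minimumFrom-attained (inside ∷ T)  x d with ⊓-sel (x zero) (minimumFrom T (x ∘ suc) d) | minimumFrom-attained T (x ∘ suc) d
  ... | inj₁ e | _                    = inj₂ (zero , here , e)
  ... | inj₂ e | inj₁ e′             = inj₁ (trans e e′)
  ... | inj₂ e | inj₂ (p , p∈ , e′) = inj₂ (suc p , there p∈ , trans e e′)
  minimumFrom-attained (outside ∷ T) x d with minimumFrom-attained T (x ∘ suc) d
  ... | inj₁ e            = inj₁ e
  ... | inj₂ (p , p∈ , e) = inj₂ (suc p , there p∈ , e)

  minimumFrom≤d : ∀ (T : Subset n) x d → minimumFrom T x d ≤ d
  minimumFrom≤d []            x d = ≤-refl
  minimumFrom≤d (inside ∷ T)  x d = ≤-trans (x⊓y≤y _ _) (minimumFrom≤d T (x ∘ suc) d)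
  minimumFrom≤d (outside ∷ T) x d = minimumFrom≤d T (x ∘ suc) d

  -- The default `maximum x` never undercuts a coordinate, so it has no influence on the minimum
  -- over a nonempty `T`, and the expression is continuous for every `T`.
  minimumOn : Subset (suc n) → Coords (suc n) → Carrier
  minimumOn T x = minimumFrom T x (maximum x)

  minimumOn≤ : ∀ (T : Subset (suc n)) x {p} → p ∈ T → minimumOn T x ≤ x p
  minimumOn≤ T x = minimumFrom≤ T x (maximum x)

  minimumOn-attained : ∀ (T : Subset (suc n)) x → Nonempty T → ∃ λ p → p ∈ T × minimumOn T x ≈ x p
  minimumOn-attained T x (q , q∈T) with minimumFrom-attained T x (maximum x)
  ... | inj₂ e = e
  ... | inj₁ e = q , q∈T , ≤-antisym (minimumOn≤ T x q∈T) (≤-respʳ-≈ (sym e) (≤maximum x q))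

  module _ {X : Space} where
    cont-maximum : {φ : Pt X → Coords (suc n)} → (∀ p → Cont X (λ z → φ z p)) → Cont X (maximum ∘ φ)
    cont-maximum {zero}  c = c zero
    cont-maximum {suc n} c = cont-⊔ {X} (c zero) (cont-maximum (c ∘ suc))

    cont-minimumFrom : ∀ (T : Subset n) {φ : Pt X → Coords n} {δ} → (∀ p → Cont X (λ z → φ z p)) → Cont X δ →
                       Cont X (λ z → minimumFrom T (φ z) (δ z))
    cont-minimumFrom []            c d = d
    cont-minimumFrom (inside ∷ T)  c d = cont-⊓ {X} (c zero) (cont-minimumFrom T (c ∘ suc) d)
    cont-minimumFrom (outside ∷ T) c d = cont-minimumFrom T (c ∘ suc) d

    cont-minimumOn : ∀ (T : Subset (suc n)) {φ : Pt X → Coords (suc n)} → (∀ p → Cont X (λ z → φ z p)) →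
                     Cont X (minimumOn T ∘ φ)
    cont-minimumOn T c = cont-minimumFrom T c (cont-maximum c)

  maximum-cong : {x y : Coords (suc n)} → (∀ p → x p ≈ y p) → maximum x ≈ maximum y
  maximum-cong {zero}  e = e zero
  maximum-cong {suc n} e = ⊔-cong (e zero) (maximum-cong (e ∘ suc))

  minimumFrom-cong : ∀ (T : Subset n) {x y d e} → (∀ p → x p ≈ y p) → d ≈ e → minimumFrom T x d ≈ minimumFrom T y e
  minimumFrom-cong []            f g = g
  minimumFrom-cong (inside ∷ T)  f g = ⊓-cong (f zero) (minimumFrom-cong T (f ∘ suc) g)
  minimumFrom-cong (outside ∷ T) f g = minimumFrom-cong T (f ∘ suc) g

  minimumOn-cong : ∀ (T : Subset (suc n)) {x y} → (∀ p → x p ≈ y p) → minimumOn T x ≈ minimumOn T y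
  minimumOn-cong T e = minimumFrom-cong T e (maximum-cong e)

  _<?_ : ∀ x y → Dec (x < y)
  x <? y = [ yes , (λ y≤x → no (≤⇒≯ y≤x)) ]′ (<-≤-total x y)

  support : Coords n → Subset n
  support x = tabulate λ p → does (0# <? x p)

  ∈support⁺ : ∀ (x : Coords n) {p} → 0# < x p → p ∈ support x
  ∈support⁺ x {p} 0<x = Vec.lookup⇒[]= p _ (≡.trans (Vec.lookup∘tabulate _ p) (dec-true (0# <? x p) 0<x))

  ∈support⁻ : ∀ (x : Coords n) {p} → p ∈ support x → 0# < x p
  ∈support⁻ x {p} p∈ with 0# <? x p | ≡.trans (≡.sym (Vec.lookup∘tabulate (λ q → does (0# <? x q)) p)) (Vec.[]=⇒lookup p∈)
  ... | yes 0<x | _  = 0<x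
  ... | no _    | ()

  NonNeg : Coords n → Set
  NonNeg x = ∀ p → 0# ≤ x p

  NonZero : Coords n → Set
  NonZero x = ∃ λ p → 0# < x p

  Carried : List (Subset n) → Coords n → Set
  Carried Φ x = NonNeg x × Avoids Φ (support x)

  carried-by : ∀ {Φ x} (T : Subset n) → NonNeg x → Avoids Φ T → (∀ p → 0# < x p → p ∈ T) → Carried Φ x
  carried-by {x = x} T x≥0 T∈ s = x≥0 , avoids-antitone (λ {p} p∈ → s p (∈support⁻ x p∈)) T∈

  carried-⊆ : ∀ {Φ} {x y : Coords n} → Carried Φ x → NonNeg y → (∀ p → 0# < y p → 0# < x p) → Carried Φ y
  carried-⊆ {x = x} (x≥0 , a) y≥0 s = carried-by (support x) y≥0 a λ p 0<y → ∈support⁺ x (s p 0<y)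

  carried-≈ : ∀ {Φ} {x y : Coords n} → (∀ p → x p ≈ y p) → Carried Φ x → Carried Φ y
  carried-≈ e c = carried-⊆ c (λ p → ≤-respʳ-≈ (e p) (proj₁ c p)) λ p → <-respʳ-≈ (sym (e p))

  nonzero-≈ : {x y : Coords n} → (∀ p → x p ≈ y p) → NonZero x → NonZero y
  nonzero-≈ e (p , 0<x) = p , <-respʳ-≈ (e p) 0<x

  minimumOn-pos : ∀ (T : Subset (suc n)) x → Nonempty T → T ⊆ support x → 0# < minimumOn T x
  minimumOn-pos T x ne T⊆ = let (p , p∈T , e) = minimumOn-attained T x ne in
    <-respʳ-≈ (sym e) (∈support⁻ x (T⊆ p∈T))

  minimumOn-nonNeg : ∀ (T : Subset (suc n)) {x} → Nonempty T → NonNeg x → 0# ≤ minimumOn T x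
  minimumOn-nonNeg T {x} ne x≥0 = let (p , p∈T , e) = minimumOn-attained T x ne in ≤-respʳ-≈ (sym e) (x≥0 p)

  minimumOn-pos⁻ : ∀ (T : Subset (suc n)) x → 0# < minimumOn T x → T ⊆ support x
  minimumOn-pos⁻ T x 0<m p∈T = ∈support⁺ x (<-≤-trans 0<m (minimumOn≤ T x p∈T))

  direction : Collapse n → Fin n → Carrier
  direction (T , v) p with p ∈? T | p Fin.≟ v
  ... | yes _ | _     = - 1#
  ... | no _  | yes _ = 1#
  ... | no _  | no _  = 0#

  push : Collapse (suc n) → Carrier → Coords (suc n) → Coords (suc n)
  push (T , v) s x p = x p + s * minimumOn T x * direction (T , v) p

  data Position (c : Collapse (suc n)) (s : Carrier) (x : Coords (suc n)) (p : Fin (suc n)) : Set where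
    removed : p ∈ proj₁ c → push c s x p ≈ x p - s * minimumOn (proj₁ c) x → Position c s x p
    added   : p ∉ proj₁ c → p ≡ proj₂ c → push c s x p ≈ x p + s * minimumOn (proj₁ c) x → Position c s x p
    fixed   : p ∉ proj₁ c → ¬ p ≡ proj₂ c → push c s x p ≈ x p → Position c s x p

  direction-cases : ∀ (c : Collapse n) p → (p ∈ proj₁ c × direction c p ≡ - 1#) ⊎
    (p ∉ proj₁ c × p ≡ proj₂ c × direction c p ≡ 1#) ⊎ (p ∉ proj₁ c × ¬ p ≡ proj₂ c × direction c p ≡ 0#)
  direction-cases (T , v) p with p ∈? T | p Fin.≟ v
  ... | yes p∈ | _     = inj₁ (p∈ , ≡.refl)
  ... | no p∉  | yes e = inj₂ (inj₁ (p∉ , e , ≡.refl))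
  ... | no p∉  | no ne = inj₂ (inj₂ (p∉ , ne , ≡.refl))

  position : ∀ (c : Collapse (suc n)) s x p → Position c s x p
  position c s x p with direction-cases c p
  ... | inj₁ (p∈ , e)             = removed p∈ (trans (+-congˡ (*-congˡ (reflexive e)))
                                      (solve 2 (λ x t → x :+ t :* :- con (+ 1) := x :- t) refl (x p) _))
  ... | inj₂ (inj₁ (p∉ , p≡v , e)) = added p∉ p≡v (+-congˡ (≈1⇒*≈ˡ (reflexive e)))
  ... | inj₂ (inj₂ (p∉ , p≢v , e)) = fixed p∉ p≢v (trans (+-congˡ (≈0⇒*≈0ʳ (reflexive e))) (+-identityʳ _))

  module _ {T : Subset (suc n)} {v : Fin (suc n)} (ne : Nonempty T) (v∉T : v ∉ T)
           {s : Carrier} (0≤s : 0# ≤ s) (s≤1 : s ≤ 1#) {x : Coords (suc n)} (x≥0 : NonNeg x) where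
    private
      m = minimumOn T x
      y = push (T , v) s x
      0≤m = minimumOn-nonNeg T ne x≥0
      0≤sm = *-nonNeg 0≤s 0≤m
      sm≤m : s * m ≤ m
      sm≤m = ≤-respʳ-≈ (*-identityʳ m) (≤-respˡ-≈ (*-comm m s) (*-monoʳ-≤ 0≤m s≤1))

    push-nonNeg : NonNeg y
    push-nonNeg p with position (T , v) s x p
    ... | removed p∈ e = ≤-respʳ-≈ (sym e) (gap≤ (≤-trans sm≤m (minimumOn≤ T x p∈)))
    ... | added _ _ e  = ≤-respʳ-≈ (sym e) (+-nonNeg (x≥0 p) 0≤sm)
    ... | fixed _ _ e  = ≤-respʳ-≈ (sym e) (x≥0 p)

    push-nonZero : NonZero x → NonZero y
    push-nonZero (p , 0<x) with 0≤⇒≈⊎< 0≤sm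
    ... | inj₁ sm≈0 = p , <-respʳ-≈ (sym (trans (+-congˡ (≈0⇒*≈0ˡ sm≈0)) (+-identityʳ _))) 0<x
    ... | inj₂ 0<sm with position (T , v) s x v
    ...   | removed v∈ _ = ⊥-elim (v∉T v∈)
    ...   | added _ _ e  = v , <-respʳ-≈ (sym e) (+-nonNeg-pos (x≥0 v) 0<sm)
    ...   | fixed _ v≢v _ = ⊥-elim (v≢v ≡.refl)

    private
      removed⇒pos : ∀ {p} → y p ≈ x p - s * m → 0# < y p → 0# < x p
      removed⇒pos {p} e 0<y = <-≤-trans (<-respʳ-≈ e 0<y)
        (le 0≤sm (solve 2 (λ x t → t := x :- (x :- t)) refl (x p) (s * m)))

      unmoved : ¬ T ⊆ support x → ∀ p → y p ≈ x p
      unmoved T⊈ p = trans (+-congˡ (≈0⇒*≈0ˡ (≈0⇒*≈0ʳ m≈0))) (+-identityʳ _)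
        where
        m≈0 : m ≈ 0#
        m≈0 = [ id , (λ 0<m → ⊥-elim (T⊈ (minimumOn-pos⁻ T x 0<m))) ]′ (0≤⇒≈⊎< 0≤m)

      pos⇒∈ : ∀ p → 0# < y p → p ∈ support x ∪ ⁅ v ⁆
      pos⇒∈ p 0<y with position (T , v) s x p
      ... | removed _ e       = x∈p∪q⁺ (inj₁ (∈support⁺ x (removed⇒pos e 0<y)))
      ... | added _ ≡.refl _  = x∈p∪q⁺ {p = support x} (inj₂ (x∈⁅x⁆ v))
      ... | fixed _ _ e       = x∈p∪q⁺ (inj₁ (∈support⁺ x (<-respʳ-≈ e 0<y)))

    module _ {Φ} (unobstructed : ¬ ∃ (Obstructs Φ (T , v))) (a : Avoids Φ (support x)) where
      private
        a∪v : T ⊆ support x → Avoids Φ (support x ∪ ⁅ v ⁆)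
        a∪v T⊆ = decidable-stable (avoids? Φ _) λ ¬a → unobstructed (support x , a , T⊆ , ¬a)

      -- Only the coordinate at `v` can become positive, and it moves only if `T` lies in the
      -- support, in which case `v` may be added to that support.
      push-carried : Carried Φ y
      push-carried with T ⊆? support x
      ... | no T⊈  = carried-≈ (λ p → sym (unmoved T⊈ p)) (x≥0 , a)
      ... | yes T⊆ = carried-by (support x ∪ ⁅ v ⁆) push-nonNeg (a∪v T⊆) pos⇒∈

      -- At full strength the coordinate at which the minimum over `T` is attained drops to zero, so
      -- the support loses a member of `T`.
      push-collapsed : s ≈ 1# → Carried (T ∷ Φ) y
      push-collapsed s≈1 with T ⊆? support x
      ... | no T⊈  = carried-≈ (λ p → sym (unmoved T⊈ p)) (x≥0 , T⊈ ∷ a)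
      ... | yes T⊆ = carried-by S push-nonNeg (T⊈S ∷ avoids-antitone (λ {p} → p─q⊆p _ _ {p}) (a∪v T⊆)) pos⇒∈S
        where
        q = proj₁ (minimumOn-attained T x ne)
        q∈T = proj₁ (proj₂ (minimumOn-attained T x ne))
        m≈xq = proj₂ (proj₂ (minimumOn-attained T x ne))
        S = (support x ∪ ⁅ v ⁆) Subset.- q
        T⊈S : T ⊈ S
        T⊈S T⊆S = ∉-remove (support x ∪ ⁅ v ⁆) q (T⊆S q∈T)
        yq≈0 : y q ≈ 0#
        yq≈0 with position (T , v) s x q
        ... | removed _ e  = trans e (trans (+-congˡ (-‿cong (trans (*-congʳ s≈1) (trans (*-identityˡ m) m≈xq)))) (-‿inverseʳ _))
        ... | added q∉ _ _ = ⊥-elim (q∉ q∈T)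
        ... | fixed q∉ _ _ = ⊥-elim (q∉ q∈T)
        pos⇒∈S : ∀ p → 0# < y p → p ∈ S
        pos⇒∈S p 0<y = x∈p∧x≢y⇒x∈p-y (pos⇒∈ p 0<y) λ { ≡.refl → 0<⇒≉ 0<y yq≈0 }

  push-0 : ∀ (c : Collapse (suc n)) {s} x → s ≈ 0# → ∀ p → push c s x p ≈ x p
  push-0 c x s≈0 p = trans (+-congˡ (≈0⇒*≈0ˡ (≈0⇒*≈0ˡ s≈0))) (+-identityʳ _)

  -- Each collapse takes one unit of the time A.
  run : List (Collapse (suc n)) → Carrier → Coords (suc n) → Coords (suc n)
  run []      A x = x
  run (c ∷ l) A x = run l (A - 1#) (push c (clamp A) x)

  duration : List (Collapse n) → Carrier
  duration []      = 0#
  duration (_ ∷ l) = duration l + 1#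

  0≤duration : ∀ (l : List (Collapse n)) → 0# ≤ duration l
  0≤duration []      = ≤-refl
  0≤duration (_ ∷ l) = +-nonNeg (0≤duration l) (<⇒≤ 0<1)

  run-≤0 : ∀ (l : List (Collapse (suc n))) {A} x → A ≤ 0# → ∀ p → run l A x p ≈ x p
  run-≤0 []      x A≤0 p = refl
  run-≤0 (c ∷ l) {A} x A≤0 p = trans (run-≤0 l _ A-1≤0 p) (push-0 c x (clamp-≤0 A≤0) p)
    where
    A-1≤0 : A - 1# ≤ 0#
    A-1≤0 = ≤-trans (le (<⇒≤ 0<1) (solve 1 (λ a → con (+ 1) := a :- (a :- con (+ 1))) refl A)) A≤0

  run-nonZero : ∀ {Φ} (l : List (Collapse (suc n))) {A x} → Valid Φ l → NonNeg x → NonZero x → NonZero (run l A x)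
  run-nonZero []      _ _ x≢0 = x≢0
  run-nonZero ((T , v) ∷ l) {A} (ne , v∉T , _ , val) x≥0 x≢0 =
    run-nonZero l val (push-nonNeg ne v∉T (0≤clamp A) (clamp≤1 A) x≥0)
                      (push-nonZero ne v∉T (0≤clamp A) (clamp≤1 A) x≥0 x≢0)

  -- Up to time 1 only the first collapse acts. Later its set `T` has become a nonface of the
  -- carrier, and the rest of the list is valid for that smaller complex.
  run-carried : ∀ {Φ} (l : List (Collapse (suc n))) {A x} → Valid Φ l → Carried Φ x → Carried Φ (run l A x)
  run-carried []      _ c = c
  run-carried {Φ = Φ} ((T , v) ∷ l) {A} {x} (ne , v∉T , uno , val) (x≥0 , a) = [ early , late ]′ (total A 1#)
    where
    early : A ≤ 1# → Carried Φ (run ((T , v) ∷ l) A x)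
    early A≤1 = carried-≈ (λ p → sym (run-≤0 l _ (le (gap≤ A≤1)
        (solve 1 (λ a → con (+ 1) :- a := con (+ 0) :- (a :- con (+ 1))) refl A)) p))
      (push-carried ne v∉T (0≤clamp A) (clamp≤1 A) x≥0 uno a)
    late : 1# ≤ A → Carried Φ (run ((T , v) ∷ l) A x)
    late 1≤A = let (y≥0 , b) = run-carried l val
                     (push-collapsed ne v∉T (0≤clamp A) (clamp≤1 A) x≥0 uno a (clamp-≥1 1≤A))
               in y≥0 , All.tail b

  run-collapsed : ∀ {Φ} (l : List (Collapse (suc n))) {A x} → Valid Φ l → duration l ≤ A → Carried Φ x →
                  Carried (remaining Φ l) (run l A x)
  run-collapsed []      _ _ c = c
  run-collapsed ((T , v) ∷ l) {A} {x} (ne , v∉T , uno , val) d (x≥0 , a) =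
    run-collapsed l val
      (le (gap≤ d) (solve 2 (λ a d → a :- (d :+ con (+ 1)) := (a :- con (+ 1)) :- d) refl A (duration l)))
      (push-collapsed ne v∉T (0≤clamp A) (clamp≤1 A) x≥0 uno a (clamp-≥1 (≤-trans 1≤d d)))
    where
    1≤d : 1# ≤ duration l + 1#
    1≤d = le (0≤duration l) (solve 1 (λ d → d := (d :+ con (+ 1)) :- con (+ 1)) refl (duration l))

  clamp-cong : ∀ {a b} → a ≈ b → clamp a ≈ clamp b
  clamp-cong e = ⊔-cong refl (⊓-cong e refl)

  run-cong : ∀ (l : List (Collapse (suc n))) {A B x y} → A ≈ B → (∀ p → x p ≈ y p) → ∀ p → run l A x p ≈ run l B y p
  run-cong []            e f p = f p
  run-cong ((T , v) ∷ l) e f p = run-cong l (+-congʳ e)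
    (λ q → +-cong (f q) (*-congʳ (*-cong (clamp-cong e) (minimumOn-cong T f)))) p

  module _ {X : Space} where
    cont-run : ∀ (l : List (Collapse (suc n))) {A : Pt X → Carrier} {φ : Pt X → Coords (suc n)} →
               Cont X A → (∀ p → Cont X (λ z → φ z p)) → ∀ p → Cont X (λ z → run l (A z) (φ z) p)
    cont-run []            cA cφ p = cφ p
    cont-run ((T , v) ∷ l) cA cφ p = cont-run l (cont-sub {X} cA (cont-const {X} 1#))
      (λ q → cont-+ {X} (cφ q) (cont-* {X} (cont-* {X} (cont-clamp {X} cA) (cont-minimumOn {X} T cφ)) (cont-const {X} (direction (T , v) q)))) p

-- A complex split into some facets and a collapsible core.

image : (Fin d → Fin n) → Subset n
image φ = tabulate λ p → does (Fin.any? λ j → φ j Fin.≟ p)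

∈image⁺ : ∀ (φ : Fin d → Fin n) j → φ j ∈ image φ
∈image⁺ φ j = Vec.lookup⇒[]= (φ j) _
  (≡.trans (Vec.lookup∘tabulate _ (φ j)) (dec-true (Fin.any? λ i → φ i Fin.≟ φ j) (j , ≡.refl)))

∈image⁻ : ∀ (φ : Fin d → Fin n) {p} → p ∈ image φ → ∃ λ j → φ j ≡ p
∈image⁻ φ {p} p∈ with Fin.any? (λ j → φ j Fin.≟ p)
                    | ≡.trans (≡.sym (Vec.lookup∘tabulate (λ q → does (Fin.any? λ j → φ j Fin.≟ q)) p)) (Vec.[]=⇒lookup p∈)
... | yes e | _  = e
... | no _  | ()

record Decomposition (n k d : ℕ) : Set where
  field
    nonfaces  : List (Subset (suc n))
    vertex    : Fin (suc k) → Fin (suc d) → Fin (suc n)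
    injective : ∀ i {j j′} → vertex i j ≡ vertex i j′ → j ≡ j′

  facet : Fin (suc k) → Subset (suc n)
  facet i = image (vertex i)

  -- The facets are maximal, so turning them into nonfaces removes no other face.
  core : List (Subset (suc n))
  core = tabulateᴸ facet ++ nonfaces

  field
    facet-face    : ∀ i → Avoids nonfaces (facet i)
    facet-maximal : ∀ i {T} → Avoids nonfaces T → facet i ⊆ T → T ⊆ facet i
    facet-unique  : ∀ {i j} → facet i ⊆ facet j → i ≡ j
    collapses     : List (Collapse (suc n))
    valid         : Valid core collapses
    apex          : Fin (suc n)
    apex-core     : Avoids core ⁅ apex ⁆
    collapsed     : ∀ {T} → Avoids (remaining core collapses) T → T ⊆ ⁅ apex ⁆

  core⇒nonfaces : ∀ {T} → Avoids core T → Avoids nonfaces T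
  core⇒nonfaces = All.++⁻ʳ (tabulateᴸ facet)

  core⇒facet⊈ : ∀ {T} → Avoids core T → ∀ i → facet i ⊈ T
  core⇒facet⊈ a = All.tabulate⁻ (All.++⁻ˡ (tabulateᴸ facet) a)

  core-intro : ∀ {T} → (∀ i → facet i ⊈ T) → Avoids nonfaces T → Avoids core T
  core-intro f a = All.++⁺ (All.tabulate⁺ f) a

-- Normalisation onto the unit sphere, extension by zero, gluing of open sets.

module Spheres (ℝ : CompleteOrderedField) where
  open Cones ℝ public
  open Space using (Pt)

  sum-nonNeg : ∀ {n} {f : Coords n} → NonNeg f → 0# ≤ sum f
  sum-nonNeg {zero}  _ = ≤-refl
  sum-nonNeg {suc n} f≥0 = +-nonNeg (f≥0 zero) (sum-nonNeg (f≥0 ∘ suc))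

  sum-≈0⇒ : ∀ {n} {f : Coords n} → NonNeg f → sum f ≈ 0# → ∀ i → f i ≈ 0#
  sum-≈0⇒ {suc n} {f} f≥0 e i with 0≤⇒≈⊎< (f≥0 zero) | 0≤⇒≈⊎< (sum-nonNeg (f≥0 ∘ suc))
  ... | inj₂ p | _      = ⊥-elim (0<⇒≉ (+-pos-nonNeg p (sum-nonNeg (f≥0 ∘ suc))) e)
  ... | inj₁ _ | inj₂ q = ⊥-elim (0<⇒≉ (+-nonNeg-pos (f≥0 zero) q) e)
  sum-≈0⇒ {suc n} f≥0 e zero    | inj₁ p | inj₁ _ = p
  sum-≈0⇒ {suc n} f≥0 e (suc i) | inj₁ _ | inj₁ q = sum-≈0⇒ (f≥0 ∘ suc) q i

  x*x≈0⇒x≈0 : ∀ {x} → x * x ≈ 0# → x ≈ 0#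
  x*x≈0⇒x≈0 {x} e with compare x 0#
  ... | tri≈ _ x≈0 _ = x≈0

  ... | tri< _ x≉0 _ = ⊥-elim (0<⇒≉ (x*x-pos x x≉0) e)
  ... | tri> _ x≉0 _ = ⊥-elim (0<⇒≉ (x*x-pos x x≉0) e)

  x*x≈1⇒x≈1 : ∀ {x} → 0# < x → x * x ≈ 1# → x ≈ 1#
  x*x≈1⇒x≈1 {x} 0<x e = trans (sym (solve 1 (λ x → (x :- con (+ 1)) :+ con (+ 1) := x) refl x))
    (trans (+-congʳ (*-zero-divisor (trans (solve 1 (λ x → (x :+ con (+ 1)) :* (x :- con (+ 1)) := x :* x :- con (+ 1)) refl x)
       (trans (+-congʳ e) (-‿inverseʳ 1#))) (+-pos 0<x 0<1))) (+-identityˡ 1#))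

  squares : Coords d → Carrier
  squares q = sum λ j → q j * q j

  squares-pos : ∀ (q : Coords d) → ¬ (∀ j → q j ≈ 0#) → 0# < squares q
  squares-pos q ¬0 with 0≤⇒≈⊎< (sum-nonNeg {f = λ j → q j * q j} (λ j → x*x-nonNeg (q j)))
  ... | inj₂ p = p
  ... | inj₁ e = ⊥-elim (¬0 λ j → x*x≈0⇒x≈0 (sum-≈0⇒ (λ j → x*x-nonNeg (q j)) e j))

  sphere : ℕ → Space
  sphere d = subspaceOf (suc d) λ x → squares x ≈ 1#

  punctured : ℕ → Space
  punctured d = subspaceOf (suc d) λ x → 0# < squares x

  abstract
    scale : ∀ (q : Coords d) → 0# < squares q → ∃ λ κ → 0# < κ × κ * κ * squares q ≈ 1#
    scale q 0<q = let (s , 0<s , ss≈) = sqrt (squares q) 0<q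
                      (κ , 0<κ , sκ≈1) = positive-inverse s 0<s
                  in κ , 0<κ , trans (*-congˡ (sym ss≈)) (trans
                       (solve 2 (λ k s → k :* k :* (s :* s) := (s :* k) :* (s :* k)) refl κ s)
                       (trans (*-cong sκ≈1 sκ≈1) (*-identityˡ 1#)))

    cont-scale : ∀ {X : Space} (ψ : Pt X → Coords d) (pos : ∀ z → 0# < squares (ψ z)) →
                 (∀ j → Cont X (λ z → ψ z j)) → Cont X (λ z → proj₁ (scale (ψ z) (pos z)))
    cont-scale {X = X} ψ pos c = cont-inverse {X} (λ z → proj₁ (proj₂ (root z))) (λ z → proj₂ (proj₂ (inv z)))
        (cont-sqrt {X} (λ z → proj₁ (proj₂ (root z))) (λ z → proj₂ (proj₂ (root z)))
          (cont-sum {X} (λ i → cont-* {X} (c i) (c i))))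
      where
      root : ∀ z → ∃ λ s → 0# < s × s * s ≈ squares (ψ z)
      root z = sqrt (squares (ψ z)) (pos z)
      inv : ∀ z → ∃ λ κ → 0# < κ × proj₁ (root z) * κ ≈ 1#
      inv z = positive-inverse (proj₁ (root z)) (proj₁ (proj₂ (root z)))

  squares-scale : ∀ {d} κ (q : Coords d) → squares (λ j → κ * q j) ≈ κ * κ * squares q
  squares-scale {zero}  κ q = sym (zeroʳ _)
  squares-scale {suc d} κ q = trans (+-congˡ (squares-scale κ (q ∘ suc)))
    (solve 3 (λ k q s → (k :* q) :* (k :* q) :+ k :* k :* s := k :* k :* (q :* q :+ s)) refl κ (q zero) (squares (q ∘ suc)))

  unit : Pt (punctured d) → Pt (sphere d)
  unit (q , 0<q) = let (κ , _ , e) = scale q 0<q in (λ j → κ * q j) , trans (squares-scale κ q) e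

  cont-unit : ∀ {X : Space} {d} (ψ : Pt X → Pt (punctured d)) → (∀ j → Cont X (λ z → proj₁ (ψ z) j)) →
              ∀ j → Cont X (λ z → proj₁ (unit (ψ z)) j)
  cont-unit {X} ψ c j = cont-* {X} (cont-scale {X = X} (λ z → proj₁ (ψ z)) (λ z → proj₂ (ψ z)) c) (c j)

  unit-cong : ∀ {q q′ : Pt (punctured d)} → (∀ j → proj₁ q j ≈ proj₁ q′ j) → ∀ j → proj₁ (unit q) j ≈ proj₁ (unit q′) j
  unit-cong {d} {q} {q′} e j = cont-cong {punctured d}
    (cont-unit {punctured d} id (λ i → cont-coord {punctured d} i) j) {q} {q′} e

  unit-idem : ∀ (q : Pt (punctured d)) → squares (proj₁ q) ≈ 1# → ∀ j → proj₁ (unit q) j ≈ proj₁ q j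
  unit-idem (q , 0<q) e j = let (κ , 0<κ , k) = scale q 0<q in
    ≈1⇒*≈ʳ (x*x≈1⇒x≈1 0<κ (trans (sym (≈1⇒*≈ˡ e)) k))

  sum-≈0 : ∀ {n} {f : Coords n} → (∀ i → f i ≈ 0#) → sum f ≈ 0#
  sum-≈0 {n} e = trans (sum-cong-≋ e) (sum-replicate-zero n)

  on-axis : ∀ (w : Pt (sphere d)) → (∀ j → proj₁ w (suc j) ≈ 0#) → proj₁ w zero * proj₁ w zero ≈ 1#
  on-axis (w , e) z = trans (sym (trans (+-congˡ (sum-≈0 λ j → ≈0⇒*≈0ˡ (z j))) (+-identityʳ _))) e

  ≈basePoint : ∀ (w : Pt (sphere d)) → 0# < proj₁ w zero → (∀ j → proj₁ w (suc j) ≈ 0#) → Space._∼_ (sphere d) w (basePoint d)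
  ≈basePoint w p z zero    = x*x≈1⇒x≈1 p (on-axis w z)
  ≈basePoint w p z (suc j) = z j

  place : (Fin d → Fin n) → Coords d → Coords n
  place φ y p with Fin.any? (λ j → φ j Fin.≟ p)
  ... | yes (j , _) = y j
  ... | no _        = 0#

  place-in : ∀ (φ : Fin d → Fin n) (y : Coords d) → (∀ {j j′} → φ j ≡ φ j′ → j ≡ j′) → ∀ j → place φ y (φ j) ≈ y j
  place-in φ y inj j with Fin.any? (λ i → φ i Fin.≟ φ j)
  ... | yes (i , e) = reflexive (≡.cong y (inj e))
  ... | no ¬e       = ⊥-elim (¬e (j , ≡.refl))

  place-out : ∀ (φ : Fin d → Fin n) (y : Coords d) {p} → p ∉ image φ → place φ y p ≈ 0#
  place-out φ y {p} p∉ with Fin.any? (λ i → φ i Fin.≟ p)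
  ... | yes (i , ≡.refl) = ⊥-elim (p∉ (∈image⁺ φ i))
  ... | no _             = refl

  place-nonNeg : ∀ (φ : Fin d → Fin n) {y : Coords d} → NonNeg y → NonNeg (place φ y)
  place-nonNeg φ y≥0 p with Fin.any? (λ i → φ i Fin.≟ p)
  ... | yes (i , _) = y≥0 i
  ... | no _        = ≤-refl

  cont-place : ∀ {X : Space} (φ : Fin d → Fin n) {ψ : Pt X → Coords d} → (∀ j → Cont X (λ z → ψ z j)) →
               ∀ p → Cont X (λ z → place φ (ψ z) p)
  cont-place {X = X} φ c p with Fin.any? (λ i → φ i Fin.≟ p)
  ... | yes (i , _) = c i
  ... | no _        = cont-const {X} 0#

  -- The pieces V i overlap only where all μ i vanish.
  glue : ∀ {X : Space} {k} (μ : Fin k → Pt X → Carrier) → (∀ i → Cont X (μ i)) → (∀ i z → 0# ≤ μ i z) →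
         (sel : Pt X → Fin k) → (∀ z j → ¬ j ≡ sel z → μ j z ≈ 0#) →
         (V : Fin k → Pred (Pt X) 0ℓ) → (∀ i → Space.BallOpen X (V i)) →
         (∀ z → (∀ i → μ i z ≈ 0#) → ∀ i j → V i z → V j z) → Space.BallOpen X (λ z → V (sel z) z)
  glue {X} {k} μ cμ μ≥0 sel spec V oV agree z v with 0≤⇒≈⊎< (μ≥0 (sel z) z)
  ... | inj₂ 0<μ =
    let (δ , 0<δ , f) = oV (sel z) z v
        (η , 0<η , g) = cont-positive {X} (cμ (sel z)) z 0# 0<μ
    in δ ⊓ η , ⊓-pos 0<δ 0<η , λ y b →
       ≡.subst (λ j → V j y)
         (decidable-stable (sel z Fin.≟ sel y)
           λ ne → 0<⇒≉ (g y (Space.ball-mono X (x⊓y≤y δ η) b)) (spec y (sel z) ne))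
         (f y (Space.ball-mono X (x⊓y≤x δ η) b))
  ... | inj₁ μ≈0 =
    let (ε , 0<ε , f) = uniform-Fin k (λ j ε → ∀ y → Space.Ball X ε z y → V j y)
                          (λ j δ≤ε f y b → f y (Space.ball-mono X δ≤ε b))
                          (λ j → oV j z (agree z all≈0 (sel z) j v))
    in ε , 0<ε , λ y b → f (sel y) y b
    where
    all≈0 : ∀ j → μ j z ≈ 0#
    all≈0 j with j Fin.≟ sel z
    ... | yes ≡.refl = μ≈0
    ... | no ne      = spec z j ne

-- The cone of a decomposed complex is homotopy equivalent to a wedge of spheres.

module WedgeEquivalence (ℝ : CompleteOrderedField) {n k d : ℕ} (D : Decomposition n k d) where
  open Spheres ℝ
  open Space using (Pt)
  open Decomposition D

  cone : Space
  cone = subspaceOf (suc n) λ x → Carried nonfaces x × NonZero x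

  S : Space
  S = sphere d

  m : Fin (suc k) → Coords (suc n) → Carrier
  m i = minimumOn (facet i)

  facet-nonempty : ∀ i → Nonempty (facet i)
  facet-nonempty i = vertex i zero , ∈image⁺ (vertex i) zero

  0≤m : ∀ i {x} → NonNeg x → 0# ≤ m i x
  0≤m i = minimumOn-nonNeg (facet i) (facet-nonempty i)

  m≤ : ∀ i x j → m i x ≤ x (vertex i j)
  m≤ i x j = minimumOn≤ (facet i) x (∈image⁺ (vertex i) j)

  m-attained : ∀ i x → ∃ λ j → m i x ≈ x (vertex i j)
  m-attained i x with minimumOn-attained (facet i) x (facet-nonempty i)
  ... | p , p∈ , e with ∈image⁻ (vertex i) p∈
  ...   | j , ≡.refl = j , e

  SupportedOn : Fin (suc k) → Coords (suc n) → Set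
  SupportedOn i x = ∀ p → 0# < x p → p ∈ facet i

  OnlyFacet : Fin (suc k) → Coords (suc n) → Set
  OnlyFacet i x = ∀ j → ¬ j ≡ i → m j x ≈ 0#

  -- The support is a face containing the facet, and the facet is maximal.
  supported : ∀ i {x} → Carried nonfaces x → 0# < m i x → SupportedOn i x
  supported i {x} (_ , a) 0<m p 0<x = facet-maximal i a (minimumOn-pos⁻ (facet i) x 0<m) (∈support⁺ x 0<x)

  supported⇒only : ∀ i {x} → NonNeg x → SupportedOn i x → OnlyFacet i x
  supported⇒only i {x} x≥0 s j j≢i = [ id , (λ 0<m → ⊥-elim (j≢i (facet-unique {j} {i} λ p∈ →
    s _ (∈support⁻ x (minimumOn-pos⁻ (facet j) x 0<m p∈))))) ]′ (0≤⇒≈⊎< (0≤m j x≥0))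

  m≈0⇒core : ∀ {x} → Carried nonfaces x → (∀ i → m i x ≈ 0#) → Carried core x
  m≈0⇒core {x} (x≥0 , a) z = x≥0 , core-intro
    (λ i F⊆ → 0<⇒≉ (minimumOn-pos (facet i) x (facet-nonempty i) F⊆) (z i)) a

  core⇒carried : ∀ {x} → Carried core x → Carried nonfaces x
  core⇒carried (x≥0 , a) = x≥0 , core⇒nonfaces a

  core⇒m≈0 : ∀ {x} → Carried core x → ∀ i → m i x ≈ 0#
  core⇒m≈0 {x} (x≥0 , a) i = [ id , (λ 0<m → ⊥-elim (core⇒facet⊈ a i (minimumOn-pos⁻ (facet i) x 0<m))) ]′
    (0≤⇒≈⊎< (0≤m i x≥0))

  boundary-core : ∀ i {x} → NonNeg x → SupportedOn i x → (∃ λ j → x (vertex i j) ≈ 0#) → Carried core x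
  boundary-core i {x} x≥0 s (j , e) = m≈0⇒core (carried-by (facet i) x≥0 (facet-face i) s) z
    where
    z : ∀ l → m l x ≈ 0#
    z l with l Fin.≟ i
    ... | yes ≡.refl = ≤-antisym (≤-respʳ-≈ e (m≤ i x j)) (0≤m i x≥0)
    ... | no l≢i     = supported⇒only i x≥0 s l l≢i

  abstract
    select : Coords (suc n) → Fin (suc k)
    select x with Fin.any? (λ i → 0# <? m i x)
    ... | yes (i , _) = i
    -- If all the minima vanish, every index leads to the base point, so any default will do.
    ... | no _        = zero

    select-only : ∀ x → Carried nonfaces x → OnlyFacet (select x) x
    select-only x c with Fin.any? (λ i → 0# <? m i x)
    ... | yes (i , 0<m) = supported⇒only i (proj₁ c) (supported i c 0<m)
    ... | no none       = λ j _ → [ id , (λ 0<m → ⊥-elim (none (j , 0<m))) ]′ (0≤⇒≈⊎< (0≤m j (proj₁ c)))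

  M : Coords (suc n) → Carrier
  M = maximum

  0<M : ∀ {x} → NonZero x → 0# < M x
  0<M {x} (p , 0<x) = <-≤-trans 0<x (≤maximum x p)

  -- On the boundary of the facet `m i x` is zero, the differences are switched off by their factor,
  -- and the positive first coordinate `M x` is left: the direction of the base point. At the
  -- barycentre `M x` equals `m i x`, and the factor 2 makes the first coordinate negative, which is
  -- the opposite pole.
  Q : Fin (suc k) → Coords (suc n) → Coords (suc d)
  Q i x zero    = M x - 2# * m i x
  Q i x (suc j) = m i x * (x (vertex i (suc j)) - x (vertex i zero))

  -- A nonzero vector supported on the facet attains its maximum at a vertex of the facet.
  constant⇒M≈ : ∀ i {x c} → NonZero x → SupportedOn i x → (∀ j → x (vertex i j) ≈ c) → M x ≈ c
  constant⇒M≈ i {x} nz s e with maximum-attained x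
  ... | p , M≈ with ∈image⁻ (vertex i) (s p (<-respʳ-≈ M≈ (0<M nz)))
  ...   | j , ≡.refl = trans M≈ (e j)

  abstract
    -- If the minimum is zero, the first coordinate is the positive maximum. Otherwise vanishing
    -- differences make `x` constant on the facet, so the maximum equals `m i x` and the first
    -- coordinate is its negative.
    Q-pos : ∀ i {x} → Carried nonfaces x → NonZero x → 0# < squares (Q i x)
    Q-pos i {x} c nz = squares-pos (Q i x) λ z → contradiction z (0≤⇒≈⊎< (0≤m i (proj₁ c)))
      where
      contradiction : (∀ j → Q i x j ≈ 0#) → m i x ≈ 0# ⊎ 0# < m i x → ⊥
      contradiction z (inj₁ m≈0) = 0<⇒≉ (0<M nz) (trans (sym (trans (+-congˡ (-‿cong (≈0⇒*≈0ʳ m≈0)))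
        (solve 1 (λ a → a :- con (+ 0) := a) refl (M x)))) (z zero))
      contradiction z (inj₂ 0<m) = 0<⇒≉ 0<m (trans (sym (solve 2 (λ a b → a :- (a :- con (+ 2) :* b) :- b := b) refl (M x) (m i x)))
        (trans (+-congʳ (+-cong (constant⇒M≈ i nz (supported i c 0<m) all≈m) (-‿cong (z zero))))
          (solve 1 (λ b → b :- con (+ 0) :- b := con (+ 0)) refl (m i x))))
        where
        all≈x₀ : ∀ j → x (vertex i j) ≈ x (vertex i zero)
        all≈x₀ zero    = refl
        all≈x₀ (suc j) = sym (-≈0⇒≈ (*-zero-divisor (z (suc j)) 0<m))
        all≈m : ∀ j → x (vertex i j) ≈ m i x
        all≈m j = let (j′ , e) = m-attained i x in trans (all≈x₀ j) (trans (sym (all≈x₀ j′)) (sym e))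

  Q̂ : Fin (suc k) → Pt cone → Pt (punctured d)
  Q̂ i (x , c , nz) = Q i x , Q-pos i c nz

  toSphere : Fin (suc k) → Pt cone → Pt S
  toSphere i = unit ∘ Q̂ i

  m≈0⇒Q₀ : ∀ i {x} → m i x ≈ 0# → Q i x zero ≈ M x
  m≈0⇒Q₀ i {x} e = trans (+-congˡ (-‿cong (≈0⇒*≈0ʳ e))) (solve 1 (λ a → a :- con (+ 0) := a) refl (M x))

  m≈0⇒Qⱼ : ∀ i {x} → m i x ≈ 0# → ∀ j → Q i x (suc j) ≈ 0#
  m≈0⇒Qⱼ i e j = ≈0⇒*≈0ˡ e

  toSphere-base : ∀ i (x : Pt cone) → m i (proj₁ x) ≈ 0# → Space._∼_ S (toSphere i x) (basePoint d)
  toSphere-base i (x , c , nz) m≈0 = ≈basePoint (toSphere i (x , c , nz))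
    (*-pos (proj₁ (proj₂ (scale (Q i x) (Q-pos i c nz)))) (<-respʳ-≈ (sym (m≈0⇒Q₀ i m≈0)) (0<M nz)))
    (λ j → ≈0⇒*≈0ʳ (m≈0⇒Qⱼ i m≈0 j))

  module _ {X : Space} {φ : Pt X → Coords (suc n)} (cφ : ∀ p → Cont X (λ z → φ z p)) where
    cont-m : ∀ i → Cont X (λ z → m i (φ z))
    cont-m i = cont-minimumOn {X} (facet i) cφ

    cont-Q : ∀ i j → Cont X (λ z → Q i (φ z) j)
    cont-Q i zero    = cont-sub {X} (cont-maximum {X} cφ) (cont-* {X} (cont-const {X} 2#) (cont-m i))
    cont-Q i (suc j) = cont-* {X} (cont-m i) (cont-sub {X} (cφ _) (cφ _))

  cont-toSphere : ∀ {X : Space} (ψ : Pt X → Pt cone) → (∀ p → Cont X (λ z → proj₁ (ψ z) p)) →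
                  ∀ i j → Cont X (λ z → proj₁ (toSphere i (ψ z)) j)
  cont-toSphere {X} ψ cψ i = cont-unit {X} (λ z → Q̂ i (ψ z)) (cont-Q {X} {λ z → proj₁ (ψ z)} cψ i)

  toSphereMap : Fin (suc k) → Space.space cone ⇒ Space.space S
  toSphereMap i = continuousMap cone S (toSphere i) (cont-toSphere {cone} id (λ p → cont-coord {cone} p) i)

  wedge : TopologicalSpace
  wedge = ⋁ (suc k) (𝕊 d) (basePoint d)

  module W = TopologicalSpace wedge

  abstract
    collapse : Pt cone → W.Carrier
    collapse x = select (proj₁ x) , toSphere (select (proj₁ x)) x

    -- If `select` returns an index other than `i`, the minima of both facets vanish, and both
    -- images are the base point.
    collapse-at : ∀ i (x : Pt cone) → OnlyFacet i (proj₁ x) → collapse x W.≈ (i , toSphere i x)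
    collapse-at i x only = [ (λ { ≡.refl → W.refl {collapse x} }) , differ ]′ (Dec.toSum (select (proj₁ x) Fin.≟ i))
      where
      differ : ¬ select (proj₁ x) ≡ i → collapse x W.≈ (i , toSphere i x)
      differ s≢i = inj₂ (toSphere-base (select (proj₁ x)) x (only _ s≢i) ,
                         toSphere-base i x (select-only (proj₁ x) (proj₁ (proj₂ x)) i (s≢i ∘ ≡.sym)))

    collapse-cong : ∀ x y → Space._∼_ cone x y → collapse x W.≈ collapse y
    collapse-cong x y x≈y = W.trans {collapse x} {select (proj₁ x) , toSphere (select (proj₁ x)) y} {collapse y}
      (inj₁ (≡.refl , _⇒_.cong (toSphereMap (select (proj₁ x))) {x} {y} x≈y))
      (W.sym {collapse y} {select (proj₁ x) , toSphere (select (proj₁ x)) y} (collapse-at (select (proj₁ x)) y λ j ne →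
        trans (minimumOn-cong (facet j) (λ p → sym (x≈y p))) (select-only (proj₁ x) (proj₁ (proj₂ x)) j ne)))

    collapse-open : ∀ V → W.Open V → Space.Open cone (V ∘ collapse)
    collapse-open V (resp , oV) = Space.ball⇒open cone (glue {cone} (λ i x → m i (proj₁ x))
      (cont-m {cone} {proj₁} (λ p → cont-coord {cone} p)) (λ i x → 0≤m i (proj₁ (proj₁ (proj₂ x))))
      (select ∘ proj₁) (λ x → select-only (proj₁ x) (proj₁ (proj₂ x)))
      (λ i x → V (i , toSphere i x))
      (λ i → Space.open⇒ball cone (_⇒_.continuous (toSphereMap i) _ (oV i)))
      (λ x z i j → resp (inj₂ (toSphere-base i x (z i) , toSphere-base j x (z j)))))

  collapseMap : Space.space cone ⇒ wedge
  collapseMap = record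
    { func = record { to = collapse ; cong = λ {x} {y} → collapse-cong x y }
    ; continuous = collapse-open
    }

  -- The first coordinate cuts the sphere into three zones. Below 0 the facet is parametrised, with
  -- `depth` as minimum of the lifted vector. From 0 to ½ its boundary runs through all the
  -- collapses, whence the factor 2 in `time`. Above ½ the apex receives the weight `excess`, which
  -- keeps the vector nonzero at the base point, where the lift vanishes.
  time depth excess : Pt S → Carrier
  time w   = 2# * duration collapses * (0# ⊔ proj₁ w zero)
  depth w  = 0# ⊔ - proj₁ w zero
  excess w = 0# ⊔ (proj₁ w zero - ½)

  0≤depth : ∀ w → 0# ≤ depth w
  0≤depth w = x≤x⊔y _ _

  0≤excess : ∀ w → 0# ≤ excess w
  0≤excess w = x≤x⊔y _ _

  time≈0 : ∀ w → proj₁ w zero ≤ 0# → time w ≈ 0#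
  time≈0 w p = ≈0⇒*≈0ʳ (x≥y⇒x⊔y≈x p)

  depth≈ : ∀ w → proj₁ w zero ≤ 0# → depth w ≈ - proj₁ w zero
  depth≈ w p = x≤y⇒x⊔y≈y (≤-respˡ-≈ -0≈0 (neg-mono-≤ p))

  depth≈0 : ∀ w → 0# ≤ proj₁ w zero → depth w ≈ 0#
  depth≈0 w p = x≥y⇒x⊔y≈x (≤-respʳ-≈ -0≈0 (neg-mono-≤ p))

  excess≈0 : ∀ w → proj₁ w zero ≤ ½ → excess w ≈ 0#
  excess≈0 w p = x≥y⇒x⊔y≈x (le (gap≤ p) (solve 2 (λ h w → h :- w := con (+ 0) :- (w :- h)) refl ½ (proj₁ w zero)))

  0<excess : ∀ w → ½ < proj₁ w zero → 0# < excess w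
  0<excess w p = <-≤-trans (gap< p) (x≤y⊔x _ _)

  duration≤time : ∀ w → ½ < proj₁ w zero → duration collapses ≤ time w
  duration≤time w p = ≤-trans (≤-reflexive (trans (sym (*-identityʳ _)) (trans (*-congˡ (sym 2*½≈1))
      (solve 2 (λ a h → a :* (con (+ 2) :* h) := con (+ 2) :* a :* h) refl (duration collapses) ½))))
    (*-monoʳ-≤ (*-nonNeg (<⇒≤ 0<2#) (0≤duration collapses)) (≤-trans (<⇒≤ p) (x≤y⊔x _ _)))

  -- Vertex `zero` has height 0 because the coordinates of `Q` are differences from that vertex.
  heights : Pt S → Coords (suc d)
  heights w zero    = 0#
  heights w (suc j) = proj₁ w (suc j)

  lowest : Pt S → Carrier
  lowest w = minimumOn Subset.⊤ (heights w)

  lowest≤ : ∀ w j → lowest w ≤ heights w j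
  lowest≤ w j = minimumOn≤ Subset.⊤ (heights w) {j} ∈⊤

  lowest-attained : ∀ w → ∃ λ j → lowest w ≈ heights w j
  lowest-attained w = let (j , _ , e) = minimumOn-attained Subset.⊤ (heights w) (zero , ∈⊤) in j , e

  -- A point of the facet whose coordinates differ by the last coordinates of w.
  lift-coord : Pt S → Coords (suc d)
  lift-coord w j = (heights w j - lowest w) + depth w

  lift-facet : Fin (suc k) → Pt S → Coords (suc n)
  lift-facet i w = place (vertex i) (lift-coord w)

  depth≤lift : ∀ w j → depth w ≤ lift-coord w j
  depth≤lift w j = le (gap≤ (lowest≤ w j)) (solve 3 (λ h l e → h :- l := ((h :- l) :+ e) :- e) refl _ _ _)

  lift-at : ∀ i w j → lift-facet i w (vertex i j) ≈ lift-coord w j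
  lift-at i w = place-in (vertex i) (lift-coord w) (injective i)

  lift-nonNeg : ∀ i w → NonNeg (lift-facet i w)
  lift-nonNeg i w = place-nonNeg (vertex i) λ j → ≤-trans (0≤depth w) (depth≤lift w j)

  lift-supported : ∀ i w → SupportedOn i (lift-facet i w)
  lift-supported i w p 0<x = decidable-stable (p ∈? facet i) λ p∉ → 0<⇒≉ 0<x (place-out (vertex i) _ p∉)

  m-lift : ∀ i w → m i (lift-facet i w) ≈ depth w
  m-lift i w = let (j , e) = lowest-attained w ; (j′ , e′) = m-attained i (lift-facet i w) in ≤-antisym
    (≤-trans (m≤ i (lift-facet i w) j) (≤-reflexive (trans (lift-at i w j) (lift-lowest w j e))))
    (≤-respʳ-≈ (sym (trans e′ (lift-at i w j′))) (depth≤lift w j′))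
    where
    lift-lowest : ∀ w j → lowest w ≈ heights w j → lift-coord w j ≈ depth w
    lift-lowest w j e = trans (+-congʳ (trans (+-congˡ (-‿cong e)) (-‿inverseʳ _))) (+-identityˡ _)

  lift-boundary : ∀ i w → 0# ≤ proj₁ w zero → Carried core (lift-facet i w)
  lift-boundary i w p = let (j , e) = m-attained i (lift-facet i w) in
    boundary-core i (lift-nonNeg i w) (lift-supported i w)
      (j , trans (sym e) (trans (m-lift i w) (depth≈0 w p)))

  axis-small : ∀ (w : Pt S) → proj₁ w zero ≤ ½ → (∀ j → proj₁ w (suc j) ≈ 0#) → proj₁ w zero < 0#
  axis-small w w₀≤½ z with <-≤-total (proj₁ w zero) 0#
  ... | inj₁ p = p
  ... | inj₂ p = ⊥-elim (≤⇒≯ (≤-respˡ-≈ w₀≈1 w₀≤½) ½<1)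
    where
    ½<1 : ½ < 1#
    ½<1 = lt 0<½ (trans (solve 1 (λ h → h := con (+ 2) :* h :- h) refl ½) (+-congʳ 2*½≈1))
    w₀≈1 : proj₁ w zero ≈ 1#
    w₀≈1 with 0≤⇒≈⊎< p
    ... | inj₂ 0<w₀ = x*x≈1⇒x≈1 0<w₀ (on-axis w z)
    ... | inj₁ w₀≈0 = ⊥-elim (0<⇒≉ 0<1 (trans (sym (on-axis w z)) (≈0⇒*≈0ˡ w₀≈0)))

  -- If the lift vanished, all heights would agree with the height 0 of the first vertex, so `w`
  -- would lie on the axis. The bound ½ excludes the base point, and at the other pole `depth` is
  -- positive.
  lift-nonZero : ∀ i w → proj₁ w zero ≤ ½ → NonZero (lift-facet i w)
  lift-nonZero i w w₀≤½ with Fin.any? (λ j → 0# <? lift-coord w j)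
  ... | yes (j , 0<x) = vertex i j , <-respʳ-≈ (sym (lift-at i w j)) 0<x
  ... | no none = ⊥-elim (≤⇒≯ (lift≤0 zero) (<-≤-trans 0<depth (depth≤lift w zero)))
    where
    lift≤0 : ∀ j → lift-coord w j ≤ 0#
    lift≤0 j = ≮⇒≥ λ p → none (j , p)
    h≈l : ∀ j → heights w j ≈ lowest w
    h≈l j = ≤-antisym (le (gap≤ (≤-trans (le (0≤depth w) (solve 3 (λ h l e → e := ((h :- l) :+ e) :- (h :- l)) refl _ _ _)) (lift≤0 j)))
                         (solve 2 (λ h l → con (+ 0) :- (h :- l) := l :- h) refl _ _))
                      (lowest≤ w j)
    0<depth : 0# < depth w
    0<depth = <-≤-trans (neg-pos (axis-small w w₀≤½ λ j → trans (h≈l (suc j)) (sym (h≈l zero)))) (x≤y⊔x _ _)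

  at-apex : Fin (suc n) → Carrier
  at-apex p with p Fin.≟ apex
  ... | yes _ = 1#
  ... | no _  = 0#

  at-apex-nonNeg : ∀ p → 0# ≤ at-apex p
  at-apex-nonNeg p with p Fin.≟ apex
  ... | yes _ = <⇒≤ 0<1
  ... | no _  = ≤-refl

  at-apex-self : at-apex apex ≈ 1#
  at-apex-self with apex Fin.≟ apex
  ... | yes _ = refl
  ... | no ne = ⊥-elim (ne ≡.refl)

  at-apex-other : ∀ p → ¬ p ∈ ⁅ apex ⁆ → at-apex p ≈ 0#
  at-apex-other p p∉ with p Fin.≟ apex
  ... | yes ≡.refl = ⊥-elim (p∉ (x∈⁅x⁆ apex))
  ... | no _       = refl

  contract : Carrier → Carrier → Coords (suc n) → Coords (suc n)
  contract A e y p = run collapses A y p + e * at-apex p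

  contract-cong : ∀ {A B e f x y} → A ≈ B → e ≈ f → (∀ p → x p ≈ y p) → ∀ p → contract A e x p ≈ contract B f y p
  contract-cong a b c p = +-cong (run-cong collapses a c p) (*-congʳ b)

  contract-e≈0 : ∀ {A e y} → e ≈ 0# → ∀ p → run collapses A y p ≈ contract A e y p
  contract-e≈0 e≈0 p = sym (trans (+-congˡ (≈0⇒*≈0ˡ e≈0)) (+-identityʳ _))

  contract-still : ∀ {A e y} → A ≈ 0# → e ≈ 0# → ∀ p → y p ≈ contract A e y p
  contract-still A≈0 e≈0 p = trans (sym (run-≤0 collapses _ (≤-reflexive A≈0) p)) (contract-e≈0 e≈0 p)

  run-nonZero′ : ∀ {A y} → Carried core y → NonZero y → NonZero (run collapses A y)
  run-nonZero′ c = run-nonZero collapses valid (proj₁ c)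

  contract-core : ∀ {A e y} → e ≈ 0# → Carried core y → Carried core (contract A e y)
  contract-core e≈0 c = carried-≈ (contract-e≈0 e≈0) (run-carried collapses valid c)

  -- Once all collapses have run, the support contains at most the apex, so extra weight there does
  -- not enlarge the carrier beyond a vertex of the core.
  contract-apex : ∀ {A e y} → duration collapses ≤ A → 0# ≤ e → Carried core y → Carried core (contract A e y)
  contract-apex {A} {e} {y} D≤A 0≤e c = carried-by ⁅ apex ⁆
    (λ p → +-nonNeg (proj₁ r p) (*-nonNeg 0≤e (at-apex-nonNeg p))) apex-core
    λ p 0<z → decidable-stable (p ∈? ⁅ apex ⁆) λ p∉ →
      p∉ (collapsed (proj₂ r) (∈support⁺ (run collapses A y)
        (<-respʳ-≈ (trans (+-congˡ (≈0⇒*≈0ʳ (at-apex-other p p∉))) (+-identityʳ _)) 0<z)))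
    where
    r : Carried (remaining core collapses) (run collapses A y)
    r = run-collapsed collapses valid D≤A c

  contract-nonZero : ∀ {A e y} → 0# ≤ e → Carried core y → NonZero y → NonZero (contract A e y)
  contract-nonZero 0≤e c nz = let (p , 0<r) = run-nonZero′ c nz in
    p , +-pos-nonNeg 0<r (*-nonNeg 0≤e (at-apex-nonNeg p))

  contract-nonZero-apex : ∀ {A e y} → 0# < e → Carried core y → NonZero (contract A e y)
  contract-nonZero-apex {A} {e} {y} 0<e c =
    apex , +-nonNeg-pos (proj₁ (run-carried collapses {A} valid c) apex)
             (<-respʳ-≈ (sym (≈1⇒*≈ˡ at-apex-self)) 0<e)

  abstract
    expand : Fin (suc k) → Pt S → Coords (suc n)
    expand i w = contract (time w) (excess w) (lift-facet i w)

    -- `expand` is opaque outside this block; its definition is available only through this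
    -- equation.
    expand≈ : ∀ i w p → contract (time w) (excess w) (lift-facet i w) p ≈ expand i w p
    expand≈ i w p = refl

  expand-≤0 : ∀ i w → proj₁ w zero ≤ 0# → ∀ p → lift-facet i w p ≈ expand i w p
  expand-≤0 i w w₀≤0 p = trans (contract-still (time≈0 w w₀≤0) (excess≈0 w (≤-trans w₀≤0 (<⇒≤ 0<½))) p) (expand≈ i w p)

  expand-core : ∀ i w → 0# ≤ proj₁ w zero → Carried core (expand i w)
  expand-core i w 0≤w₀ = carried-≈ (expand≈ i w)
    ([ (λ ½<w₀ → contract-apex (duration≤time w ½<w₀) (0≤excess w) (lift-boundary i w 0≤w₀))
     , (λ w₀≤½ → contract-core (excess≈0 w w₀≤½) (lift-boundary i w 0≤w₀)) ]′ (<-≤-total ½ (proj₁ w zero)))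

  lift-carried : ∀ i w → Carried nonfaces (lift-facet i w)
  lift-carried i w = carried-by (facet i) (lift-nonNeg i w) (facet-face i) (lift-supported i w)

  abstract
    expand-carried : ∀ i w → Carried nonfaces (expand i w)
    expand-carried i w with total (proj₁ w zero) 0#
    ... | inj₁ w₀≤0 = carried-≈ (expand-≤0 i w w₀≤0) (lift-carried i w)
    ... | inj₂ 0≤w₀ = core⇒carried (expand-core i w 0≤w₀)

  abstract
    expand-nonZero : ∀ i w → NonZero (expand i w)
    expand-nonZero i w = [ negative , (λ 0≤w₀ → nonzero-≈ (expand≈ i w) (nonNegative 0≤w₀ (<-≤-total ½ (proj₁ w zero)))) ]′
                         (<-≤-total (proj₁ w zero) 0#)
      where
      negative : proj₁ w zero < 0# → NonZero (expand i w)
      negative w₀<0 = nonzero-≈ (expand-≤0 i w (<⇒≤ w₀<0)) (lift-nonZero i w (≤-trans (<⇒≤ w₀<0) (<⇒≤ 0<½)))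
      nonNegative : 0# ≤ proj₁ w zero → ½ < proj₁ w zero ⊎ proj₁ w zero ≤ ½ →
                    NonZero (contract (time w) (excess w) (lift-facet i w))
      nonNegative 0≤w₀ (inj₁ ½<w₀) = contract-nonZero-apex (0<excess w ½<w₀) (lift-boundary i w 0≤w₀)
      nonNegative 0≤w₀ (inj₂ w₀≤½) = contract-nonZero (0≤excess w) (lift-boundary i w 0≤w₀) (lift-nonZero i w w₀≤½)

  expandPt : Fin (suc k) → Pt S → Pt cone
  expandPt i w = expand i w , expand-carried i w , expand-nonZero i w

  module _ {X : Space} {ψ : Pt X → Pt S} (cψ : ∀ j → Cont X (λ z → proj₁ (ψ z) j)) where
    cont-time : Cont X (time ∘ ψ)
    cont-time = cont-* {X} (cont-const {X} _) (cont-⊔ {X} (cont-const {X} 0#) (cψ zero))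

    cont-excess : Cont X (excess ∘ ψ)
    cont-excess = cont-⊔ {X} (cont-const {X} 0#) (cont-sub {X} (cψ zero) (cont-const {X} ½))

    cont-heights : ∀ j → Cont X (λ z → heights (ψ z) j)
    cont-heights zero    = cont-const {X} 0#
    cont-heights (suc j) = cψ (suc j)

    cont-lift : ∀ i p → Cont X (λ z → lift-facet i (ψ z) p)
    cont-lift i = cont-place {X = X} (vertex i) λ j → cont-+ {X}
      (cont-sub {X} (cont-heights j) (cont-minimumOn {X} Subset.⊤ cont-heights))
      (cont-⊔ {X} (cont-const {X} 0#) (cont-neg {X} (cψ zero)))

  module _ {X : Space} where
    cont-contract : ∀ {A e : Pt X → Carrier} {φ : Pt X → Coords (suc n)} → Cont X A → Cont X e →
                    (∀ p → Cont X (λ z → φ z p)) → ∀ p → Cont X (λ z → contract (A z) (e z) (φ z) p)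
    cont-contract cA ce cφ p = cont-+ {X} (cont-run {X} collapses cA cφ p) (cont-* {X} ce (cont-const {X} _))

  cont-expand : ∀ {X : Space} {ψ : Pt X → Pt S} → (∀ j → Cont X (λ z → proj₁ (ψ z) j)) →
                ∀ i p → Cont X (λ z → expand i (ψ z) p)
  cont-expand {X} {ψ} cψ i p = cont-≈ {X} (λ z → expand≈ i (ψ z) p)
    (cont-contract {X} (cont-time {X} {ψ} cψ) (cont-excess {X} {ψ} cψ) (cont-lift {X} {ψ} cψ i) p)

  expandMap′ : Fin (suc k) → Space.space S ⇒ Space.space cone
  expandMap′ i = continuousMap S cone (expandPt i) (cont-expand {S} {id} (λ j → cont-coord {S} j) i)

  lift-base : ∀ i (w : Pt S) → Space._∼_ S w (basePoint d) → ∀ p → lift-facet i w p ≈ 0#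
  lift-base i w e p with p ∈? facet i
  ... | no p∉ = place-out (vertex i) _ p∉
  ... | yes p∈ with ∈image⁻ (vertex i) p∈
  ...   | j , ≡.refl = trans (lift-at i w j) (trans (+-cong (+-cong (h≈0 j) (-‿cong (trans l≈h (h≈0 (proj₁ (lowest-attained w)))))) d≈0)
                         (solve 0 ((con (+ 0) :- con (+ 0)) :+ con (+ 0) := con (+ 0)) refl))
    where
    l≈h = proj₂ (lowest-attained w)
    h≈0 : ∀ j → heights w j ≈ 0#
    h≈0 zero    = refl
    h≈0 (suc j) = e (suc j)
    d≈0 : depth w ≈ 0#
    d≈0 = depth≈0 w (<⇒≤ (<-respʳ-≈ (sym (e zero)) 0<1))

  time-cong : ∀ w w′ → proj₁ w zero ≈ proj₁ w′ zero → time w ≈ time w′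
  time-cong w w′ e = *-congˡ (⊔-cong refl e)

  excess-cong : ∀ w w′ → proj₁ w zero ≈ proj₁ w′ zero → excess w ≈ excess w′
  excess-cong w w′ e = ⊔-cong refl (+-congʳ e)

  -- At base points of different spheres both lifts are the zero vector, and neither the time nor
  -- the excess depends on the index.
  expand-cong : ∀ {u v} → u W.≈ v → ∀ p → expand (proj₁ u) (proj₂ u) p ≈ expand (proj₁ v) (proj₂ v) p
  expand-cong {i , w} {j , w′} (inj₁ (≡.refl , e)) = _⇒_.cong (expandMap′ i) {w} {w′} e
  expand-cong {i , w} {j , w′} (inj₂ (e , e′)) p = trans (sym (expand≈ i w p)) (trans (contract-cong
    (time-cong w w′ (trans (e zero) (sym (e′ zero)))) (excess-cong w w′ (trans (e zero) (sym (e′ zero))))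
    (λ q → trans (lift-base i w e q) (sym (lift-base j w′ e′ q))) p) (expand≈ j w′ p))

  expandMap : wedge ⇒ Space.space cone
  expandMap = record
    { func = record { to = λ (i , w) → expandPt i w ; cong = λ {u} {v} → expand-cong {u} {v} }
    ; continuous = λ V oV → (λ {u} {v} e → Space.resp-≈ cone oV (expand-cong {u} {v} e)) ,
                            λ i → _⇒_.continuous (expandMap′ i) V oV
    }

  convex-pos : ∀ {t x y} → 0# ≤ t → t ≤ 1# → 0# < x → 0# < y → 0# < (1# - t) * x + t * y
  convex-pos {t} {x} {y} 0≤t t≤1 0<x 0<y with 0≤⇒≈⊎< 0≤t
  ... | inj₂ 0<t = +-nonNeg-pos (*-nonNeg (gap≤ t≤1) (<⇒≤ 0<x)) (*-pos 0<t 0<y)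
  ... | inj₁ t≈0 = +-pos-nonNeg (<-respʳ-≈ (sym (≈1⇒*≈ʳ (1-≈1 t≈0))) 0<x) (*-nonNeg 0≤t (<⇒≤ 0<y))

  squares-cong : ∀ {q q′ : Coords (suc d)} → (∀ j → q j ≈ q′ j) → squares q ≈ squares q′
  squares-cong e = sum-cong-≋ λ j → *-cong (e j) (e j)

  blend : Fin (suc k) → Pt S → Carrier → Coords (suc d)
  blend i w t j = (1# - t) * Q i (expand i w) j + t * proj₁ w j

  expand-only : ∀ i w → OnlyFacet i (expand i w)
  expand-only i w with total (proj₁ w zero) 0#
  ... | inj₁ w₀≤0 = supported⇒only i (proj₁ (expand-carried i w))
                      λ p 0<x → lift-supported i w p (<-respʳ-≈ (sym (expand-≤0 i w w₀≤0 p)) 0<x)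
  ... | inj₂ 0≤w₀ = λ j _ → core⇒m≈0 (expand-core i w 0≤w₀) j

  blend₀-pos : ∀ i w {t} → 0# ≤ t → t ≤ 1# → 0# < proj₁ w zero → 0# < blend i w t zero
  blend₀-pos i w 0≤t t≤1 0<w₀ = convex-pos 0≤t t≤1
    (<-respʳ-≈ (sym (m≈0⇒Q₀ i (core⇒m≈0 (expand-core i w (<⇒≤ 0<w₀)) i))) (0<M (expand-nonZero i w))) 0<w₀

  -- For positive first coordinate of `w`, `expand` lands in the core, and both ends of the segment
  -- have positive first coordinate. Otherwise the later coordinates of `Q` are those of `w` times
  -- the depth `ν`. If they cancel, either `w` has only its first coordinate left and both ends
  -- start with `- ν`, or `t` and `ν` are zero and the positive maximum remains.
  blend-pos : ∀ i w {t} → 0# ≤ t → t ≤ 1# → 0# < squares (blend i w t)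
  blend-pos i w {t} 0≤t t≤1 = squares-pos (blend i w t) λ z → contradiction z (<-≤-total 0# (proj₁ w zero))
    where
    contradiction : (∀ j → blend i w t j ≈ 0#) → 0# < proj₁ w zero ⊎ proj₁ w zero ≤ 0# → ⊥
    contradiction z (inj₁ 0<w₀) = 0<⇒≉ (blend₀-pos i w 0≤t t≤1 0<w₀) (z zero)
    contradiction z (inj₂ w₀≤0) = split (0≤⇒≈⊎< 0≤r)
      where
      x = expand i w
      ν = depth w
      0≤1-t = gap≤ t≤1
      r = (1# - t) * ν + t
      0≤r : 0# ≤ r
      0≤r = +-nonNeg (*-nonNeg 0≤1-t (0≤depth w)) 0≤t
      m≈ν : m i x ≈ ν
      m≈ν = trans (minimumOn-cong (facet i) λ p → sym (expand-≤0 i w w₀≤0 p)) (m-lift i w)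
      x≈ : ∀ j → x (vertex i j) ≈ lift-coord w j
      x≈ j = trans (sym (expand-≤0 i w w₀≤0 _)) (lift-at i w j)
      blendⱼ : ∀ j → blend i w t (suc j) ≈ r * proj₁ w (suc j)
      blendⱼ j = trans (+-congʳ (*-congˡ (*-cong m≈ν (+-cong (x≈ (suc j)) (-‿cong (x≈ zero))))))
        (solve 4 (λ t v wj l → (con (+ 1) :- t) :* (v :* (((wj :- l) :+ v) :- ((con (+ 0) :- l) :+ v))) :+ t :* wj
                              := ((con (+ 1) :- t) :* v :+ t) :* wj) refl t ν (proj₁ w (suc j)) (lowest w))
      split : r ≈ 0# ⊎ 0# < r → ⊥
      split (inj₂ 0<r) = 0<⇒≉ (0<M (expand-nonZero i w)) (trans M≈ν ν≈0)
        where
        wⱼ≈0 : ∀ j → heights w j ≈ 0#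
        wⱼ≈0 zero    = refl
        wⱼ≈0 (suc j) = *-zero-divisor (trans (sym (blendⱼ j)) (z (suc j))) 0<r
        l≈0 : lowest w ≈ 0#
        l≈0 = let (j , e) = lowest-attained w in trans e (wⱼ≈0 j)
        M≈ν : M x ≈ ν
        M≈ν = constant⇒M≈ i (expand-nonZero i w)
          (λ p 0<x → lift-supported i w p (<-respʳ-≈ (sym (expand-≤0 i w w₀≤0 p)) 0<x))
          λ j → trans (x≈ j) (trans (+-congʳ (+-cong (wⱼ≈0 j) (-‿cong l≈0)))
                  (solve 1 (λ v → (con (+ 0) :- con (+ 0)) :+ v := v) refl ν))
        w₀≈-ν : proj₁ w zero ≈ - ν
        w₀≈-ν = trans (solve 1 (λ a → a := :- :- a) refl (proj₁ w zero)) (-‿cong (sym (depth≈ w w₀≤0)))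
        ν≈0 : ν ≈ 0#
        ν≈0 = trans (solve 2 (λ t v → v := :- ((con (+ 1) :- t) :* (v :- con (+ 2) :* v) :+ t :* :- v)) refl t ν)
          (trans (-‿cong (trans (sym (+-cong (*-congˡ (+-cong M≈ν (-‿cong (*-congˡ m≈ν)))) (*-congˡ w₀≈-ν))) (z zero))) -0≈0)
      split (inj₁ r≈0) = 0<⇒≉ (0<M (expand-nonZero i w))
        (trans (sym (trans (+-cong (≈1⇒*≈ʳ (1-≈1 t≈0)) (≈0⇒*≈0ˡ t≈0))
                 (trans (+-identityʳ _) (m≈0⇒Q₀ i (trans m≈ν ν≈0))))) (z zero))
        where
        t≈0 : t ≈ 0#
        t≈0 = [ id , (λ 0<t → ⊥-elim (0<⇒≉ (+-nonNeg-pos (*-nonNeg 0≤1-t (0≤depth w)) 0<t) r≈0)) ]′ (0≤⇒≈⊎< 0≤t)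
        ν≈0 : ν ≈ 0#
        ν≈0 = trans (sym (trans (+-cong (≈1⇒*≈ʳ (1-≈1 t≈0)) t≈0) (+-identityʳ ν))) r≈0

  S×I : Space
  S×I = S ×ₛ interval

  blendPt : Fin (suc k) → Pt S×I → Pt (punctured d)
  blendPt i (w , t , 0≤t , t≤1) = blend i w (t zero) , blend-pos i w 0≤t t≤1

  moved : Fin (suc k) → Pt S×I → Pt S
  moved i p = unit (blendPt i p)

  cont-w : ∀ j → Cont S×I (λ z → proj₁ (proj₁ z) j)
  cont-w j = cont-coord {S×I} (inj₁ j)

  cont-blend : ∀ i j → Cont S×I (λ z → proj₁ (blendPt i z) j)
  cont-blend i j = cont-+ {S×I}
    (cont-* {S×I} (cont-sub {S×I} (cont-const {S×I} 1#) (cont-coord {S×I} (inj₂ zero)))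
      (cont-Q {S×I} {λ z → expand i (proj₁ z)} (cont-expand {S×I} {proj₁} cont-w i) i j))
    (cont-* {S×I} (cont-coord {S×I} (inj₂ zero)) (cont-w j))

  movedMap : Fin (suc k) → Space.space S×I ⇒ Space.space S
  movedMap i = continuousMap S×I S (moved i) (cont-unit {S×I} (blendPt i) (cont-blend i))

  moved-base : ∀ i w t → Space._∼_ S w (basePoint d) → Space._∼_ S (moved i (w , t)) (basePoint d)
  moved-base i w (t , 0≤t , t≤1) e = ≈basePoint (moved i (w , t , 0≤t , t≤1))
    (*-pos 0<κ (blend₀-pos i w 0≤t t≤1 0<w₀))
    λ j → ≈0⇒*≈0ʳ (trans (+-cong
        (≈0⇒*≈0ʳ (m≈0⇒Qⱼ i (core⇒m≈0 (expand-core i w (<⇒≤ 0<w₀)) i) j))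
        (≈0⇒*≈0ʳ (e (suc j)))) (+-identityʳ 0#))
    where
    0<κ = proj₁ (proj₂ (scale (blend i w (t zero)) (blend-pos i w 0≤t t≤1)))
    0<w₀ : 0# < proj₁ w zero
    0<w₀ = <-respʳ-≈ (sym (e zero)) 0<1

  nonbase-open : ∀ (w : Pt S) → ¬ Space._∼_ S w (basePoint d) →
                 ∃ λ ε → 0# < ε × ∀ y → Space.Ball S ε w y → ¬ Space._∼_ S y (basePoint d)
  nonbase-open w w≁ with Fin.any? (λ j → Dec.¬? (DecEq (proj₁ w j) (proj₁ (basePoint d) j)))
    where DecEq = StrictTotalOrder._≟_ strictTotalOrder
  ... | no none = ⊥-elim (w≁ λ j → decidable-stable (StrictTotalOrder._≟_ strictTotalOrder _ _) λ ne → none (j , ne))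
  ... | yes (j , ne) = let (δ , 0<δ , f) = cont-positive {S} cφ w 0# (x*x-pos _ λ e → ne (sym (-≈0⇒≈ e))) in
    δ , 0<δ , λ y b y∼ → 0<⇒≉ (f y b) (≈0⇒*≈0ˡ (trans (+-congʳ (y∼ j)) (-‿inverseʳ _)))
    where
    φ : Pt S → Carrier
    φ y = (proj₁ y j - proj₁ (basePoint d) j) * (proj₁ y j - proj₁ (basePoint d) j)
    cφ : Cont S φ
    cφ = cont-* {S} c c where c = cont-sub {S} (cont-coord {S} j) (cont-const {S} _)

  decBase : (w : Pt S) → Dec (Space._∼_ S w (basePoint d))
  decBase w = Fin.all? λ j → StrictTotalOrder._≟_ strictTotalOrder (proj₁ w j) (proj₁ (basePoint d) j)

  movedTo : W.Carrier × Pt interval → W.Carrier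
  movedTo ((i , w) , t) = i , moved i (w , t)

  -- The wedge carries a quotient topology, so product neighbourhoods are exhibited by hand. Away
  -- from the base point a ball in one sphere, without the base point, suffices. At the base point,
  -- which stays fixed throughout, one radius serves all the finitely many spheres.
  wedgeHomotopy : wedge ×ₜ unitInterval ⇒ wedge
  wedgeHomotopy = record
    { func = record
      { to = movedTo
      ; cong = λ { {(i , w) , s} {(j , w′) , t} (inj₁ (≡.refl , e) , e′) →
                     inj₁ (≡.refl , _⇒_.cong (movedMap i) {w , s} {w′ , t} (e , e′))
                 ; {(i , w) , s} {(j , w′) , t} (inj₂ (e , e′) , _) → inj₂ (moved-base i w s e , moved-base j w′ t e′) }
      }
    ; continuous = λ V oV p v → nbhd V oV (proj₁ (proj₁ p)) (proj₂ (proj₁ p)) (proj₂ p) v (decBase (proj₂ (proj₁ p)))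
    }
    where
    module _ (V : W.Carrier → Set) (oV : W.Open V) where
      local : ∀ i w t → V (i , moved i (w , t)) →
              ∃ λ ε → 0# < ε × ∀ p → Space.Ball S×I ε (w , t) p → V (i , moved i p)
      local i w t = Space.open⇒ball S×I {λ p → V (i , moved i p)} (_⇒_.continuous (movedMap i) (λ y → V (i , y)) (proj₂ oV i)) (w , t)

      nbhd : ∀ i w t → V (i , moved i (w , t)) → Dec (Space._∼_ S w (basePoint d)) →
             ∃₂ λ U U′ → W.Open U × Space.Open interval U′ × (U (i , w) × U′ t) ×
             (∀ {q} → U (proj₁ q) × U′ (proj₂ q) → V (movedTo q))
      nbhd i w t v (no w≁) =
        let (ε , 0<ε , f) = local i w t v in
        (λ (j , y) → j ≡ i × Space.Ball S ε w y × ¬ Space._∼_ S y (basePoint d)) ,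
        Space.Ball interval ε t ,
        ((λ { {j , y} {l , y′} (inj₁ (≡.refl , e)) (j≡i , b , ne) →
                 j≡i , Space.resp-≈ S {Space.Ball S ε w} (Space.ball-open S ε w) {y} {y′} e b , λ e′ → ne λ a → trans (e a) (e′ a)
            ; {j , y} {l , y′} (inj₂ (e , _)) (_ , _ , ne) → ⊥-elim (ne e) }) ,
         λ j → Space.ball⇒open S λ { y (j≡i , b , ne) →
           let (δ , 0<δ , g) = Space.open⇒ball S {Space.Ball S ε w} (Space.ball-open S ε w) y b
               (η , 0<η , h) = nonbase-open y ne
           in δ ⊓ η , ⊓-pos 0<δ 0<η , λ y′ b′ → j≡i ,
              g y′ (Space.ball-mono S {x = y} {y′} (x⊓y≤x δ η) b′) , h y′ (Space.ball-mono S {x = y} {y′} (x⊓y≤y δ η) b′) }) ,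
        Space.ball-open interval ε t ,
        ((≡.refl , Space.ball-refl S {x = w} {w} 0<ε (λ _ → refl) , w≁) , Space.ball-refl interval {x = t} {t} 0<ε (λ _ → refl)) ,
        λ { {(j , y) , s} ((≡.refl , b , _) , c) → f (y , s) [ b , c ] }
      nbhd i w t v (yes w∼) =
        let (ε , 0<ε , f) = uniform-Fin (suc k)
              (λ j ε → ∀ p → Space.Ball S×I ε (w , t) p → V (j , moved j p))
              (λ j δ≤ε f p b → f p (Space.ball-mono S×I {x = w , t} {p} δ≤ε b))
              (λ j → local j w t (proj₁ oV (inj₂ (moved-base i w t w∼ , moved-base j w t w∼)) v))
        in
        (λ (_ , y) → Space.Ball S ε w y) ,
        Space.Ball interval ε t ,
        ((λ { {j , y} {l , y′} (inj₁ (≡.refl , e)) b → Space.resp-≈ S {Space.Ball S ε w} (Space.ball-open S ε w) {y} {y′} e b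
            ; {j , y} {l , y′} (inj₂ (_ , e)) _ → Space.ball-refl S {x = w} {y′} 0<ε (λ a → trans (w∼ a) (sym (e a))) }) ,
         λ j → Space.ball-open S ε w) ,
        Space.ball-open interval ε t ,
        (Space.ball-refl S {x = w} {w} 0<ε (λ _ → refl) , Space.ball-refl interval {x = t} {t} 0<ε (λ _ → refl)) ,
        λ { {(j , y) , s} (b , c) → f j (y , s) [ b , c ] }

  blend-0 : ∀ i w j → blend i w 0# j ≈ Q i (expand i w) j
  blend-0 i w j = solve 2 (λ q w → (con (+ 1) :- con (+ 0)) :* q :+ con (+ 0) :* w := q) refl (Q i (expand i w) j) (proj₁ w j)

  blend-1 : ∀ i w j → blend i w 1# j ≈ proj₁ w j
  blend-1 i w j = solve 2 (λ q w → (con (+ 1) :- con (+ 1)) :* q :+ con (+ 1) :* w := w) refl (Q i (expand i w) j) (proj₁ w j)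

  moved-start : ∀ i w → Space._∼_ S (moved i (w , 𝕀₀)) (toSphere i (expandPt i w))
  moved-start i w = unit-cong {q = blendPt i (w , 𝕀₀)} {q′ = Q̂ i (expandPt i w)} (blend-0 i w)

  moved-end : ∀ i w → Space._∼_ S (moved i (w , 𝕀₁)) w
  moved-end i w j = trans (unit-idem (blendPt i (w , 𝕀₁)) (trans (squares-cong (blend-1 i w)) (proj₂ w)) j) (blend-1 i w j)

  wedge-start : ∀ p → movedTo (p , 𝕀₀) W.≈ collapse (expandPt (proj₁ p) (proj₂ p))
  wedge-start (i , w) = W.trans {movedTo ((i , w) , 𝕀₀)} {i , toSphere i (expandPt i w)} {collapse (expandPt i w)}
    (inj₁ (≡.refl , moved-start i w))
    (W.sym {collapse (expandPt i w)} {i , toSphere i (expandPt i w)} (collapse-at i (expandPt i w) (expand-only i w)))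

  collapse∘expand : Homotopic (collapseMap ∘ₜ expandMap) (idₜ wedge)
  collapse∘expand = wedgeHomotopy , wedge-start , λ (i , w) → inj₁ (≡.refl , moved-end i w)

  indicator : Fin (suc k) → Coords (suc n)
  indicator i = place (vertex i) (λ _ → 1#)

  indicator-in : ∀ i j → indicator i (vertex i j) ≈ 1#
  indicator-in i = place-in (vertex i) _ (injective i)

  indicator-out : ∀ i {p} → p ∉ facet i → indicator i p ≈ 0#
  indicator-out i = place-out (vertex i) _

  indicator-nonNeg : ∀ i → NonNeg (indicator i)
  indicator-nonNeg i = place-nonNeg (vertex i) λ _ → <⇒≤ 0<1

  -- Subtracting the minimum moves the facet onto its boundary.
  reduce : Fin (suc k) → Coords (suc n) → Coords (suc n)
  reduce i x p = x p - m i x * indicator i p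

  facet-cases : ∀ i p → (∃ λ j → vertex i j ≡ p) ⊎ p ∉ facet i
  facet-cases i p with p ∈? facet i
  ... | yes p∈ = inj₁ (∈image⁻ (vertex i) p∈)
  ... | no p∉  = inj₂ p∉

  reduce-in : ∀ i x j → reduce i x (vertex i j) ≈ x (vertex i j) - m i x
  reduce-in i x j = +-congˡ (-‿cong (≈1⇒*≈ˡ (indicator-in i j)))

  reduce-out : ∀ i x {p} → p ∉ facet i → reduce i x p ≈ x p
  reduce-out i x {p} p∉ = trans (+-congˡ (-‿cong (≈0⇒*≈0ʳ (indicator-out i p∉))))
    (solve 1 (λ a → a :- con (+ 0) := a) refl (x p))

  reduce-nonNeg : ∀ i {x} → NonNeg x → NonNeg (reduce i x)
  reduce-nonNeg i {x} x≥0 p with facet-cases i p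
  ... | inj₁ (j , ≡.refl) = ≤-respʳ-≈ (sym (reduce-in i x j)) (gap≤ (m≤ i x j))
  ... | inj₂ p∉           = ≤-respʳ-≈ (sym (reduce-out i x p∉)) (x≥0 p)

  module _ (i : Fin (suc k)) (x : Pt cone) where
    private
      w = toSphere i x
      q = Q i (proj₁ x)
      κ = proj₁ (scale q (Q-pos i (proj₁ (proj₂ x)) (proj₂ (proj₂ x))))
      0<κ : 0# < κ
      0<κ = proj₁ (proj₂ (scale q (Q-pos i (proj₁ (proj₂ x)) (proj₂ (proj₂ x)))))
      x≥0 = proj₁ (proj₁ (proj₂ x))

    0<Q₀ : 0# < proj₁ w zero → 0# < q zero
    0<Q₀ = *-cancel-pos 0<κ

    w₀≤0⇒0<m : proj₁ w zero ≤ 0# → 0# < m i (proj₁ x)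
    w₀≤0⇒0<m w₀≤0 = [ (λ m≈0 → ⊥-elim (≤⇒≯ w₀≤0 (<-respʳ-≈ (sym (toSphere-base i x m≈0 zero)) 0<1))) , id ]′
      (0≤⇒≈⊎< (0≤m i x≥0))

    -- Let `p` be a vertex where `x` is largest. On the facet its reduced coordinate is `M - m`,
    -- which exceeds the positive first coordinate `M - 2m` by `m`; off the facet it is unchanged.
    reduce-nonZero : 0# < proj₁ w zero → NonZero (reduce i (proj₁ x))
    reduce-nonZero 0<w₀ = p , [ on-facet , off-facet ]′ (facet-cases i p)
      where
      p = proj₁ (maximum-attained (proj₁ x))
      M≈ = proj₂ (maximum-attained (proj₁ x))
      on-facet : (∃ λ j → vertex i j ≡ p) → 0# < reduce i (proj₁ x) p
      on-facet (j , e) = ≡.subst (λ p → 0# < reduce i (proj₁ x) p) e (<-respʳ-≈ (sym (reduce-in i (proj₁ x) j))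
            (<-respʳ-≈ (+-congʳ (trans M≈ (reflexive (≡.cong (proj₁ x) (≡.sym e))))) (<-≤-trans (0<Q₀ 0<w₀) (le (0≤m i x≥0)
              (solve 2 (λ a b → b := (a :- b) :- (a :- con (+ 2) :* b)) refl (M (proj₁ x)) (m i (proj₁ x)))))))
      off-facet : p ∉ facet i → 0# < reduce i (proj₁ x) p
      off-facet p∉ = <-respʳ-≈ (sym (reduce-out i (proj₁ x) p∉)) (<-respʳ-≈ M≈ (0<M (proj₂ (proj₂ x))))

    heights≈ : ∀ j → heights w j ≈ κ * (m i (proj₁ x) * (proj₁ x (vertex i j) - proj₁ x (vertex i zero)))
    heights≈ zero    = sym (≈0⇒*≈0ʳ (≈0⇒*≈0ʳ (-‿inverseʳ _)))
    heights≈ (suc j) = refl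

    -- The heights of `w` are a nonnegative multiple of the coordinates of `x` on the facet, up to a
    -- shift. They are therefore lowest wherever `x` is, and with depth zero the lift vanishes
    -- there.
    lift-at-minimum : 0# ≤ proj₁ w zero → ∀ j → m i (proj₁ x) ≈ proj₁ x (vertex i j) → lift-facet i w (vertex i j) ≈ 0#
    lift-at-minimum 0≤w₀ j m≈ = trans (lift-at i w j) (trans (+-cong (trans (+-congˡ (-‿cong lowest≈)) (-‿inverseʳ _)) (depth≈0 w 0≤w₀)) (+-identityʳ 0#))
      where
      h≤ : ∀ j′ → heights w j ≤ heights w j′
      h≤ j′ = ≤-respˡ-≈ (sym (heights≈ j)) (≤-respʳ-≈ (sym (heights≈ j′))
        (*-monoʳ-≤ (<⇒≤ 0<κ) (*-monoʳ-≤ (0≤m i x≥0) (+-mono-≤ (≤-trans (≤-reflexive (sym m≈)) (m≤ i (proj₁ x) j′)) ≤-refl))))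
      lowest≈ : lowest w ≈ heights w j
      lowest≈ = let (j′ , e) = lowest-attained w in
        ≤-antisym (lowest≤ w j) (≤-respʳ-≈ (sym e) (h≤ j′))

  -- For `a` and `c` equal to 0 this is the lift of the sphere point. For both equal to 1 it is `x`,
  -- because the last term restores what `reduce` subtracts. The middle term enters first, so that
  -- the vector survives the removal of the apex weight.
  mix : Fin (suc k) → Pt cone → Carrier → Carrier → Coords (suc n)
  mix i x a c p = ((1# - c) * lift-facet i (toSphere i x) p + a * reduce i (proj₁ x) p) + c * (m i (proj₁ x) * indicator i p)

  deform : Fin (suc k) → Pt cone → Carrier → Carrier → Carrier → Coords (suc n)
  deform i x a b c = contract ((1# - b) * time (toSphere i x)) ((1# - a) * excess (toSphere i x)) (mix i x a c)

  mix-≈0 : ∀ {a c} i x p → lift-facet i (toSphere i x) p ≈ 0# → a * reduce i (proj₁ x) p ≈ 0# →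
           c * (m i (proj₁ x) * indicator i p) ≈ 0# → mix i x a c p ≈ 0#
  mix-≈0 i x p e f g = trans (+-cong (trans (+-cong (≈0⇒*≈0ʳ e) f) (+-identityʳ 0#)) g) (+-identityʳ 0#)

  module _ (i : Fin (suc k)) (x : Pt cone) (only : OnlyFacet i (proj₁ x)) {a c : Carrier}
           (0≤a : 0# ≤ a) (0≤c : 0# ≤ c) (c≤1 : c ≤ 1#) where
    private
      w = toSphere i x
      y = mix i x a c
      carried = proj₁ (proj₂ x)
      x≥0 = proj₁ carried
      L≥0 = lift-nonNeg i w
      U≥0 = reduce-nonNeg i x≥0
      term₁ : ∀ p → 0# ≤ (1# - c) * lift-facet i w p
      term₁ p = *-nonNeg (gap≤ c≤1) (L≥0 p)
      term₂ : ∀ p → 0# ≤ a * reduce i (proj₁ x) p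
      term₂ p = *-nonNeg 0≤a (U≥0 p)
      term₃ : ∀ p → 0# ≤ c * (m i (proj₁ x) * indicator i p)
      term₃ p = *-nonNeg 0≤c (*-nonNeg (0≤m i x≥0) (indicator-nonNeg i p))

    mix-nonNeg : NonNeg y
    mix-nonNeg p = +-nonNeg (+-nonNeg (term₁ p) (term₂ p)) (term₃ p)

    mix-supported : 0# < m i (proj₁ x) → SupportedOn i y
    mix-supported 0<m p 0<y = decidable-stable (p ∈? facet i) λ p∉ → 0<⇒≉ 0<y (mix-≈0 i x p
      (place-out (vertex i) _ p∉)
      (≈0⇒*≈0ʳ (trans (reduce-out i (proj₁ x) p∉) (x≈0 p∉)))
      (≈0⇒*≈0ʳ (≈0⇒*≈0ʳ (indicator-out i p∉))))
      where
      x≈0 : ∀ {p} → p ∉ facet i → proj₁ x p ≈ 0#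
      x≈0 {p} p∉ = [ id , (λ 0<x → ⊥-elim (p∉ (supported i carried 0<m p 0<x))) ]′ (0≤⇒≈⊎< (x≥0 p))

    mix-pos⇒ : m i (proj₁ x) ≈ 0# → ∀ p → 0# < y p → 0# < proj₁ x p
    mix-pos⇒ m≈0 p 0<y = [ (λ x≈0 → ⊥-elim (0<⇒≉ 0<y (y≈0 x≈0))) , id ]′ (0≤⇒≈⊎< (x≥0 p))
      where
      mi≈0 : m i (proj₁ x) * indicator i p ≈ 0#
      mi≈0 = ≈0⇒*≈0ˡ m≈0
      y≈0 : proj₁ x p ≈ 0# → y p ≈ 0#
      y≈0 x≈0 = mix-≈0 i x p (lift-base i w (toSphere-base i x m≈0) p)
        (≈0⇒*≈0ʳ (trans (+-cong x≈0 (-‿cong mi≈0)) (-‿inverseʳ 0#)))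
        (≈0⇒*≈0ʳ mi≈0)

    m-cases : m i (proj₁ x) ≈ 0# ⊎ 0# < m i (proj₁ x)
    m-cases = 0≤⇒≈⊎< (0≤m i x≥0)

    mix-carried : Carried nonfaces y
    mix-carried = [ (λ m≈0 → carried-⊆ carried mix-nonNeg (mix-pos⇒ m≈0))
                  , (λ 0<m → carried-by (facet i) mix-nonNeg (facet-face i) (mix-supported 0<m)) ]′ m-cases

    m≈0-all : m i (proj₁ x) ≈ 0# → ∀ j → m j (proj₁ x) ≈ 0#
    m≈0-all m≈0 j = [ (λ { ≡.refl → m≈0 }) , only j ]′ (Dec.toSum (j Fin.≟ i))

    mix-at-minimum : c ≈ 0# → 0# < proj₁ w zero → ∀ j → m i (proj₁ x) ≈ proj₁ x (vertex i j) → y (vertex i j) ≈ 0#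
    mix-at-minimum c≈0 0<w₀ j m≈ = mix-≈0 i x (vertex i j)
      (lift-at-minimum i x (<⇒≤ 0<w₀) j m≈)
      (≈0⇒*≈0ʳ (trans (reduce-in i (proj₁ x) j) (trans (+-congˡ (-‿cong m≈)) (-‿inverseʳ _))))
      (≈0⇒*≈0ˡ c≈0)

    -- Both the lift and the reduced vector vanish at a vertex where `x` is smallest on the facet,
    -- so their combination lies on the boundary and the collapses can be applied to it.
    mix-core : c ≈ 0# → 0# < proj₁ w zero → Carried core y
    mix-core c≈0 0<w₀ = [ (λ m≈0 → carried-⊆ (m≈0⇒core carried (m≈0-all m≈0)) mix-nonNeg (mix-pos⇒ m≈0))
                        , (λ 0<m → boundary-core i mix-nonNeg (mix-supported 0<m) vanishing) ]′ m-cases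
      where
      vanishing : ∃ λ j → y (vertex i j) ≈ 0#
      vanishing = let (j , m≈) = m-attained i (proj₁ x) in j , mix-at-minimum c≈0 0<w₀ j m≈

    mix-nonZero-reduce : 0# < a → 0# < proj₁ w zero → NonZero y
    mix-nonZero-reduce 0<a 0<w₀ = let (p , 0<u) = reduce-nonZero i x 0<w₀ in
      p , +-pos-nonNeg (+-nonNeg-pos (term₁ p) (*-pos 0<a 0<u)) (term₃ p)

    mix-nonZero-lift : c < 1# → proj₁ w zero ≤ ½ → NonZero y
    mix-nonZero-lift c<1 w₀≤½ = let (p , 0<l) = lift-nonZero i w w₀≤½ in
      p , +-pos-nonNeg (+-pos-nonNeg (*-pos (gap< c<1) 0<l) (term₂ p)) (term₃ p)

    mix-nonZero-facet : 0# < c → 0# < m i (proj₁ x) → NonZero y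
    mix-nonZero-facet 0<c 0<m = vertex i zero , +-nonNeg-pos (+-nonNeg (term₁ _) (term₂ _))
      (*-pos 0<c (<-respʳ-≈ (sym (≈1⇒*≈ˡ (indicator-in i zero))) 0<m))

    -- The last two hypotheses make the phases consecutive: `b` starts only after `a` has reached 1,
    -- and `c` only after `b` has.
    module _ {b : Carrier} (0≤b : 0# ≤ b) (a≤1 : a ≤ 1#) (b⇒a : 0# < b → a ≈ 1#) (c⇒b : 0# < c → b ≈ 1#) where
      private
        A = (1# - b) * time w
        e = (1# - a) * excess w
        z = deform i x a b c
        0≤e : 0# ≤ e
        0≤e = *-nonNeg (gap≤ a≤1) (0≤excess w)
        a≈1⇒0<a : a ≈ 1# → 0# < a
        a≈1⇒0<a a≈1 = <-respʳ-≈ (sym a≈1) 0<1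
        a≈1⇒e≈0 : a ≈ 1# → e ≈ 0#
        a≈1⇒e≈0 a≈1 = ≈0⇒*≈0ˡ (1-≈0 a≈1)
        b≈1⇒A≈0 : b ≈ 1# → A ≈ 0#
        b≈1⇒A≈0 b≈1 = ≈0⇒*≈0ˡ (1-≈0 b≈1)
        Result : Set
        Result = Carried nonfaces z × NonZero z

        still : A ≈ 0# → e ≈ 0# → NonZero y → Result
        still A≈0 e≈0 nz = carried-≈ (contract-still A≈0 e≈0) mix-carried , nonzero-≈ (contract-still A≈0 e≈0) nz

        in-core : e ≈ 0# → c ≈ 0# → 0# < proj₁ w zero → NonZero y → Result
        in-core e≈0 c≈0 0<w₀ nz = core⇒carried (contract-core e≈0 (mix-core c≈0 0<w₀)) ,
                                  contract-nonZero 0≤e (mix-core c≈0 0<w₀) nz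

        at-top : c ≈ 0# → ½ < proj₁ w zero → b ≈ 0# ⊎ 0# < b → a ≈ 0# ⊎ 0# < a → Result
        at-top c≈0 ½<w₀ (inj₂ 0<b) _ = in-core (a≈1⇒e≈0 (b⇒a 0<b)) c≈0 (<-trans 0<½ ½<w₀)
                                         (mix-nonZero-reduce (a≈1⇒0<a (b⇒a 0<b)) (<-trans 0<½ ½<w₀))
        -- With `b` still 0 the full contraction is in force, so the vector sits at the apex and the
        -- excess may be added. It is nonzero through the excess at the start and through `reduce`
        -- once `a` is positive.
        at-top c≈0 ½<w₀ (inj₁ b≈0) a? = core⇒carried (contract-apex D≤A 0≤e y-core) , nz a?
          where
          y-core = mix-core c≈0 (<-trans 0<½ ½<w₀)
          D≤A = ≤-respʳ-≈ (sym (≈1⇒*≈ʳ (1-≈1 b≈0))) (duration≤time w ½<w₀)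
          nz : a ≈ 0# ⊎ 0# < a → NonZero z
          nz (inj₂ 0<a) = contract-nonZero 0≤e y-core (mix-nonZero-reduce 0<a (<-trans 0<½ ½<w₀))
          nz (inj₁ a≈0) = contract-nonZero-apex
            (<-respʳ-≈ (sym (≈1⇒*≈ʳ (1-≈1 a≈0))) (0<excess w ½<w₀)) y-core

        above : 0# < proj₁ w zero → c ≈ 0# ⊎ 0# < c → ½ < proj₁ w zero ⊎ proj₁ w zero ≤ ½ → Result
        above 0<w₀ (inj₂ 0<c) _ = still (b≈1⇒A≈0 b≈1) (a≈1⇒e≈0 a≈1) (mix-nonZero-reduce (a≈1⇒0<a a≈1) 0<w₀)
          where
          b≈1 = c⇒b 0<c
          a≈1 = b⇒a (<-respʳ-≈ (sym b≈1) 0<1)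
        above 0<w₀ (inj₁ c≈0) (inj₁ ½<w₀) = at-top c≈0 ½<w₀ (0≤⇒≈⊎< 0≤b) (0≤⇒≈⊎< 0≤a)
        above 0<w₀ (inj₁ c≈0) (inj₂ w₀≤½) = in-core (≈0⇒*≈0ʳ (excess≈0 w w₀≤½)) c≈0 0<w₀
          (mix-nonZero-lift (<-respˡ-≈ (sym c≈0) 0<1) w₀≤½)

        below : proj₁ w zero ≤ 0# → c < 1# ⊎ 1# ≤ c → Result
        below w₀≤0 c? = still (≈0⇒*≈0ʳ (time≈0 w w₀≤0))
          (≈0⇒*≈0ʳ (excess≈0 w (≤-trans w₀≤0 (<⇒≤ 0<½))))
          ([ (λ c<1 → mix-nonZero-lift c<1 (≤-trans w₀≤0 (<⇒≤ 0<½)))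
           , (λ 1≤c → mix-nonZero-facet (<-≤-trans 0<1 1≤c) (w₀≤0⇒0<m i x w₀≤0)) ]′ c?)

      -- If the first coordinate is nonpositive, the contraction never acts. If it is positive,
      -- either `c` is 0 and the mixture lies in the core, where contracting is allowed, or the
      -- first two phases are complete and the contraction is over.
      deform-in : Carried nonfaces z × NonZero z
      deform-in = [ (λ 0<w₀ → above 0<w₀ (0≤⇒≈⊎< 0≤c) (<-≤-total ½ (proj₁ w zero)))
                  , (λ w₀≤0 → below w₀≤0 (<-≤-total c 1#)) ]′ (<-≤-total 0# (proj₁ w zero))

  Z : Space
  Z = cone ×ₛ interval

  3# : Carrier
  3# = 1# + 1# + 1#

  phase₁ phase₂ phase₃ : Pt Z → Carrier
  phase₁ z = clamp (3# * proj₁ (proj₂ z) zero)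
  phase₂ z = clamp (3# * proj₁ (proj₂ z) zero - 1#)
  phase₃ z = clamp (3# * proj₁ (proj₂ z) zero - 1# - 1#)

  clamp-next : ∀ r → 0# < clamp (r - 1#) → clamp r ≈ 1#
  clamp-next r 0<c with <-≤-total 0# (r - 1#)
  ... | inj₂ p = ⊥-elim (0<⇒≉ 0<c (clamp-≤0 p))
  ... | inj₁ p = clamp-≥1 (<⇒≤ (lt p refl))

  abstract
    deformation : Fin (suc k) → Pt Z → Coords (suc n)
    deformation i z = deform i (proj₁ z) (phase₁ z) (phase₂ z) (phase₃ z)

    deformation≈ : ∀ i x s p → deform i x (phase₁ (x , s)) (phase₂ (x , s)) (phase₃ (x , s)) p ≈ deformation i (x , s) p
    deformation≈ i x s p = refl

  select′ : Pt Z → Fin (suc k)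
  select′ z = select (proj₁ (proj₁ z))

  deformation-in : ∀ i z → OnlyFacet i (proj₁ (proj₁ z)) →
                   Carried nonfaces (deformation i z) × NonZero (deformation i z)
  deformation-in i z only = carried-≈ (deformation≈ i (proj₁ z) (proj₂ z)) (proj₁ in-cone) , nonzero-≈ (deformation≈ i (proj₁ z) (proj₂ z)) (proj₂ in-cone)
    where
    in-cone = deform-in i (proj₁ z) only (0≤clamp _) (0≤clamp _) (clamp≤1 _) (0≤clamp _) (clamp≤1 _) (clamp-next _) (clamp-next _)

  deformationPt : Pt Z → Pt cone
  deformationPt z = deformation (select′ z) z ,
    deformation-in (select′ z) z (select-only (proj₁ (proj₁ z)) (proj₁ (proj₂ (proj₁ z))))

  cont-x : ∀ p → Cont Z (λ z → proj₁ (proj₁ z) p)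
  cont-x p = cont-coord {Z} (inj₁ p)

  cont-3s : Cont Z (λ z → 3# * proj₁ (proj₂ z) zero)
  cont-3s = cont-* {Z} (cont-const {Z} 3#) (cont-coord {Z} (inj₂ zero))

  cont-phase₁ : Cont Z phase₁
  cont-phase₁ = cont-clamp {Z} cont-3s

  cont-phase₂ : Cont Z phase₂
  cont-phase₂ = cont-clamp {Z} (cont-sub {Z} cont-3s (cont-const {Z} 1#))

  cont-phase₃ : Cont Z phase₃
  cont-phase₃ = cont-clamp {Z} (cont-sub {Z} (cont-sub {Z} cont-3s (cont-const {Z} 1#)) (cont-const {Z} 1#))

  cont-1- : ∀ {φ : Pt Z → Carrier} → Cont Z φ → Cont Z (λ z → 1# - φ z)
  cont-1- c = cont-sub {Z} (cont-const {Z} 1#) c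

  module _ (i : Fin (suc k)) where
    private
      cont-toS : ∀ j → Cont Z (λ z → proj₁ (toSphere i (proj₁ z)) j)
      cont-toS = cont-toSphere {Z} proj₁ cont-x i

      cont-mi : ∀ p → Cont Z (λ z → m i (proj₁ (proj₁ z)) * indicator i p)
      cont-mi p = cont-* {Z} (cont-m {Z} {λ z → proj₁ (proj₁ z)} cont-x i) (cont-const {Z} _)

    cont-deformation : ∀ p → Cont Z (λ z → deformation i z p)
    cont-deformation p = cont-≈ {Z} (λ z → deformation≈ i (proj₁ z) (proj₂ z) p) (cont-contract {Z}
      (cont-* {Z} (cont-1- cont-phase₂) (cont-time {Z} {λ z → toSphere i (proj₁ z)} cont-toS))
      (cont-* {Z} (cont-1- cont-phase₁) (cont-excess {Z} {λ z → toSphere i (proj₁ z)} cont-toS))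
      (λ p → cont-+ {Z} (cont-+ {Z}
        (cont-* {Z} (cont-1- cont-phase₃) (cont-lift {Z} {λ z → toSphere i (proj₁ z)} cont-toS i p))
        (cont-* {Z} cont-phase₁ (cont-sub {Z} (cont-x p) (cont-mi p))))
        (cont-* {Z} cont-phase₃ (cont-mi p))) p)

  -- Where both minima vanish, both sphere points are the base point: the lifts are zero, nothing is
  -- subtracted by `reduce`, and time and excess coincide.
  deformation-agree : ∀ i j (z : Pt Z) → m i (proj₁ (proj₁ z)) ≈ 0# → m j (proj₁ (proj₁ z)) ≈ 0# →
                      ∀ p → deformation i z p ≈ deformation j z p
  deformation-agree i j z mi mj p = trans (sym (deformation≈ i (proj₁ z) (proj₂ z) p)) (trans (contract-cong
      (*-congˡ (time-cong (w i) (w j) w₀≈)) (*-congˡ (excess-cong (w i) (w j) w₀≈))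
      (λ q → +-cong (+-cong (*-congˡ (trans (lift-base i (w i) (base i mi) q) (sym (lift-base j (w j) (base j mj) q))))
               (*-congˡ (+-congˡ (-‿cong (trans (vanish mi) (sym (vanish mj)))))))
               (*-congˡ (trans (vanish mi) (sym (vanish mj))))) p)
    (deformation≈ j (proj₁ z) (proj₂ z) p))
    where
    w : Fin (suc k) → Pt S
    w i = toSphere i (proj₁ z)
    base : ∀ i → m i (proj₁ (proj₁ z)) ≈ 0# → Space._∼_ S (w i) (basePoint d)
    base i = toSphere-base i (proj₁ z)
    w₀≈ : proj₁ (w i) zero ≈ proj₁ (w j) zero
    w₀≈ = trans (base i mi zero) (sym (base j mj zero))
    vanish : ∀ {u v} → u ≈ 0# → u * v ≈ 0#
    vanish e = ≈0⇒*≈0ˡ e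

  -- The selected index may jump. `glue` is therefore applied to the preimages of an interval around
  -- the value at `z` under the deformations of the individual facets.
  cont-deformationPt : ∀ p → Cont Z (λ z → proj₁ (deformationPt z) p)
  cont-deformationPt p z ε 0<ε =
    let (δ , 0<δ , f) = glue {Z} (λ i z → m i (proj₁ (proj₁ z))) (cont-m {Z} {λ z → proj₁ (proj₁ z)} cont-x)
          (λ i z → 0≤m i (proj₁ (proj₁ (proj₂ (proj₁ z))))) select′
          (λ z → select-only (proj₁ (proj₁ z)) (proj₁ (proj₂ (proj₁ z))))
          (λ i y → Close ε v (deformation i y p)) ball-open-V
          (λ y all≈0 i j c → within⇒close (within-resp
             (+-congʳ (deformation-agree i j y (all≈0 i) (all≈0 j) p)) (close⇒within c)))
          z (close-refl 0<ε refl)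
    in δ , 0<δ , λ y b → close⇒within (f y b)
    where
    v = proj₁ (deformationPt z) p
    ball-open-V : ∀ i → Space.BallOpen Z (λ y → Close ε v (deformation i y p))
    ball-open-V i y c =
      let (η , 0<η , g) = close-open c
          (δ , 0<δ , f) = cont-deformation i p y η 0<η
      in δ , 0<δ , λ y′ b → g _ (within⇒close (f y′ b))

  deform-0 : ∀ i x p → deform i x (phase₁ (x , 𝕀₀)) (phase₂ (x , 𝕀₀)) (phase₃ (x , 𝕀₀)) p ≈
             contract (time (toSphere i x)) (excess (toSphere i x)) (lift-facet i (toSphere i x)) p
  deform-0 i x = contract-cong
    (one (clamp-≤0 (le (<⇒≤ 0<1) (solve 0 (con (+ 1) := con (+ 0) :- (con (+ 3) :* con (+ 0) :- con (+ 1))) refl))))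
    (one a≈0)
    (λ q → trans (+-cong (trans (+-cong (one c≈0) (≈0⇒*≈0ˡ a≈0)) (+-identityʳ _)) (≈0⇒*≈0ˡ c≈0))
                (+-identityʳ _))
    where
    a≈0 : phase₁ (x , 𝕀₀) ≈ 0#
    a≈0 = clamp-≤0 (≤-reflexive (zeroʳ 3#))
    c≈0 : phase₃ (x , 𝕀₀) ≈ 0#
    c≈0 = clamp-≤0 (le (<⇒≤ 0<2#) (solve 0 (con (+ 2) := con (+ 0) :- (con (+ 3) :* con (+ 0) :- con (+ 1) :- con (+ 1))) refl))
    one : ∀ {t y} → t ≈ 0# → (1# - t) * y ≈ y
    one t≈0 = ≈1⇒*≈ʳ (1-≈1 t≈0)

  deformation-0 : ∀ i x p → deformation i (x , 𝕀₀) p ≈ expand i (toSphere i x) p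
  deformation-0 i x p = trans (sym (deformation≈ i x 𝕀₀ p)) (trans (deform-0 i x p) (expand≈ i (toSphere i x) p))

  deform-1 : ∀ i x p → deform i x (phase₁ (x , 𝕀₁)) (phase₂ (x , 𝕀₁)) (phase₃ (x , 𝕀₁)) p ≈ proj₁ x p
  deform-1 i x p = trans (sym (contract-still (none b≈1) (none a≈1) p))
    (trans (+-cong (trans (+-cong (none c≈1) (≈1⇒*≈ʳ a≈1)) (+-identityˡ _)) (≈1⇒*≈ʳ c≈1))
      (solve 2 (λ a b → (a :- b) :+ b := a) refl (proj₁ x p) (m i (proj₁ x) * indicator i p)))
    where
    a≈1 : phase₁ (x , 𝕀₁) ≈ 1#
    a≈1 = clamp-≥1 (le (<⇒≤ 0<2#) (solve 0 (con (+ 2) := con (+ 3) :* con (+ 1) :- con (+ 1)) refl))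
    b≈1 : phase₂ (x , 𝕀₁) ≈ 1#
    b≈1 = clamp-≥1 (le (<⇒≤ 0<1) (solve 0 (con (+ 1) := (con (+ 3) :* con (+ 1) :- con (+ 1)) :- con (+ 1)) refl))
    c≈1 : phase₃ (x , 𝕀₁) ≈ 1#
    c≈1 = clamp-≥1 (≤-reflexive (solve 0 (con (+ 1) := con (+ 3) :* con (+ 1) :- con (+ 1) :- con (+ 1)) refl))
    none : ∀ {t y} → t ≈ 1# → (1# - t) * y ≈ 0#
    none t≈1 = ≈0⇒*≈0ˡ (1-≈0 t≈1)

  deformation-1 : ∀ i x p → deformation i (x , 𝕀₁) p ≈ proj₁ x p
  deformation-1 i x p = trans (sym (deformation≈ i x 𝕀₁ p)) (deform-1 i x p)

  collapse-select : ∀ x → (select (proj₁ x) , toSphere (select (proj₁ x)) x) W.≈ collapse x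
  collapse-select x = W.sym {collapse x} {select (proj₁ x) , toSphere (select (proj₁ x)) x}
    (collapse-at (select (proj₁ x)) x (select-only (proj₁ x) (proj₁ (proj₂ x))))

  deformation-start : ∀ x p → proj₁ (deformationPt (x , 𝕀₀)) p ≈ expand (proj₁ (collapse x)) (proj₂ (collapse x)) p
  deformation-start x p = trans {j = expand (select (proj₁ x)) (toSphere (select (proj₁ x)) x) p} (deformation-0 (select (proj₁ x)) x p)
    (expand-cong {select (proj₁ x) , toSphere (select (proj₁ x)) x} {collapse x} (collapse-select x) p)

  expand∘collapse : Homotopic (expandMap ∘ₜ collapseMap) (idₜ (Space.space cone))
  expand∘collapse = continuousMap Z cone deformationPt cont-deformationPt , deformation-start , λ x → deformation-1 (select (proj₁ x)) x

  cone≃wedge : Space.space cone ≃ wedge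
  cone≃wedge = collapseMap , expandMap , expand∘collapse , collapse∘expand

-- Posets that are opposite to the face poset of a complex.

private
  variable
    A : Set

Face : List (Subset n) → Subset n → Set
Face Φ T = Nonempty T × Avoids Φ T

face? : ∀ (Φ : List (Subset n)) T → Dec (Face Φ T)
face? Φ T = nonempty? T ×-dec avoids? Φ T

-- The elements of `P` may contain proofs, so they are compared only through their faces, and
-- `element` is inverse to `face` up to the equality of the poset.
record FacePoset (P : Poset 0ℓ 0ℓ 0ℓ) (Φ : List (Subset n)) : Set where
  private
    module P = Poset P
  field
    face      : P.Carrier → Subset n
    face-face : ∀ p → Face Φ (face p)
    reverse   : ∀ {p q} → p P.≤ q → face q ⊆ face p
    reflect   : ∀ {p q} → face q ⊆ face p → p P.≤ q
    element   : ∀ T → Face Φ T → P.Carrier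
    face-element : ∀ T (f : Face Φ T) → face (element T f) ≡ T

  reflect-≈ : ∀ {p q} → face p ≡ face q → p P.≈ q
  reflect-≈ e = P.antisym (reflect λ x∈ → ≡.subst (_ ∈_) (≡.sym e) x∈) (reflect λ x∈ → ≡.subst (_ ∈_) e x∈)

  face-cong : ∀ {p q} → p P.≈ q → face p ≡ face q
  face-cong p≈q = ⊆-antisym (reverse (P.reflexive (P.Eq.sym p≈q))) (reverse (P.reflexive p≈q))

_≟ˢ_ : (S T : Subset n) → Dec (S ≡ T)
_≟ˢ_ = Vec.≡-dec Bool._≟_

-- Larger subsets come first, so that filtering the list yields chains in
-- increasing order of the opposite of inclusion.
subsets : ∀ n → List (Subset n)
subsets zero    = [] ∷ []
subsets (suc n) = List.map (inside ∷_) (subsets n) ++ List.map (outside ∷_) (subsets n)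

∈-subsets : (T : Subset n) → T Membership.∈ subsets n
∈-subsets []            = here ≡.refl
∈-subsets (inside ∷ T)  = Membership.∈-++⁺ˡ (Membership.∈-map⁺ (inside ∷_) (∈-subsets T))
∈-subsets (outside ∷ T) = Membership.∈-++⁺ʳ (List.map (inside ∷_) (subsets _)) (Membership.∈-map⁺ (outside ∷_) (∈-subsets T))

subsets-ordered : ∀ n → AllPairs _⊈_ (subsets n)
subsets-ordered zero    = [] ∷ []
subsets-ordered (suc n) = AllPairs.++⁺
  (AllPairs.map⁺ (AllPairs.map (λ {S} {T} → ⊈-∷ S T) (subsets-ordered n)))
  (AllPairs.map⁺ (AllPairs.map (λ {S} {T} → ⊈-∷ S T) (subsets-ordered n)))
  (All.map⁺ (All.universal (λ S → All.map⁺ (All.universal (λ T S⊆T → head∉ T (S⊆T here)) (subsets n))) (subsets n)))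
  where
  ⊈-∷ : ∀ (S T : Subset n) {b} → S ⊈ T → b ∷ S ⊈ b ∷ T
  ⊈-∷ S T S⊈T S⊆T = S⊈T λ x∈ → drop-there (S⊆T (there x∈))
  head∉ : ∀ (T : Subset n) → zero ∉ outside ∷ T
  head∉ T ()

allPairs-lookup : ∀ {R : A → A → Set} {xs : List A} → AllPairs R xs →
                  ∀ {i j} → i Fin.< j → R (List.lookup xs i) (List.lookup xs j)
allPairs-lookup (r ∷ _)  {zero}  {suc j} _         = All.lookup r (Membership.∈-lookup j)
allPairs-lookup (_ ∷ rs) {suc i} {suc j} (s≤s i<j) = allPairs-lookup rs i<j

-- Sums of weights over all subsets.

module FaceWeights (ℝ : CompleteOrderedField) where
  open Spheres ℝ public
  open Space using (Pt)

  total-over : List A → (A → Carrier) → Carrier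
  total-over xs f = sum λ i → f (List.lookup xs i)

  total-over-cong : ∀ (xs : List A) {f g : A → Carrier} → (∀ x → f x ≈ g x) → total-over xs f ≈ total-over xs g
  total-over-cong xs e = sum-cong-≋ λ i → e (List.lookup xs i)

  total-over-+ : ∀ (xs : List A) (f g : A → Carrier) → total-over xs (λ x → f x + g x) ≈ total-over xs f + total-over xs g
  total-over-+ []       f g = sym (+-identityʳ 0#)
  total-over-+ (x ∷ xs) f g = trans (+-congˡ (total-over-+ xs f g))
    (solve 4 (λ a b c d → (a :+ b) :+ (c :+ d) := (a :+ c) :+ (b :+ d)) refl (f x) (g x) (total-over xs f) (total-over xs g))

  total-over-* : ∀ (xs : List A) (f : A → Carrier) c → total-over xs (λ x → c * f x) ≈ c * total-over xs f
  total-over-* []       f c = sym (zeroʳ c)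
  total-over-* (x ∷ xs) f c = trans (+-congˡ (total-over-* xs f c))
    (solve 3 (λ a b c → c :* a :+ c :* b := c :* (a :+ b)) refl (f x) (total-over xs f) c)

  total-over-mono : ∀ (xs : List A) {f g : A → Carrier} → (∀ x → f x ≤ g x) → total-over xs f ≤ total-over xs g
  total-over-mono []       f≤g = ≤-refl
  total-over-mono (x ∷ xs) f≤g = +-mono-≤ (f≤g x) (total-over-mono xs f≤g)

  total-over-nonNeg : ∀ (xs : List A) {f : A → Carrier} → (∀ x → 0# ≤ f x) → 0# ≤ total-over xs f
  total-over-nonNeg xs {f} f≥0 = sum-nonNeg {f = λ i → f (List.lookup xs i)} λ i → f≥0 (List.lookup xs i)

  ≤total-over : ∀ (xs : List A) {f : A → Carrier} → (∀ x → 0# ≤ f x) → ∀ {x} → x Membership.∈ xs → f x ≤ total-over xs f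
  ≤total-over (x ∷ xs) {f} f≥0 (here ≡.refl) =
    ≤-respˡ-≈ (+-identityʳ _) (+-mono-≤ ≤-refl (total-over-nonNeg xs f≥0))
  ≤total-over (x ∷ xs) f≥0 (there x∈) =
    ≤-respˡ-≈ (+-identityˡ _) (+-mono-≤ (f≥0 x) (≤total-over xs f≥0 x∈))

  cont-total-over : ∀ {X : Space} (xs : List A) {φ : Pt X → A → Carrier} → (∀ x → Cont X (λ z → φ z x)) →
                    Cont X (λ z → total-over xs (φ z))
  cont-total-over {X = X} xs {φ} c = cont-sum {X} {φ = λ z i → φ z (List.lookup xs i)} λ i → c (List.lookup xs i)

  total-over-pos⁻ : ∀ (xs : List A) {f : A → Carrier} → (∀ x → 0# ≤ f x) → 0# < total-over xs f → ∃ λ x → 0# < f x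
  total-over-pos⁻ []       f≥0 p = ⊥-elim (<-irrefl′ p)
  total-over-pos⁻ (x ∷ xs) {f} f≥0 p with 0≤⇒≈⊎< (f≥0 x)
  ... | inj₂ 0<f = x , 0<f
  ... | inj₁ f≈0 = total-over-pos⁻ xs f≥0 (<-respʳ-≈ (trans (+-congʳ f≈0) (+-identityˡ _)) p)

  total-over-filter : ∀ (h : A → Carrier) (xs : List A) {f : A → Carrier} → (∀ x → ¬ 0# < h x → f x ≈ 0#) →
                      total-over (filter (λ x → 0# <? h x) xs) f ≈ total-over xs f
  total-over-filter h [] _ = refl
  total-over-filter h (x ∷ xs) {f} z with 0# <? h x
  ... | yes p = +-congˡ (total-over-filter h xs z)
  ... | no ¬p = trans (total-over-filter h xs z) (sym (trans (+-congʳ (z x ¬p)) (+-identityˡ _)))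

  at : Subset n → (Subset n → Carrier) → Subset n → Carrier
  at F f T with T ≟ˢ F
  ... | yes _ = f T
  ... | no _  = 0#

  off : Subset n → (Subset n → Carrier) → Subset n → Carrier
  off F f T with T ≟ˢ F
  ... | yes _ = 0#
  ... | no _  = f T

  at+off : ∀ (F : Subset n) f T → f T ≈ at F f T + off F f T
  at+off F f T with T ≟ˢ F
  ... | yes _ = sym (+-identityʳ _)
  ... | no _  = sym (+-identityˡ _)

  at-other : ∀ (F : Subset n) f T → ¬ T ≡ F → at F f T ≈ 0#
  at-other F f T ne with T ≟ˢ F
  ... | yes e = ⊥-elim (ne e)
  ... | no _  = refl

  at-self : ∀ (F : Subset n) f → at F f F ≈ f F
  at-self F f with F ≟ˢ F
  ... | yes _ = refl
  ... | no ne = ⊥-elim (ne ≡.refl)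

  off-other : ∀ (F : Subset n) f T → ¬ T ≡ F → off F f T ≈ f T
  off-other F f T ne with T ≟ˢ F
  ... | yes e = ⊥-elim (ne e)
  ... | no _  = refl

  total-over-at : ∀ {xs : List (Subset n)} (F : Subset n) f → AllPairs _⊈_ xs → F Membership.∈ xs → total-over xs (at F f) ≈ f F
  total-over-at {xs = x ∷ xs} F f (x⊈ ∷ _) (here ≡.refl) = trans (+-cong (at-self F f) (sum-≈0 zeros)) (+-identityʳ _)
    where
    zeros : ∀ i → at F f (List.lookup xs i) ≈ 0#
    zeros i = at-other F f _ λ e → All.lookup x⊈ (Membership.∈-lookup i) λ x∈ → ≡.subst (_ ∈_) (≡.sym e) x∈
  total-over-at {xs = x ∷ xs} F f (x⊈ ∷ o) (there F∈) = trans
    (+-cong (at-other F f x λ { ≡.refl → All.lookup x⊈ F∈ id }) (total-over-at F f o F∈)) (+-identityˡ _)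

  -- Removes the dependence of a coordinate sum on a particular simplex. Vertices are split off one
  -- by one: `at` contributes the value at the first, and `off` vanishes away from the others.
  total-over-vertices : ∀ k (F : Fin k → Subset n) → (∀ {i j} → F i ≡ F j → i ≡ j) →
                        ∀ {f} → (∀ T → (∀ i → ¬ F i ≡ T) → f T ≈ 0#) → total-over (subsets n) f ≈ sum (f ∘ F)
  total-over-vertices {n} zero F _ {f} z = sum-≈0 {f = λ i → f (List.lookup (subsets n) i)} λ i → z _ λ ()
  total-over-vertices {n} (suc k) F inj {f} z = trans (total-over-cong (subsets n) (at+off (F zero) f))
    (trans (total-over-+ (subsets n) (at (F zero) f) (off (F zero) f)) (+-cong
      (total-over-at (F zero) f (subsets-ordered n) (∈-subsets (F zero)))
      (trans (total-over-vertices k (F ∘ suc) (λ e → Fin.suc-injective (inj e)) z′)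
        (sum-cong-≋ λ i → off-other (F zero) f (F (suc i)) λ e → 0≢suc (inj e)))))
    where
    0≢suc : ∀ {i : Fin k} → ¬ suc i ≡ zero
    0≢suc ()
    z′ : ∀ T → (∀ i → ¬ F (suc i) ≡ T) → off (F zero) f T ≈ 0#
    z′ T ne with T ≟ˢ F zero
    ... | yes e = refl
    ... | no ne₀ = z T λ { zero e → ne₀ (≡.sym e) ; (suc i) → ne i }

-- The realization of the order complex in finitely many coordinates.

module Realizations (ℝ : CompleteOrderedField) {n : ℕ} {P : Poset 0ℓ 0ℓ 0ℓ} {Φ : List (Subset (suc n))}
                    (FP : FacePoset P Φ) where
  open FaceWeights ℝ
  open Space using (Pt)
  open FacePoset FP
  open Realization P using (Simplex; Point; CarriedBy; realization)
  open Simplex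
  open Point using (coord)
  private
    module P = Poset P

  Weight : Set
  Weight = Subset (suc n) → Carrier

  total-weight : Weight → Carrier
  total-weight = total-over (subsets (suc n))

  Comparable : Subset (suc n) → Subset (suc n) → Set
  Comparable S T = S ⊆ T ⊎ T ⊆ S

  resolve : ∀ {S T} → S ⊈ T → Comparable S T → T ⊆ S
  resolve S⊈T (inj₁ S⊆T) = ⊥-elim (S⊈T S⊆T)
  resolve S⊈T (inj₂ T⊆S) = T⊆S

  -- Barycentric coordinates without a chosen simplex: only the sets of positive weight have to form
  -- a chain, and `supportSimplex` recovers a simplex from them.
  record Weighting (h : Weight) : Set where
    field
      nonNeg : ∀ T → 0# ≤ h T
      faces  : ∀ T → ¬ Face Φ T → h T ≈ 0#
      total≈1 : total-weight h ≈ 1#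
      chain  : ∀ {S T} → 0# < h S → 0# < h T → Comparable S T

    pos⇒face : ∀ {T} → 0# < h T → Face Φ T
    pos⇒face {T} 0<h = decidable-stable (face? Φ T) λ ¬f → 0<⇒≉ 0<h (faces T ¬f)

  -- `vertex-sum` covers every weight supported where `h` is, so this one simplex carries all points
  -- whose support is contained in that of `h`.
  record SupportSimplex (h : Weight) : Set where
    field
      simplex : Simplex
      pos-vertex : ∀ {T} → 0# < h T → ∃ λ i → face (vertex simplex i) ≡ T
      vertex-sum : ∀ {f : Weight} → (∀ T → 0# ≤ f T) → (∀ T → 0# < f T → 0# < h T) →
                   sum (λ i → f (face (vertex simplex i))) ≈ total-weight f

  supportSimplex : ∀ {h} → Weighting h → SupportSimplex h
  supportSimplex {h} W = build (filter pos? (subsets (suc n)))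
      (All.all-filter pos? (subsets (suc n)))
      (AllPairs.filter⁺ pos? (subsets-ordered (suc n)))
      (λ p → Membership.∈-filter⁺ pos? (∈-subsets _) p)
      (λ f≥0 s → total-over-filter h (subsets (suc n)) λ T ¬p → ≤-antisym (≮⇒≥ λ 0<f → ¬p (s T 0<f)) (f≥0 T))
    where
    open Weighting W
    pos? : ∀ T → Dec (0# < h T)
    pos? T = 0# <? h T
    build : ∀ l → All (λ T → 0# < h T) l → AllPairs _⊈_ l → (∀ {T} → 0# < h T → T Membership.∈ l) →
            (∀ {f : Weight} → (∀ T → 0# ≤ f T) → (∀ T → 0# < f T → 0# < h T) → total-over l f ≈ total-weight f) →
            SupportSimplex h
    build [] _ _ _ t = ⊥-elim (0<⇒≉ 0<1 (sym (trans (t nonNeg λ _ → id) total≈1)))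
    build l@(_ ∷ _) pos ord mem t = record
      { simplex = record { dim = _ ; vertex = v ; increasing = incr }
      ; pos-vertex = λ p → Any.index (mem p) , ≡.trans (face-v (Any.index (mem p))) (≡.sym (Any.lookup-index (mem p)))
      ; vertex-sum = λ {f} f≥0 s → trans (sum-cong-≋ λ i → reflexive (≡.cong f (face-v i))) (t f≥0 s)
      }
      where
      pos-at : ∀ i → 0# < h (List.lookup l i)
      pos-at i = All.lookup pos (Membership.∈-lookup i)
      v : Fin (length l) → P.Carrier
      v i = element (List.lookup l i) (pos⇒face (pos-at i))
      face-v : ∀ i → face (v i) ≡ List.lookup l i
      face-v i = face-element _ _
      incr : ∀ {i j} → i Fin.< j → v i P.≤ v j × ¬ v i P.≈ v j
      incr {i} {j} i<j = reflect j⊆i , λ e → i⊈j λ {p} p∈ →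
          ≡.subst (p ∈_) (≡.trans (≡.sym (face-v i)) (≡.trans (face-cong e) (face-v j))) p∈
        where
        i⊈j : List.lookup l i ⊈ List.lookup l j
        i⊈j = allPairs-lookup ord i<j
        j⊆i : face (v j) ⊆ face (v i)
        j⊆i = ≡.subst₂ _⊆_ (≡.sym (face-v j)) (≡.sym (face-v i))
              (resolve i⊈j (chain (pos-at i) (pos-at j)))

  carried-by-support : ∀ {h} (s : SupportSimplex h) (t : P.Carrier → Carrier) {f : Weight} →
                       (∀ p → t p ≈ f (face p)) → (∀ T → 0# ≤ f T) → total-weight f ≈ 1# →
                       (∀ T → 0# < f T → 0# < h T) → CarriedBy (SupportSimplex.simplex s) t
  carried-by-support {h} s t {f} e f≥0 tot pos =
    (λ p none → ≤-antisym (≮⇒≥ λ 0<t → let (i , eq) = pos-vertex (pos (face p) (<-respʳ-≈ (e p) 0<t)) in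
                  none i (reflect-≈ (≡.sym eq))) (≤-respʳ-≈ (sym (e p)) (f≥0 (face p)))) ,
    trans (sum-cong-≋ λ i → e (vertex simplex i)) (trans (vertex-sum f≥0 pos) tot)
    where open SupportSimplex s

  fromWeights : ∀ {h} → Weighting h → Point
  fromWeights {h} W = record
    { coord   = h ∘ face
    ; cong    = λ p≈q → reflexive (≡.cong h (face-cong p≈q))
    ; nonNeg  = λ p → Weighting.nonNeg W (face p)
    ; carried = SupportSimplex.simplex s ,
                carried-by-support s (h ∘ face) (λ _ → refl) (Weighting.nonNeg W) (Weighting.total≈1 W) (λ _ → id)
    }
    where s = supportSimplex W

  abstract
    -- Extending the coordinates by zero to all subsets replaces the index type `P.Carrier` by a
    -- finite one on which equality is decidable.
    hat : Point → Weight
    hat t T with face? Φ T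
    ... | yes f = coord t (element T f)
    ... | no _  = 0#

    hat-face : ∀ t T (f : Face Φ T) → hat t T ≈ coord t (element T f)
    hat-face t T f with face? Φ T
    ... | yes f′ = Point.cong t (reflect-≈ (≡.trans (face-element T f′) (≡.sym (face-element T f))))
    ... | no ¬f  = ⊥-elim (¬f f)

    hat-nonface : ∀ t T → ¬ Face Φ T → hat t T ≈ 0#
    hat-nonface t T ¬f with face? Φ T
    ... | yes f = ⊥-elim (¬f f)
    ... | no _  = refl

    hat-fromWeights : ∀ {h} (W : Weighting h) T → hat (fromWeights W) T ≈ h T
    hat-fromWeights {h} W T with face? Φ T
    ... | yes f = reflexive (≡.cong h (face-element T f))
    ... | no ¬f = sym (Weighting.faces W T ¬f)

  coord≈hat : ∀ t p → coord t p ≈ hat t (face p)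
  coord≈hat t p = sym (trans (hat-face t (face p) (face-face p)) (Point.cong t (reflect-≈ (face-element _ _))))

  module _ (t : Point) where
    private
      σ = proj₁ (Point.carried t)
      c = proj₂ (Point.carried t)
      F : Fin (suc (dim σ)) → Subset (suc n)
      F = face ∘ vertex σ

      F-ordered : ∀ i j → Comparable (F i) (F j)
      F-ordered i j with Fin.<-cmp i j
      ... | tri< i<j _ _      = inj₂ (reverse (proj₁ (increasing σ i<j)))
      ... | tri≈ _ ≡.refl _   = inj₁ id
      ... | tri> _ _ j<i      = inj₁ (reverse (proj₁ (increasing σ j<i)))

      F-injective : ∀ {i j} → F i ≡ F j → i ≡ j
      F-injective {i} {j} e with Fin.<-cmp i j
      ... | tri< i<j _ _ = ⊥-elim (proj₂ (increasing σ i<j) (reflect-≈ e))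
      ... | tri≈ _ i≡j _ = i≡j
      ... | tri> _ _ j<i = ⊥-elim (proj₂ (increasing σ j<i) (reflect-≈ (≡.sym e)))

      zero-off : ∀ T → (∀ i → ¬ F i ≡ T) → hat t T ≈ 0#
      zero-off T none = [ on-face , hat-nonface t T ]′ (Dec.toSum (face? Φ T))
        where
        on-face : Face Φ T → hat t T ≈ 0#
        on-face f = trans (hat-face t T f) (proj₁ c (element T f) λ i e →
          none i (≡.trans (≡.sym (face-cong e)) (face-element T f)))

      hat≥0 : ∀ T → 0# ≤ hat t T
      hat≥0 T = [ (λ f → ≤-respʳ-≈ (sym (hat-face t T f)) (Point.nonNeg t _))
                , (λ ¬f → ≤-reflexive (sym (hat-nonface t T ¬f))) ]′ (Dec.toSum (face? Φ T))

      pos⇒vertex : ∀ {T} → 0# < hat t T → ∃ λ i → F i ≡ T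
      pos⇒vertex {T} 0<h with Fin.any? (λ i → F i ≟ˢ T)
      ... | yes e   = e
      ... | no none = ⊥-elim (0<⇒≉ 0<h (zero-off T λ i e → none (i , e)))

      hat-chain : ∀ {S T} → 0# < hat t S → 0# < hat t T → Comparable S T
      hat-chain p q = let (i , e) = pos⇒vertex p ; (j , e′) = pos⇒vertex q in
        ≡.subst₂ Comparable e e′ (F-ordered i j)

    hat-weighting : Weighting (hat t)
    hat-weighting = record
      { nonNeg = hat≥0
      ; faces  = hat-nonface t
      ; total≈1 = trans (total-over-vertices (suc (dim σ)) F F-injective zero-off)
                   (trans (sum-cong-≋ λ i → sym (coord≈hat t (vertex σ i))) (proj₂ c))
      ; chain  = hat-chain
      }

  hat-ball⇒open : ∀ {U : Point → Set} →
    (∀ x → U x → ∃ λ ε → 0# < ε × ∀ y → (∀ T → Close ε (hat x T) (hat y T)) → U y) →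
    TopologicalSpace.Open realization U
  hat-ball⇒open o = lift λ σ x cx Ux → let (ε , 0<ε , f) = o x Ux in
    ε , 0<ε , λ y cy close → f y (near σ x y cx cy 0<ε close)
    where
    near : ∀ σ x y {ε} → CarriedBy σ (coord x) → CarriedBy σ (coord y) → 0# < ε →
           (∀ i → Close ε (coord x (vertex σ i)) (coord y (vertex σ i))) → ∀ T → Close ε (hat x T) (hat y T)
    near σ x y {ε} cx cy 0<ε close T = [ on-face , (λ ¬f → close-refl 0<ε (trans (hat-nonface x T ¬f) (sym (hat-nonface y T ¬f)))) ]′
                                       (Dec.toSum (face? Φ T))
      where
      on-face : Face Φ T → Close ε (hat x T) (hat y T)
      on-face f = [ at-vertex , (λ none → close-refl 0<ε (trans (zero-at x cx none) (sym (zero-at y cy none)))) ]′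
                  (Dec.toSum (Fin.any? λ i → face (vertex σ i) ≟ˢ T))
        where
        at-vertex : (∃ λ i → face (vertex σ i) ≡ T) → Close ε (hat x T) (hat y T)
        at-vertex (i , e) = within⇒close (within-resp (+-cong (eq y) (-‿cong (eq x))) (close⇒within (close i)))
          where
          eq : ∀ z → coord z (vertex σ i) ≈ hat z T
          eq z = trans (coord≈hat z (vertex σ i)) (reflexive (≡.cong (hat z) e))
        zero-at : ∀ z → CarriedBy σ (coord z) → ¬ (∃ λ i → face (vertex σ i) ≡ T) → hat z T ≈ 0#
        zero-at z cz none = trans (hat-face z T f) (proj₁ cz (element T f) λ i e →
          none (i , ≡.trans (≡.sym (face-cong e)) (face-element T f)))

  -- Only finitely many supports occur, and for each of them the weak topology
  -- provides a radius.
  hat-open⇒ball : ∀ {U : Point → Set} → TopologicalSpace.Open realization U →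
    ∀ x → U x → ∃ λ ε → 0# < ε × ∀ y → (∀ T → Close ε (hat x T) (hat y T)) → U y
  hat-open⇒ball {U} (lift o) x Ux =
    let (ε , 0<ε , f) = uniform-Subset N R R-mono R-radius in ε , 0<ε , λ y b → f (mask y) y b ≡.refl
    where
    N = length (subsets (suc n))
    mask : Point → Subset N
    mask y = support λ i → hat y (List.lookup (subsets (suc n)) i)
    Near : Carrier → Point → Set
    Near ε y = ∀ T → Close ε (hat x T) (hat y T)
    R : Subset N → Carrier → Set
    R μ ε = ∀ y → Near ε y → mask y ≡ μ → U y
    R-mono : ∀ μ {δ ε} → δ ≤ ε → R μ ε → R μ δ
    R-mono μ δ≤ε r y b = r y λ T → close-mono δ≤ε (b T)
    mask-pos : ∀ y z → mask y ≡ mask z → ∀ T → 0# < hat y T → 0# < hat z T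
    mask-pos y z e T 0<h = ≡.subst (λ S → 0# < hat z S) (≡.sym (Any.lookup-index T∈))
      (∈support⁻ _ (≡.subst (Any.index T∈ ∈_) e
        (∈support⁺ _ (≡.subst (λ S → 0# < hat y S) (Any.lookup-index T∈) 0<h))))
      where T∈ = ∈-subsets T
    positive-bound : ∃ λ ε → 0# < ε × ∀ T → 0# < hat x T → ε ≤ hat x T
    positive-bound = uniform-Subset (suc n) (λ T ε → 0# < hat x T → ε ≤ hat x T)
      (λ T δ≤ε f p → ≤-trans δ≤ε (f p))
      (λ T → [ (λ 0<h → hat x T , 0<h , λ _ → ≤-refl)
             , (λ h≤0 → 1# , 0<1 , λ 0<h → ⊥-elim (≤⇒≯ h≤0 0<h)) ]′ (<-≤-total 0# (hat x T)))
    grows : ∀ {ε} → (∀ T → 0# < hat x T → ε ≤ hat x T) → ∀ y → Near ε y → ∀ T → 0# < hat x T → 0# < hat y T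
    grows {ε} bound y b T 0<h = lt (+-pos-nonNeg (gap< (proj₁ (b T))) (gap≤ (bound T 0<h)))
      (solve 3 (λ x y e → ((y :+ e) :- x) :+ (x :- e) := y :- con (+ 0)) refl (hat x T) (hat y T) ε)
    -- A point with support pattern `μ` whose support contains that of `x`. Its simplex carries `x`
    -- and every point with this pattern, so openness on that simplex gives a radius. Without such a
    -- point the pattern does not occur near `x`, since nearby points are positive wherever `x` is.
    -- The question ranges over all points, hence the use of `excluded-middle`.
    Witness : Subset N → Set
    Witness μ = Σ Point λ y → mask y ≡ μ × (∀ T → 0# < hat x T → 0# < hat y T)
    R-radius : ∀ μ → ∃ λ ε → 0# < ε × R μ ε
    R-radius μ = [ with-witness , without-witness ]′ (excluded-middle (Witness μ))
      where
      with-witness : Witness μ → ∃ λ ε → 0# < ε × R μ ε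
      with-witness (y₀ , my₀ , x⇒y₀) =
        let (ε , 0<ε , f) = o (SupportSimplex.simplex s) x (carry x x⇒y₀) Ux in
        ε , 0<ε , λ y b my → f y (carry y (mask-pos y y₀ (≡.trans my (≡.sym my₀)))) λ i →
          within⇒close (within-resp (+-cong (sym (coord≈hat y _)) (-‿cong (sym (coord≈hat x _)))) (close⇒within (b (face (vertex (SupportSimplex.simplex s) i)))))
        where
        s = supportSimplex (hat-weighting y₀)
        carry : ∀ y → (∀ T → 0# < hat y T → 0# < hat y₀ T) → CarriedBy (SupportSimplex.simplex s) (coord y)
        carry y pos = carried-by-support s (coord y) (coord≈hat y)
          (Weighting.nonNeg (hat-weighting y)) (Weighting.total≈1 (hat-weighting y)) pos
      without-witness : ¬ Witness μ → ∃ λ ε → 0# < ε × R μ ε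
      without-witness none = let (ε , 0<ε , bound) = positive-bound in
        ε , 0<ε , λ y b my → ⊥-elim (none (y , my , grows bound y b))

  realizationSpace : Space
  realizationSpace = record
    { space = ∥ P ∥
    ; Index = Subset (suc n)
    ; uniform = uniform-Subset (suc n)
    ; coord = hat
    ; coord-cong = λ {x} {y} e T → [ (λ f → trans (hat-face x T f) (trans (e (element T f)) (sym (hat-face y T f))))
                                   , (λ ¬f → trans (hat-nonface x T ¬f) (sym (hat-nonface y T ¬f))) ]′ (Dec.toSum (face? Φ T))
    ; coord-injective = λ {x} {y} e p → trans (coord≈hat x p) (trans (e (face p)) (sym (coord≈hat y p)))
    ; open⇒ball = hat-open⇒ball
    ; ball⇒open = hat-ball⇒open
    }

-- The realization is homotopy equivalent to the cone.

module RealizationEquivalence (ℝ : CompleteOrderedField) {n : ℕ} {P : Poset 0ℓ 0ℓ 0ℓ} {Φ : List (Subset (suc n))}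
                              (FP : FacePoset P Φ) where
  open FaceWeights ℝ
  open Space using (Pt)
  open FacePoset FP
  open Realizations ℝ FP
  open Realization P using (Point)

  faceCone : Space
  faceCone = subspaceOf (suc n) λ x → Carried Φ x × NonZero x

  all : List (Subset (suc n))
  all = subsets (suc n)

  incidence : Fin (suc n) → Subset (suc n) → Carrier
  incidence p T = [ (λ _ → 1#) , (λ _ → 0#) ]′ (Dec.toSum (p ∈? T))

  incidence-∈ : ∀ {p T} → p ∈ T → incidence p T ≈ 1#
  incidence-∈ {p} {T} p∈ with p ∈? T
  ... | yes _ = refl
  ... | no p∉ = ⊥-elim (p∉ p∈)

  incidence-∉ : ∀ {p T} → p ∉ T → incidence p T ≈ 0#
  incidence-∉ {p} {T} p∉ with p ∈? T
  ... | yes p∈ = ⊥-elim (p∉ p∈)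
  ... | no _   = refl

  incidence-nonNeg : ∀ p T → 0# ≤ incidence p T
  incidence-nonNeg p T with p ∈? T
  ... | yes _ = <⇒≤ 0<1
  ... | no _  = ≤-refl

  spread : Weight → Coords (suc n)
  spread h p = total-weight (λ T → incidence p T * h T)

  module _ {h : Weight} (h≥0 : ∀ T → 0# ≤ h T) where
    spread-nonNeg : NonNeg (spread h)
    spread-nonNeg p = total-over-nonNeg all λ T → *-nonNeg (incidence-nonNeg p T) (h≥0 T)

    spread-pos⁻ : ∀ {p} → 0# < spread h p → ∃ λ T → p ∈ T × 0# < h T
    spread-pos⁻ {p} 0<s = T , p∈T , *-cancel-pos 0<1 (<-respʳ-≈ (*-congʳ (incidence-∈ p∈T)) (proj₂ term))
      where
      term = total-over-pos⁻ all (λ T → *-nonNeg (incidence-nonNeg p T) (h≥0 T)) 0<s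
      T = proj₁ term
      p∈T : p ∈ T
      p∈T = decidable-stable (p ∈? T) λ p∉ → 0<⇒≉ (proj₂ term) (≈0⇒*≈0ˡ (incidence-∉ p∉))

    spread-pos⁺ : ∀ {p T} → p ∈ T → 0# < h T → 0# < spread h p
    spread-pos⁺ {p} {T} p∈ 0<h = <-≤-trans (<-respʳ-≈ (sym (≈1⇒*≈ʳ (incidence-∈ p∈))) 0<h)
      (≤total-over all (λ T → *-nonNeg (incidence-nonNeg p T) (h≥0 T)) (∈-subsets T))

    spread-mono : ∀ {p q} → (∀ T → 0# < h T → p ∈ T → q ∈ T) → spread h p ≤ spread h q
    spread-mono {p} {q} imp = total-over-mono all λ T → [ (λ h≈0 → ≤-reflexive (trans (vanish h≈0) (sym (vanish h≈0)))) , step T ]′ (0≤⇒≈⊎< (h≥0 T))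
      where
      vanish : ∀ {a b} → b ≈ 0# → a * b ≈ 0#
      vanish e = ≈0⇒*≈0ʳ e
      step : ∀ T → 0# < h T → incidence p T * h T ≤ incidence q T * h T
      step T 0<h = ≤-respˡ-≈ (*-comm _ _) (≤-respʳ-≈ (*-comm _ _) (*-monoʳ-≤ (h≥0 T)
        ([ (λ p∈ → ≤-reflexive (trans (incidence-∈ p∈) (sym (incidence-∈ (imp T 0<h p∈)))))
         , (λ p∉ → ≤-respˡ-≈ (sym (incidence-∉ p∉)) (incidence-nonNeg q T)) ]′ (Dec.toSum (p ∈? T)))))

  -- The largest member of the chain carrying h contains the support of spread h.
  module _ {h : Weight} (W : Weighting h) where
    open Weighting W

    private
      above-all : ∀ xs → AllPairs _⊈_ xs → (∀ {T} → T Membership.∈ xs → ¬ 0# < h T) ⊎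
                  (∃ λ S → 0# < h S × ∀ {T} → T Membership.∈ xs → 0# < h T → T ⊆ S)
      above-all [] _ = inj₁ λ ()
      above-all (S ∷ xs) (r ∷ rs) with <-≤-total 0# (h S)
      ... | inj₁ 0<h = inj₂ (S , 0<h , bound)
        where
        bound : ∀ {T} → T Membership.∈ S ∷ xs → 0# < h T → T ⊆ S
        bound (here ≡.refl) _ = id
        bound (there T∈) 0<hT = resolve (All.lookup r T∈) (chain 0<h 0<hT)
      ... | inj₂ h≤0 with above-all xs rs
      ...   | inj₁ none = inj₁ λ { (here ≡.refl) → ≤⇒≯ h≤0 ; (there T∈) → none T∈ }
      ...   | inj₂ (S′ , 0<h , bound) = inj₂ (S′ , 0<h , bound′)
        where
        bound′ : ∀ {T} → T Membership.∈ S ∷ xs → 0# < h T → T ⊆ S′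
        bound′ (here ≡.refl) 0<hT = ⊥-elim (≤⇒≯ h≤0 0<hT)
        bound′ (there T∈)    0<hT = bound T∈ 0<hT

    largest : ∃ λ S → 0# < h S × ∀ {T} → 0# < h T → T ⊆ S
    largest = [ (λ none → let (T , 0<h) = total-over-pos⁻ all nonNeg (<-respʳ-≈ (sym total≈1) 0<1) in ⊥-elim (none (∈-subsets T) 0<h))
              , (λ (S , 0<h , bound) → S , 0<h , λ {T} → bound (∈-subsets T)) ]′ (above-all all (subsets-ordered (suc n)))

    spread-carried : Carried Φ (spread h)
    spread-carried = let (S , 0<h , bound) = largest in
      carried-by S (spread-nonNeg nonNeg) (proj₂ (pos⇒face 0<h)) λ p 0<s →
        let (T , p∈T , 0<hT) = spread-pos⁻ nonNeg 0<s in bound 0<hT p∈T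

    spread-nonZero : NonZero (spread h)
    spread-nonZero = let (S , 0<h , _) = largest ; (p , p∈S) = proj₁ (pos⇒face 0<h) in
      p , spread-pos⁺ nonNeg p∈S 0<h

    -- Suppose `p` lies in `T` but not in `S`, and `q` in `S` but not in `T`. Every member of the
    -- chain that contains `p` then contains `S`, hence `q`, so the coordinate at `q` is at least
    -- that at `p`. This contradicts that `T` is a superlevel set.
    spread-comparable : ∀ {S T} → 0# < h S → (∀ p q → p ∈ T → q ∉ T → spread h q < spread h p) → Comparable S T
    spread-comparable {S} {T} 0<h super with S ⊆? T
    ... | yes S⊆T = inj₁ S⊆T
    ... | no S⊈T  = inj₂ λ {p} p∈T → decidable-stable (p ∈? S) λ p∉S → S⊈T λ {q} q∈S →
      decidable-stable (q ∈? T) λ q∉T → ≤⇒≯ (spread-mono nonNeg (above q∈S p∉S)) (super p q p∈T q∉T)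
      where
      above : ∀ {p q} → q ∈ S → p ∉ S → ∀ R → 0# < h R → p ∈ R → q ∈ R
      above q∈S p∉S R 0<hR p∈R with chain 0<h 0<hR
      ... | inj₁ S⊆R = S⊆R q∈S
      ... | inj₂ R⊆S = ⊥-elim (p∉S (R⊆S p∈R))

  -- The largest coordinate outside `T`, or 0 if there is no positive one; negation turns the
  -- minimum with default into this maximum.
  outer : Subset (suc n) → Coords (suc n) → Carrier
  outer T x = - minimumFrom (∁ T) (λ p → - x p) 0#

  neg-neg : ∀ a → - - a ≈ a
  neg-neg a = solve 1 (λ a → :- :- a := a) refl a

  ≤outer : ∀ T x {p} → p ∉ T → x p ≤ outer T x
  ≤outer T x {p} p∉ = ≤-respˡ-≈ (neg-neg (x p)) (neg-mono-≤ (minimumFrom≤ (∁ T) (λ p → - x p) 0# (x∉p⇒x∈∁p p∉)))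

  0≤outer : ∀ T x → 0# ≤ outer T x
  0≤outer T x = ≤-respˡ-≈ -0≈0 (neg-mono-≤ (minimumFrom≤d (∁ T) (λ p → - x p) 0#))

  outer-attained : ∀ T x → outer T x ≈ 0# ⊎ ∃ λ p → p ∉ T × outer T x ≈ x p
  outer-attained T x with minimumFrom-attained (∁ T) (λ p → - x p) 0#
  ... | inj₁ e            = inj₁ (trans (-‿cong e) -0≈0)
  ... | inj₂ (p , p∈ , e) = inj₂ (p , x∈∁p⇒x∉p p∈ , trans (-‿cong e) (neg-neg (x p)))

  abstract
    -- Up to scaling, the barycentric coordinate of the superlevel set T of x.
    jump : Coords (suc n) → Weight
    jump x T with face? Φ T
    ... | yes _ = 0# ⊔ (minimumOn T x - outer T x)
    ... | no _  = 0#

    jump-nonNeg : ∀ x T → 0# ≤ jump x T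
    jump-nonNeg x T with face? Φ T
    ... | yes _ = x≤x⊔y _ _
    ... | no _  = ≤-refl

    jump-nonface : ∀ x T → ¬ Face Φ T → jump x T ≈ 0#
    jump-nonface x T ¬f with face? Φ T
    ... | yes f = ⊥-elim (¬f f)
    ... | no _  = refl

    jump-face : ∀ x T → Face Φ T → minimumOn T x - outer T x ≤ jump x T
    jump-face x T f with face? Φ T
    ... | yes _ = x≤y⊔x _ _
    ... | no ¬f = ⊥-elim (¬f f)

    jump-pos⁻ : ∀ x T → 0# < jump x T → 0# < minimumOn T x - outer T x
    jump-pos⁻ x T p with face? Φ T
    ... | no _  = ⊥-elim (<-irrefl′ p)
    ... | yes _ = [ (λ e → ⊥-elim (0<⇒≉ p e)) , (λ e → <-respʳ-≈ e p) ]′ (⊔-sel 0# (minimumOn T x - outer T x))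

    cont-jump : ∀ {X : Space} {ψ : Pt X → Coords (suc n)} → (∀ p → Cont X (λ z → ψ z p)) → ∀ T → Cont X (λ z → jump (ψ z) T)
    cont-jump {X} c T with face? Φ T
    ... | no _  = cont-const {X} 0#
    ... | yes _ = cont-⊔ {X} (cont-const {X} 0#) (cont-sub {X} (cont-minimumOn {X} T c)
                    (cont-neg {X} (cont-minimumFrom {X} (∁ T) (λ p → cont-neg {X} (c p)) (cont-const {X} 0#))))

  jump-above : ∀ x T → 0# < jump x T → ∀ {p} → p ∈ T → outer T x < x p
  jump-above x T p p∈ = <-≤-trans (lt (jump-pos⁻ x T p) refl) (minimumOn≤ T x p∈)

  jump-super : ∀ x T → 0# < jump x T → ∀ p q → p ∈ T → q ∉ T → x q < x p
  jump-super x T 0<j p q p∈ q∉ = ≤-<-trans (≤outer T x q∉) (jump-above x T 0<j p∈)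

  jump-chain : ∀ x {S T} → 0# < jump x S → 0# < jump x T → Comparable S T
  jump-chain x {S} {T} 0<S 0<T with S ⊆? T
  ... | yes S⊆T = inj₁ S⊆T
  ... | no S⊈T  = inj₂ λ {p} p∈T → decidable-stable (p ∈? S) λ p∉S → S⊈T λ {q} q∈S →
    decidable-stable (q ∈? T) λ q∉T → <-asym (jump-super x T 0<T p q p∈T q∉T) (jump-super x S 0<S q p q∈S p∉S)

  -- One positive term is enough. For the set `T` on which `x` attains its maximum, all coordinates
  -- outside are strictly smaller, and `T` is a face because it lies in the support.
  jump-total-pos : ∀ {x} → Carried Φ x → NonZero x → 0# < total-weight (jump x)
  jump-total-pos {x} (x≥0 , a) (p₀ , 0<x₀) = <-≤-trans 0<jump (≤total-over all (jump-nonNeg x) (∈-subsets T))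
    where
    M = maximum x
    0<M : 0# < M
    0<M = <-≤-trans 0<x₀ (≤maximum x p₀)
    T : Subset (suc n)
    T = ∁ (support λ p → M - x p)
    ∈T⇒ : ∀ {p} → p ∈ T → M ≤ x p
    ∈T⇒ {p} p∈ = ≮⇒≥ λ x<M → x∈∁p⇒x∉p p∈ (∈support⁺ (λ p → M - x p) (gap< x<M))
    ∉T⇒ : ∀ {p} → p ∉ T → x p < M
    ∉T⇒ {p} p∉ = lt (∈support⁻ (λ p → M - x p) (x∉∁p⇒x∈p p∉)) refl
    nonempty : Nonempty T
    nonempty = let (p , e) = maximum-attained x in p , x∉p⇒x∈∁p λ p∈ →
      0<⇒≉ (∈support⁻ (λ p → M - x p) p∈) (trans (+-congʳ e) (-‿inverseʳ _))
    f : Face Φ T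
    f = nonempty , avoids-antitone (λ p∈ → ∈support⁺ x (<-≤-trans 0<M (∈T⇒ p∈))) a
    outer<M : outer T x < M
    outer<M = [ (λ e → <-respˡ-≈ (sym e) 0<M) , (λ (p , p∉ , e) → <-respˡ-≈ (sym e) (∉T⇒ p∉)) ]′ (outer-attained T x)
    0<jump : 0# < jump x T
    0<jump = <-≤-trans (gap< (<-≤-trans outer<M (let (p , p∈ , e) = minimumOn-attained T x nonempty in
      ≤-respʳ-≈ (sym e) (∈T⇒ p∈)))) (jump-face x T f)

  abstract
    rescale : ∀ (x : Pt faceCone) → ∃ λ κ → 0# < κ × total-weight (jump (proj₁ x)) * κ ≈ 1#
    rescale (x , c , nz) = positive-inverse _ (jump-total-pos c nz)

  κ : Pt faceCone → Carrier
  κ x = proj₁ (rescale x)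

  0<κ : ∀ x → 0# < κ x
  0<κ x = proj₁ (proj₂ (rescale x))

  levels : Pt faceCone → Weight
  levels x T = κ x * jump (proj₁ x) T

  levels-nonNeg : ∀ x T → 0# ≤ levels x T
  levels-nonNeg x T = *-nonNeg (<⇒≤ (0<κ x)) (jump-nonNeg (proj₁ x) T)

  levels-pos⁻ : ∀ x T → 0# < levels x T → 0# < jump (proj₁ x) T
  levels-pos⁻ x T = *-cancel-pos (0<κ x)

  levels-weighting : ∀ x → Weighting (levels x)
  levels-weighting x = record
    { nonNeg = levels-nonNeg x
    ; faces  = λ T ¬f → ≈0⇒*≈0ʳ (jump-nonface (proj₁ x) T ¬f)
    ; total≈1 = trans (total-over-* all (jump (proj₁ x)) (κ x)) (trans (*-comm _ _) (proj₂ (proj₂ (rescale x))))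
    ; chain  = λ {S} {T} p q → jump-chain (proj₁ x) (levels-pos⁻ x S p) (levels-pos⁻ x T q)
    }

  R : Space
  R = realizationSpace

  cont-hat : ∀ {X : Space} {f : Pt X → Point} {φ : Pt X → Weight} → (∀ z T → hat (f z) T ≈ φ z T) →
             (∀ T → Cont X (λ z → φ z T)) → ∀ T → Cont X (λ z → hat (f z) T)
  cont-hat {X} e c T = cont-≈ {X} (λ z → sym (e z T)) (c T)

  cont-spread : ∀ {X : Space} {φ : Pt X → Weight} → (∀ T → Cont X (λ z → φ z T)) → ∀ p → Cont X (λ z → spread (φ z) p)
  cont-spread {X} c p = cont-total-over {X = X} all λ T → cont-* {X} (cont-const {X} (incidence p T)) (c T)

  cont-levels : ∀ {X : Space} (ψ : Pt X → Pt faceCone) → (∀ p → Cont X (λ z → proj₁ (ψ z) p)) →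
                ∀ T → Cont X (λ z → levels (ψ z) T)
  cont-levels {X} ψ c T = cont-* {X}
    (cont-inverse {X} (λ z → jump-total-pos (proj₁ (proj₂ (ψ z))) (proj₂ (proj₂ (ψ z)))) (λ z → proj₂ (proj₂ (rescale (ψ z))))
      (cont-total-over {X = X} all (cont-jump {X} c)))
    (cont-jump {X} c T)

  toCone : Point → Pt faceCone
  toCone t = spread (hat t) , spread-carried (hat-weighting t) , spread-nonZero (hat-weighting t)

  fromCone : Pt faceCone → Point
  fromCone x = fromWeights (levels-weighting x)

  cont-toCone : ∀ {X : Space} (f : Pt X → Point) → (∀ T → Cont X (λ z → hat (f z) T)) →
                ∀ p → Cont X (λ z → proj₁ (toCone (f z)) p)
  cont-toCone {X} f c = cont-spread {X} c

  toConeMap : ∥ P ∥ ⇒ Space.space faceCone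
  toConeMap = continuousMap R faceCone toCone (cont-toCone {R} id (λ T → cont-coord {R} T))

  fromConeMap : Space.space faceCone ⇒ ∥ P ∥
  fromConeMap = continuousMap faceCone R fromCone (cont-hat {faceCone} (λ x → hat-fromWeights (levels-weighting x))
    (cont-levels {faceCone} id (λ p → cont-coord {faceCone} p)))

  comparable-sym : ∀ {S T} → Comparable S T → Comparable T S
  comparable-sym (inj₁ S⊆T) = inj₂ S⊆T
  comparable-sym (inj₂ T⊆S) = inj₁ T⊆S

  segment : Carrier → Carrier → Carrier → Carrier
  segment s a b = (1# - s) * a + s * b

  segment-0 : ∀ a b → segment 0# a b ≈ a
  segment-0 a b = solve 2 (λ a b → (con (+ 1) :- con (+ 0)) :* a :+ con (+ 0) :* b := a) refl a b

  segment-1 : ∀ a b → segment 1# a b ≈ b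
  segment-1 a b = solve 2 (λ a b → (con (+ 1) :- con (+ 1)) :* a :+ con (+ 1) :* b := b) refl a b

  module _ {s : Carrier} (0≤s : 0# ≤ s) (s≤1 : s ≤ 1#) where
    segment-nonNeg : ∀ {a b} → 0# ≤ a → 0# ≤ b → 0# ≤ segment s a b
    segment-nonNeg p q = +-nonNeg (*-nonNeg (gap≤ s≤1) p) (*-nonNeg 0≤s q)

    segment-pos⁻ : ∀ {a b} → 0# ≤ a → 0# ≤ b → 0# < segment s a b → 0# < a ⊎ 0# < b
    segment-pos⁻ {a} {b} p q 0<c with 0≤⇒≈⊎< p | 0≤⇒≈⊎< q
    ... | inj₂ 0<a | _        = inj₁ 0<a
    ... | inj₁ _   | inj₂ 0<b = inj₂ 0<b
    ... | inj₁ a≈0 | inj₁ b≈0 = ⊥-elim (0<⇒≉ 0<c (trans (+-cong (≈0⇒*≈0ʳ a≈0) (≈0⇒*≈0ʳ b≈0)) (+-identityʳ 0#)))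

    segment-cone : ∀ (x y : Pt faceCone) → (∀ p → 0# < proj₁ x p → 0# < proj₁ y p) →
                   Carried Φ (λ p → segment s (proj₁ x p) (proj₁ y p)) × NonZero (λ p → segment s (proj₁ x p) (proj₁ y p))
    segment-cone (x , (x≥0 , _) , (p , 0<x)) (y , (y≥0 , a) , (q , 0<y)) sub =
      carried-⊆ (y≥0 , a) (λ r → segment-nonNeg (x≥0 r) (y≥0 r))
        (λ r 0<c → [ sub r , id ]′ (segment-pos⁻ (x≥0 r) (y≥0 r) 0<c)) ,
      nz (0≤⇒≈⊎< 0≤s)
      where
      nz : s ≈ 0# ⊎ 0# < s → NonZero (λ p → segment s (x p) (y p))
      nz (inj₂ 0<s) = q , +-nonNeg-pos (*-nonNeg (gap≤ s≤1) (x≥0 q)) (*-pos 0<s 0<y)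
      nz (inj₁ s≈0) = p , +-pos-nonNeg (<-respʳ-≈ (sym (≈1⇒*≈ʳ (1-≈1 s≈0))) 0<x) (*-nonNeg 0≤s (y≥0 p))

    segment-weighting : ∀ {h h′} → Weighting h → Weighting h′ → (∀ {S T} → 0# < h S → 0# < h′ T → Comparable S T) →
                        Weighting (λ T → segment s (h T) (h′ T))
    segment-weighting {h} {h′} W W′ cross = record
      { nonNeg = λ T → segment-nonNeg (W.nonNeg T) (W′.nonNeg T)
      ; faces  = λ T ¬f → trans (+-cong (≈0⇒*≈0ʳ (W.faces T ¬f)) (≈0⇒*≈0ʳ (W′.faces T ¬f))) (+-identityʳ 0#)
      ; total≈1 = trans (total-over-+ all (λ T → (1# - s) * h T) (λ T → s * h′ T))
          (trans (+-cong (trans (total-over-* all h (1# - s)) (*-congˡ W.total≈1)) (trans (total-over-* all h′ s) (*-congˡ W′.total≈1)))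
            (solve 1 (λ s → (con (+ 1) :- s) :* con (+ 1) :+ s :* con (+ 1) := con (+ 1)) refl s))
      ; chain  = λ {S} {T} p q → cases (segment-pos⁻ (W.nonNeg S) (W′.nonNeg S) p) (segment-pos⁻ (W.nonNeg T) (W′.nonNeg T) q)
      }
      where
      module W = Weighting W
      module W′ = Weighting W′
      cases : ∀ {S T} → 0# < h S ⊎ 0# < h′ S → 0# < h T ⊎ 0# < h′ T → Comparable S T
      cases (inj₁ p) (inj₁ q) = W.chain p q
      cases (inj₁ p) (inj₂ q) = cross p q
      cases (inj₂ p) (inj₁ q) = comparable-sym (cross q p)
      cases (inj₂ p) (inj₂ q) = W′.chain p q

  cont-segment : ∀ {X : Space} {σ φ ψ : Pt X → Carrier} → Cont X σ → Cont X φ → Cont X ψ → Cont X (λ z → segment (σ z) (φ z) (ψ z))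
  cont-segment {X} cσ cφ cψ = cont-+ {X} (cont-* {X} (cont-sub {X} (cont-const {X} 1#) cσ) cφ) (cont-* {X} cσ cψ)

  -- A point in a superlevel set that is counted has its coordinate above `outer`, which is
  -- nonnegative. Thus the segment from the round trip to `x` stays over the face carrying `x`.
  round-trip-support : ∀ x p → 0# < proj₁ (toCone (fromCone x)) p → 0# < proj₁ x p
  round-trip-support x p 0<y =
    let (T , p∈T , 0<h) = spread-pos⁻ (Weighting.nonNeg (hat-weighting (fromCone x))) 0<y
    in ≤-<-trans (0≤outer T (proj₁ x))
         (jump-above (proj₁ x) T (levels-pos⁻ x T (<-respʳ-≈ (hat-fromWeights (levels-weighting x) T) 0<h)) p∈T)

  coneSegment : Pt (faceCone ×ₛ interval) → Pt faceCone
  coneSegment (x , s , 0≤s , s≤1) = _ , segment-cone 0≤s s≤1 (toCone (fromCone x)) x (round-trip-support x)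

  toCone∘fromCone : Homotopic (toConeMap ∘ₜ fromConeMap) (idₜ (Space.space faceCone))
  toCone∘fromCone = homotopy {faceCone} {faceCone} (toConeMap ∘ₜ fromConeMap) (idₜ _) coneSegment
    (λ p → cont-segment {Z} (cont-coord {Z} (inj₂ zero))
      (cont-toCone {Z} (λ z → fromCone (proj₁ z)) (cont-hat {Z} (λ z → hat-fromWeights (levels-weighting (proj₁ z)))
        (cont-levels {Z} proj₁ (λ q → cont-coord {Z} (inj₁ q)))) p)
      (cont-coord {Z} (inj₁ p)))
    (λ x p → segment-0 _ _) (λ x p → segment-1 _ _)
    where Z = faceCone ×ₛ interval

  realizationSegment : Pt (R ×ₛ interval) → Point
  realizationSegment (t , s , 0≤s , s≤1) =
    fromWeights (segment-weighting 0≤s s≤1 (levels-weighting (toCone t)) (hat-weighting t) cross)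
    where
    cross : ∀ {S T} → 0# < levels (toCone t) S → 0# < hat t T → Comparable S T
    cross {S} {T} p q = comparable-sym (spread-comparable (hat-weighting t) q
      (jump-super (spread (hat t)) S (levels-pos⁻ (toCone t) S p)))

  realizationSegment-hat : ∀ z T → hat (realizationSegment z) T ≈
    segment (proj₁ (proj₂ z) zero) (levels (toCone (proj₁ z)) T) (hat (proj₁ z) T)
  realizationSegment-hat z T = hat-fromWeights _ T

  fromCone∘toCone : Homotopic (fromConeMap ∘ₜ toConeMap) (idₜ ∥ P ∥)
  fromCone∘toCone = homotopy {R} {R} (fromConeMap ∘ₜ toConeMap) (idₜ ∥ P ∥) realizationSegment
    (cont-hat {Z} realizationSegment-hat λ T → cont-segment {Z} (cont-coord {Z} (inj₂ zero))
      (cont-levels {Z} (λ z → toCone (proj₁ z)) (cont-toCone {Z} proj₁ (λ S → cont-coord {Z} (inj₁ S))) T)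
      (cont-coord {Z} (inj₁ T)))
    (λ t → Space.coord-injective R {realizationSegment (t , 𝕀₀)} {fromCone (toCone t)} λ T →
      trans (realizationSegment-hat (t , 𝕀₀) T) (trans (segment-0 _ (hat t T)) (sym (hat-fromWeights (levels-weighting (toCone t)) T))))
    (λ t → Space.coord-injective R {realizationSegment (t , 𝕀₁)} {t} λ T →
      trans (realizationSegment-hat (t , 𝕀₁) T) (segment-1 _ (hat t T)))
    where Z = R ×ₛ interval

  realization≃cone : ∥ P ∥ ≃ Space.space faceCone
  realization≃cone = toConeMap , fromConeMap , fromCone∘toCone , toCone∘fromCone

-- The Fano plane: the complex, its chosen facets and the collapses of the core.

-- The index i stands for the vector with binary expansion i + 1.
lines : List (Subset 7)
lines = List.map image
  ( Vec.lookup (0F ∷ 1F ∷ 2F ∷ [])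
  ∷ Vec.lookup (0F ∷ 3F ∷ 4F ∷ [])
  ∷ Vec.lookup (0F ∷ 5F ∷ 6F ∷ [])
  ∷ Vec.lookup (1F ∷ 3F ∷ 5F ∷ [])
  ∷ Vec.lookup (1F ∷ 4F ∷ 6F ∷ [])
  ∷ Vec.lookup (2F ∷ 3F ∷ 6F ∷ [])
  ∷ Vec.lookup (2F ∷ 4F ∷ 5F ∷ [])
  ∷ [])

lineComplements : List (Subset 7)
lineComplements = List.map ∁ lines

-- These facets and the collapses below were found by a greedy search.
chosenFacets : Vec (Vec (Fin 7) 4) 8
chosenFacets =
    (1F ∷ 3F ∷ 5F ∷ 6F ∷ [])
  ∷ (0F ∷ 2F ∷ 5F ∷ 6F ∷ [])
  ∷ (2F ∷ 4F ∷ 5F ∷ 6F ∷ [])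
  ∷ (1F ∷ 3F ∷ 4F ∷ 6F ∷ [])
  ∷ (0F ∷ 2F ∷ 3F ∷ 6F ∷ [])
  ∷ (1F ∷ 2F ∷ 3F ∷ 5F ∷ [])
  ∷ (0F ∷ 1F ∷ 3F ∷ 4F ∷ [])
  ∷ (0F ∷ 1F ∷ 4F ∷ 6F ∷ [])
  ∷ []

facetVertex : Fin 8 → Fin 4 → Fin 7
facetVertex i = Vec.lookup (Vec.lookup chosenFacets i)

collapseSequence : List (Collapse 7)
collapseSequence =
    (image (Vec.lookup (2F ∷ 5F ∷ 6F ∷ [])) , 3F)
  ∷ (image (Vec.lookup (3F ∷ 5F ∷ 6F ∷ [])) , 0F)
  ∷ (image (Vec.lookup (1F ∷ 3F ∷ 6F ∷ [])) , 2F)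
  ∷ (image (Vec.lookup (3F ∷ 6F ∷ [])) , 4F)
  ∷ (image (Vec.lookup (2F ∷ 6F ∷ [])) , 1F)
  ∷ (image (Vec.lookup (2F ∷ 3F ∷ 5F ∷ [])) , 4F)
  ∷ (image (Vec.lookup (2F ∷ 3F ∷ [])) , 0F)
  ∷ (⁅ 3F ⁆ , 5F)
  ∷ (⁅ 6F ⁆ , 5F)
  ∷ (⁅ 1F ⁆ , 2F)
  ∷ (⁅ 4F ⁆ , 2F)
  ∷ (⁅ 5F ⁆ , 0F)
  ∷ (⁅ 2F ⁆ , 0F)
  ∷ []

chosenFacet : Fin 8 → Subset 7
chosenFacet i = image (facetVertex i)

coreNonfaces : List (Subset 7)
coreNonfaces = List.tabulate chosenFacet List.++ lineComplements

abstract
  facetVertex-injective : ∀ i j j′ → facetVertex i j ≡ facetVertex i j′ → j ≡ j′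
  facetVertex-injective = from-yes (Fin.all? λ i → Fin.all? λ j → Fin.all? λ j′ →
    (facetVertex i j Fin.≟ facetVertex i j′) →-dec (j Fin.≟ j′))

  chosenFacet-face : ∀ i → Avoids lineComplements (chosenFacet i)
  chosenFacet-face = from-yes (Fin.all? λ i → avoids? lineComplements (chosenFacet i))

  chosenFacet-maximal : ∀ i → ¬ ∃ λ T → Avoids lineComplements T × chosenFacet i ⊆ T × T ⊈ chosenFacet i
  chosenFacet-maximal = from-yes (Fin.all? λ i → ¬? (anySubset? λ T →
    avoids? lineComplements T ×-dec (chosenFacet i ⊆? T) ×-dec ¬? (T ⊆? chosenFacet i)))

  chosenFacet-unique : ∀ i j → chosenFacet i ⊆ chosenFacet j → i ≡ j
  chosenFacet-unique = from-yes (Fin.all? λ i → Fin.all? λ j → (chosenFacet i ⊆? chosenFacet j) →-dec (i Fin.≟ j))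

  -- Proved by evaluation: for each of the thirteen collapses, the 128 subsets are searched for an
  -- obstruction.
  collapseSequence-valid : Valid coreNonfaces collapseSequence
  collapseSequence-valid = from-yes (valid? coreNonfaces collapseSequence)

  apex-face : Avoids coreNonfaces ⁅ 0F ⁆
  apex-face = from-yes (avoids? coreNonfaces ⁅ 0F ⁆)

  collapseSequence-end : ¬ ∃ λ T → Avoids (remaining coreNonfaces collapseSequence) T × T ⊈ ⁅ 0F ⁆
  collapseSequence-end = from-yes (¬? (anySubset? λ T →
    avoids? (remaining coreNonfaces collapseSequence) T ×-dec ¬? (T ⊆? ⁅ 0F ⁆)))

decomposition : Decomposition 6 7 3
decomposition = record
  { nonfaces      = lineComplements
  ; vertex        = facetVertex
  ; injective     = λ i {j} {j′} → facetVertex-injective i j j′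
  ; facet-face    = chosenFacet-face
  ; facet-maximal = λ i {T} a F⊆T {x} x∈ → decidable-stable (T ⊆? chosenFacet i)
                      (λ T⊈ → chosenFacet-maximal i (T , a , F⊆T , T⊈)) x∈
  ; facet-unique  = λ {i} {j} → chosenFacet-unique i j
  ; collapses     = collapseSequence
  ; valid         = collapseSequence-valid
  ; apex          = 0F
  ; apex-core     = apex-face
  ; collapsed     = λ {T} a {x} x∈ → decidable-stable (T ⊆? ⁅ 0F ⁆) (λ T⊈ → collapseSequence-end (T , a , T⊈)) x∈
  }

-- Binary matroids on points of the Fano plane: rank and regularity.

open RawMatroid
open Summation ℙ.+-0-commutativeMonoid using (sum; sum-cong-≗)

private
  variable
    r : ℕ

indicator : Subset n → Vector Parity n
indicator C i = if-inside (Vec.lookup C i)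
  where
  if-inside : Bool → Parity
  if-inside true  = 1ℙ
  if-inside false = 0ℙ

indicator-∈ : ∀ {C : Subset n} {i} → i ∈ C → indicator C i ≡ 1ℙ
indicator-∈ i∈ rewrite Vec.[]=⇒lookup i∈ = ≡.refl

indicator-∉ : ∀ {C : Subset n} {i} → i ∉ C → indicator C i ≡ 0ℙ
indicator-∉ {C = C} {i} i∉ with Vec.lookup C i in eq
... | true  = ⊥-elim (i∉ (Vec.lookup⇒[]= i C eq))
... | false = ≡.refl

SumsToZero : (Fin n → Vector Parity r) → Vector Parity n → Set
SumsToZero v c = ∀ k → sum (λ i → c i ℙ.* v i k) ≡ 0ℙ

-- A linear dependency over 𝔽₂ is determined by its support.
Dependency : (Fin n → Vector Parity r) → Subset n → Subset n → Set
Dependency v I C = C ⊆ I × Nonempty C × SumsToZero v (indicator C)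

Dependent : (Fin n → Vector Parity r) → Subset n → Set
Dependent v I = ∃ (Dependency v I)

dependent? : (v : Fin n → Vector Parity r) (I : Subset n) → Dec (Dependent v I)
dependent? v I = anySubset? λ C → (C ⊆? I) ×-dec nonempty? C ×-dec
  Fin.all? λ k → sum (λ i → indicator C i ℙ.* v i k) ℙ.≟ 0ℙ

indep⇒¬dependent : ∀ {v : Fin n → Vector Parity r} {E I} → Indep (linear v E) I → ¬ Dependent v I
indep⇒¬dependent {I = I} (_ , free) (C , C⊆I , (i , i∈C) , zero-sum) = 1≢0 (≡.trans (≡.sym (indicator-∈ i∈C))
  (free (indicator C) (λ j j∉ → indicator-∉ λ j∈ → j∉ (C⊆I j∈)) zero-sum i))
  where
  1≢0 : ¬ 1ℙ ≡ 0ℙ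
  1≢0 ()

¬dependent⇒indep : ∀ {v : Fin n → Vector Parity r} {E I} → I ⊆ E → ¬ Dependent v I → Indep (linear v E) I
¬dependent⇒indep {v = v} {I = I} I⊆E free = I⊆E , λ c off zero-sum i → decidable-stable (c i ℙ.≟ 0ℙ) λ cᵢ≢0 →
  let C = tabulate λ j → does (c j ℙ.≟ 1ℙ)
      same : ∀ j → indicator C j ≡ c j
      same j = indicator-tabulate c j
      i∈C = ≢0⇒∈ c i cᵢ≢0
  in free (C , (λ {j} j∈ → decidable-stable (j ∈? I) λ j∉ → 1≢0 (≡.trans (≡.sym (indicator-∈ j∈)) (≡.trans (same j) (off j j∉)))) ,
           (i , i∈C) , λ k → ≡.trans (sum-cong-≗ λ j → ≡.cong (ℙ._* v j k) (same j)) (zero-sum k))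
  where
  1≢0 : ¬ 1ℙ ≡ 0ℙ
  1≢0 ()
  indicator-tabulate : ∀ (c : Vector Parity _) j → indicator (tabulate λ j → does (c j ℙ.≟ 1ℙ)) j ≡ c j
  indicator-tabulate c j rewrite Vec.lookup∘tabulate (λ j → does (c j ℙ.≟ 1ℙ)) j with c j
  ... | 0ℙ = ≡.refl
  ... | 1ℙ = ≡.refl
  ≢0⇒∈ : ∀ (c : Vector Parity _) i → ¬ c i ≡ 0ℙ → i ∈ tabulate λ j → does (c j ℙ.≟ 1ℙ)
  ≢0⇒∈ c i c≢0 = Vec.lookup⇒[]= i _ (≡.trans (Vec.lookup∘tabulate _ i) (is-one (c i) c≢0))
    where
    is-one : ∀ a → ¬ a ≡ 0ℙ → does (a ℙ.≟ 1ℙ) ≡ true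
    is-one 0ℙ ne = ⊥-elim (ne ≡.refl)
    is-one 1ℙ _  = ≡.refl

v₃ : Fin 8 → Vector Parity 3
v₃ = vector {3}

-- The subsets of 𝔽₂³ ∖ 0 correspond to subsets of Fin 7.
lifted : Subset 7 → Subset 8
lifted S = outside ∷ S

-- Three distinct nonzero vectors over 𝔽₂ are dependent precisely when they sum to zero, that is,
-- when they form a line.
bases : List (Subset 7)
bases = filter (λ B → (∣ B ∣ ℕ.≟ 3) ×-dec ¬? (Any.any? (B ≟ˢ_) lines)) (subsets 7)

abstract
  lines-dependent : All (λ ℓ → SumsToZero v₃ (indicator (lifted ℓ))) lines
  lines-dependent = from-yes (All.all? (λ ℓ → Fin.all? λ k → sum (λ i → indicator (lifted ℓ) i ℙ.* v₃ i k) ℙ.≟ 0ℙ) lines)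

  lineComplements-dependent : All (λ C → SumsToZero v₃ (indicator (lifted C))) lineComplements
  lineComplements-dependent = from-yes (All.all? (λ ℓ → Fin.all? λ k → sum (λ i → indicator (lifted ℓ) i ℙ.* v₃ i k) ℙ.≟ 0ℙ) lineComplements)

  lines-size : All (λ ℓ → ∣ ℓ ∣ ≡ 3) lines
  lines-size = from-yes (All.all? (λ ℓ → ∣ ℓ ∣ ℕ.≟ 3) lines)

  circuits-nonempty : All Nonempty (lines ++ lineComplements)
  circuits-nonempty = from-yes (All.all? nonempty? (lines ++ lineComplements))

  -- Of the 35 four-point sets, 28 contain a line and the other seven are the complements of lines.
  -- These two families are the circuits of the plane.
  circuit-in-large : ¬ ∃ λ I → 4 ℕ.≤ ∣ I ∣ × ¬ Any (_⊆ I) (lines ++ lineComplements)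
  circuit-in-large = from-yes (¬? (anySubset? λ I → (4 ℕ.≤? ∣ I ∣) ×-dec ¬? (Any.any? (_⊆? I) (lines ++ lineComplements))))

  basis-in-spanning : ¬ ∃ λ S → Avoids lineComplements (∁ S) × ¬ Any (_⊆ S) bases
  basis-in-spanning = from-yes (¬? (anySubset? λ S → avoids? lineComplements (∁ S) ×-dec ¬? (Any.any? (_⊆? S) bases)))

  bases-size : All (λ B → ∣ B ∣ ≡ 3) bases
  bases-size = from-yes (All.all? (λ B → ∣ B ∣ ℕ.≟ 3) bases)

  bases-independent : All (λ B → ¬ Dependent v₃ (lifted B)) bases
  bases-independent = from-yes (All.all? (λ B → ¬? (dependent? v₃ (lifted B))) bases)

circuits : List (Subset 7)
circuits = lines ++ lineComplements

circuits-dependent : All (λ C → SumsToZero v₃ (indicator (lifted C))) circuits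
circuits-dependent = All.++⁺ lines-dependent lineComplements-dependent

⊆∧∣≤∣⇒⊇ : ∀ {p q : Subset n} → p ⊆ q → ∣ q ∣ ℕ.≤ ∣ p ∣ → q ⊆ p
⊆∧∣≤∣⇒⊇ {p = p} p⊆q q≤p {x} x∈q = decidable-stable (x ∈? p) λ x∉p →
  ℕ.<⇒≱ (p⊂q⇒∣p∣<∣q∣ (p⊆q , x , x∈q , x∉p)) q≤p

zero∉nonzero : zero ∉ nonzero 3
zero∉nonzero ()

nonzero⇒suc : ∀ {x} → x ∈ nonzero 3 → ∃ λ y → x ≡ suc y
nonzero⇒suc {zero}  x∈ = ⊥-elim (zero∉nonzero x∈)
nonzero⇒suc {suc y} _  = y , ≡.refl

suc∈nonzero : ∀ {y : Fin 7} → suc y ∈ nonzero 3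
suc∈nonzero = there ∈⊤

nonzero⇒lifted : ∀ {S} → S ⊆ nonzero 3 → S ≡ lifted (Vec.tail S)
nonzero⇒lifted {true ∷ S}  S⊆ = ⊥-elim (zero∉nonzero (S⊆ here))
nonzero⇒lifted {false ∷ S} _  = ≡.refl

lifted⊆nonzero : ∀ {S} → lifted S ⊆ nonzero 3
lifted⊆nonzero = out⊆ ⊆⊤

∈-irrelevant : ∀ {p : Subset n} {x} (a b : x ∈ p) → a ≡ b
∈-irrelevant here      here      = ≡.refl
∈-irrelevant (there a) (there b) = ≡.cong there (∈-irrelevant a b)

-- A minor of a proper subset has fewer than seven elements.
proper⇒¬minor : ∀ {S : Subset 8} (N : RawMatroid 8) → ground N ≡ nonzero 3 → S ⊆ nonzero 3 →
                ∀ t → suc t ∉ S → ¬ HasMinor (⟦_⟧ {3} S) N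
proper⇒¬minor {S} N ≡.refl S⊆ t t∉S (C , D , _ , _ , _ , iso) =
  -- The seven elements of the ground set of `N` come from elements of `S`, which avoid both the
  -- zero vector and `suc t`, so only six places are available.
  let (i , j , i<j , e) = Fin.pigeonhole (ℕ.n<1+n 6) (λ i → punchOut (t≢ i))
  in Fin.<⇒≢ i<j (Fin.suc-injective (≡.cong proj₁ (from-injective i j (Fin.punchOut-injective (t≢ i) (t≢ j) e))))
  where
  open Inverse (_≅_.φ iso) using (from; to; strictlyInverseˡ)
  target : Fin 7 → ∃ (_∈ nonzero 3)
  target i = suc i , suc∈nonzero
  in-S : ∀ i → proj₁ (from (target i)) ∈ S
  in-S i = p─q⊆p S C (p─q⊆p (S ─ C) D (proj₂ (from (target i))))
  index : ∀ i → ∃ λ y → proj₁ (from (target i)) ≡ suc y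
  index i = nonzero⇒suc (S⊆ (in-S i))
  t≢ : ∀ i → ¬ t ≡ proj₁ (index i)
  t≢ i e = t∉S (≡.subst (_∈ S) (≡.trans (proj₂ (index i)) (≡.cong suc (≡.sym e))) (in-S i))
  Σ-≡ : ∀ {p : Subset 8} (a b : ∃ (_∈ p)) → proj₁ a ≡ proj₁ b → a ≡ b
  Σ-≡ (x , x∈) (.x , x∈′) ≡.refl = ≡.cong (x ,_) (∈-irrelevant x∈ x∈′)
  from-injective : ∀ i j → proj₁ (index i) ≡ proj₁ (index j) → target i ≡ target j
  from-injective i j e = ≡.trans (≡.sym (strictlyInverseˡ (target i))) (≡.trans
    (≡.cong to (Σ-≡ (from (target i)) (from (target j))
      (≡.trans (proj₂ (index i)) (≡.trans (≡.cong suc e) (≡.sym (proj₂ (index j)))))))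
    (strictlyInverseˡ (target j)))

-- Nothing is contracted or deleted. Independence in the minor still mentions a basis of the
-- contracted set, which can only be empty, so the two predicates are equivalent without being the
-- same.
F₇-minor : HasMinor F₇ F₇
F₇-minor = Subset.⊥ , Subset.⊥ , (λ x∈ → ⊥-elim (∉⊥ x∈)) , (λ x∈ → ⊥-elim (∉⊥ x∈)) ,
  (λ (x , x∈) → ∉⊥ (proj₁ (x∈p∩q⁻ Subset.⊥ Subset.⊥ x∈))) , record
  { φ = Identity.↔-id _
  ; indep = λ I J I⊆ J⊆ e → ≡.subst (λ J → Indep trivial-minor I ⇔ Indep F₇ J) (same I J I⊆ J⊆ e)
      (mk⇔ (restrict I) (extend I I⊆))
  }
  where
  trivial-minor : RawMatroid 8
  trivial-minor = F₇ / Subset.⊥ ∖ Subset.⊥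
  same : ∀ I J → I ⊆ nonzero 3 → J ⊆ nonzero 3 → (∀ (x : ∃ (_∈ nonzero 3)) → proj₁ x ∈ I ⇔ proj₁ x ∈ J) → I ≡ J
  same I J I⊆ J⊆ e = ⊆-antisym (λ {x} x∈ → Equivalence.to (e (x , I⊆ x∈)) x∈)
                               (λ {x} x∈ → Equivalence.from (e (x , J⊆ x∈)) x∈)
  ∪-empty : ∀ (I B : Subset 8) → B ⊆ Subset.⊥ → I ∪ B ≡ I
  ∪-empty I B B⊆ = ⊆-antisym (λ x∈ → [ id , (λ x∈B → ⊥-elim (∉⊥ (B⊆ x∈B))) ]′ (x∈p∪q⁻ I B x∈)) (p⊆p∪q B)
  empty-indep : Indep F₇ Subset.⊥
  empty-indep = (λ x∈ → ⊥-elim (∉⊥ x∈)) , λ c off _ i → off i ∉⊥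

  ∅-basis : IsBasisOf F₇ Subset.⊥ Subset.⊥
  ∅-basis = (λ x∈ → x∈) , empty-indep , λ _ I⊆∅ _ _ → I⊆∅
  restrict : ∀ I → Indep trivial-minor I → Indep F₇ I
  restrict I (_ , _ , B , (B⊆ , _) , ind) = ≡.subst (Indep F₇) (∪-empty I B B⊆) ind
  extend : ∀ I → I ⊆ nonzero 3 → Indep F₇ I → Indep trivial-minor I
  extend I I⊆ ind = I⊆ , I⊆ , Subset.⊥ , ∅-basis , ≡.subst (Indep F₇) (≡.sym (∪-empty I Subset.⊥ (λ x∈ → x∈))) ind

regular⇒missing : ∀ {S} → S ⊆ nonzero 3 → Regular (⟦_⟧ {3} S) → Nonempty (∁ (Vec.tail S))
regular⇒missing {S} S⊆ (_ , ¬F₇ , _) = decidable-stable (nonempty? (∁ (Vec.tail S))) λ empty →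
  ¬F₇ (≡.subst (λ S → HasMinor (⟦_⟧ {3} S) F₇) (≡.sym (full empty)) F₇-minor)
  where
  full : ¬ Nonempty (∁ (Vec.tail S)) → S ≡ nonzero 3
  full empty = ≡.trans (nonzero⇒lifted S⊆) (⊆-antisym lifted⊆nonzero
    (out⊆ λ {y} _ → x∉∁p⇒x∈p λ y∈ → empty (y , y∈)))

-- If `S` missed the complement of a line, a basis of `S` would lie in that line and, having three
-- elements, be equal to it; but a line is dependent.
rank⇒spanning : ∀ {S} → S ⊆ nonzero 3 → HasRank (⟦_⟧ {3} S) 3 → Avoids lineComplements (∁ (Vec.tail S))
rank⇒spanning {S} S⊆ (B , (B⊆S , ind , _) , ∣B∣≡3) = All.map⁺ (All.tabulate λ {ℓ} → not-in-line ℓ)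
  where
  B≡ = nonzero⇒lifted (λ x∈ → S⊆ (B⊆S x∈))
  B′ = Vec.tail B
  B′⊆S′ : B′ ⊆ Vec.tail S
  B′⊆S′ = drop-∷-⊆ (≡.subst₂ _⊆_ B≡ (nonzero⇒lifted S⊆) B⊆S)
  not-in-line : ∀ ℓ → ℓ Membership.∈ lines → ∁ ℓ ⊈ ∁ (Vec.tail S)
  not-in-line ℓ ℓ∈ ∁ℓ⊆ = indep⇒¬dependent {v = v₃} ind (lifted ℓ ,
      ≡.subst (lifted ℓ ⊆_) (≡.sym B≡) (out⊆ ℓ⊆B′) ,
      (let (i , i∈) = All.lookup circuits-nonempty (Any.++⁺ˡ ℓ∈) in suc i , there i∈) ,
      All.lookup lines-dependent ℓ∈)
    where
    ℓ⊆B′ : ℓ ⊆ B′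
    ℓ⊆B′ = ⊆∧∣≤∣⇒⊇ (λ x∈ → ∁p⊆∁q⇒p⊇q ∁ℓ⊆ (B′⊆S′ x∈))
      (ℕ.≤-reflexive (≡.trans (All.lookup lines-size ℓ∈) (≡.sym (≡.trans (≡.cong ∣_∣ (≡.sym B≡)) ∣B∣≡3))))

-- Both excluded minors have seven elements, so the same count rules them out.
proper⇒regular : ∀ S t → t ∉ S → Regular (⟦_⟧ {3} (lifted S))
proper⇒regular S t t∉S = (3 , v₃ , λ I → mk⇔ id id) ,
  proper⇒¬minor F₇ ≡.refl lifted⊆nonzero t (t∉S ∘ drop-there) ,
  proper⇒¬minor (dual F₇) ≡.refl lifted⊆nonzero t (t∉S ∘ drop-there)

large⇒dependent : ∀ {I : Subset 7} → 4 ℕ.≤ ∣ I ∣ → Dependent v₃ (lifted I)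
large⇒dependent {I} 4≤ with Membership.find (decidable-stable (Any.any? (_⊆? I) circuits) λ none → circuit-in-large (I , 4≤ , none))
... | C , C∈ , C⊆I = lifted C , out⊆ C⊆I ,
      (let (i , i∈) = All.lookup circuits-nonempty C∈ in suc i , there i∈) , All.lookup circuits-dependent C∈

spanning⇒rank : ∀ S → Avoids lineComplements (∁ S) → HasRank (⟦_⟧ {3} (lifted S)) 3
spanning⇒rank S a with Membership.find (decidable-stable (Any.any? (_⊆? S) bases) λ none → basis-in-spanning (S , a , none))
... | B , B∈ , B⊆S = lifted B ,
      (out⊆ B⊆S , ¬dependent⇒indep {v = v₃} (out⊆ B⊆S) (All.lookup bases-independent B∈) , maximal) , All.lookup bases-size B∈
  where
  -- A strictly larger independent set would have at least four elements and hence contain a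
  -- circuit.
  maximal : ∀ I → I ⊆ lifted S → Indep (⟦_⟧ {3} (lifted S)) I → lifted B ⊆ I → I ⊆ lifted B
  maximal I I⊆ ind B⊆I = ⊆∧∣≤∣⇒⊇ B⊆I (ℕ.≮⇒≥ λ B<I → indep⇒¬dependent {v = v₃} ind
    (≡.subst (Dependent v₃) (≡.sym I≡) (large⇒dependent
      (≡.subst₂ (λ b i → suc b ℕ.≤ i) (All.lookup bases-size B∈) (≡.cong ∣_∣ I≡) B<I))))
    where
    I≡ : I ≡ lifted (Vec.tail I)
    I≡ = nonzero⇒lifted (λ x∈ → lifted⊆nonzero (I⊆ x∈))

-- Regularity translates into nonemptiness of the complement, and full rank into the complement
-- being a face.
IR-facePoset : FacePoset (IR 3) lineComplements
IR-facePoset = record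
  { face         = λ (S , _) → ∁ (Vec.tail S)
  ; face-face    = λ (S , S⊆ , reg , rank) → regular⇒missing S⊆ reg , rank⇒spanning S⊆ rank
  ; reverse      = λ {(S , S⊆ , _)} {(S′ , S′⊆ , _)} S⊆S′ →
      p⊆q⇒∁p⊇∁q (drop-∷-⊆ (≡.subst₂ _⊆_ (nonzero⇒lifted S⊆) (nonzero⇒lifted S′⊆) S⊆S′))
  ; reflect      = λ {(S , S⊆ , _)} {(S′ , S′⊆ , _)} ⊇ →
      ≡.subst₂ _⊆_ (≡.sym (nonzero⇒lifted S⊆)) (≡.sym (nonzero⇒lifted S′⊆)) (out⊆ (∁p⊆∁q⇒p⊇q ⊇))
  ; element      = λ T ((t , t∈T) , a) → lifted (∁ T) , lifted⊆nonzero , proper⇒regular (∁ T) t (x∈p⇒x∉∁p t∈T) ,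
      spanning⇒rank (∁ T) (≡.subst (Avoids lineComplements) (≡.sym (∁-involutive T)) a)
  ; face-element = λ T _ → ∁-involutive T
  }
  where
  ∁-involutive : ∀ (T : Subset n) → ∁ (∁ T) ≡ T
  ∁-involutive T = ⊆-antisym (λ x∈ → x∉∁p⇒x∈p (x∈∁p⇒x∉p x∈)) (λ x∈ → x∉p⇒x∈∁p (x∈p⇒x∉∁p x∈))

theorem2p16 : (ℝ : CompleteOrderedField) → let open Topology ℝ in
    ∥ IR 3 ∥ ≃ ⋁ 8 (𝕊 3) (basePoint 3)
theorem2p16 ℝ = Homotopies.≃-trans ℝ
  (RealizationEquivalence.realization≃cone ℝ IR-facePoset)
  (WedgeEquivalence.cone≃wedge ℝ decomposition)
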